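{- Let $r,s$ be positive integers with $s\le r\le n-1$, let $P=P(m_1,\dots,m_{n-1})$ be a natural unit interval order with $m_1=\cdots=m_s=r$ and $m_{s+1}=\cdots=m_{n-1}=n$, and let $G=\mathrm{inc}(P)$. Then $$X_G(\mathbf{x},t)=\sum_{\ell=0}^{\min\{n-r,s\}}t^{(r-s)\ell}\,\frac{[n-r]_t!\,[s]_t!\,[r-\ell-1]_t!\,[n-s-\ell-1]_t!\,[n-2\ell]_t}{[n-r-\ell]_t!\,[s-\ell]_t!\,[r-s-1]_t!}\,e_{(n-\ell,\ell)}.$$ Consequently $X_G(\mathbf{x},t)$ is $e$-positive and $e$-unimodal with center of symmetry $\frac{\binom{n}{2}-(n-r)s}{2}$.
   Context: A natural unit interval order $P(m_1,\dots,m_{n-1})$ is defined for integers $m_1\le\cdots\le m_{n-1}\le n$ with $m_i\ge i$: it is the poset on $[n]$ with $i<_P j$ iff $i<n$ and $j\in\{m_i+1,\dots,n\}$. Its incomparability graph has vertex set $[n]$ and an edge $\{i,j\}$ ($i<j$) iff $j\le m_i$. The chromatic quasisymmetric function of a graph $G$ on $V\subset\mathbb{P}$ is $X_G(\mathbf{x},t)=\sum_\kappa t^{\mathrm{asc}(\kappa)}\prod_v x_{\kappa(v)}$ over proper colorings $\kappa:V\to\mathbb{P}$, with $\mathrm{asc}(\kappa)$ the number of edges $\{i,j\}$, $i<j$, with $\kappa(i)<\kappa(j)$. $[m]_t=1+t+\cdots+t^{m-1}$, $[m]_t!=[1]_t[2]_t\cdots[m]_t$, $[0]_t!=1$; $e_{(n,0)}=e_n$.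 Writing $X_G(\mathbf{x},t)=\sum_{i=0}^m a_i(\mathbf{x})t^i$ with symmetric functions $a_i$, $X_G$ is $e$-positive if each $a_i$ is a nonnegative combination of elementary symmetric functions $e_\lambda$, and $e$-unimodal with center of symmetry $c$ if it is palindromic about $c$ (i.e. $a_i=a_{2c-i}$) and $a_{i+1}-a_i$ is $e$-positive for $0\le i<c$ (equivalently here, every coefficient $C_\lambda(t)$ of $e_\lambda$ is a unimodal polynomial with nonnegative coefficients, palindromic with center $c$).
   Formalization: For r = s the formula contains the undefined factorial [-1]_t!; it is read as 1/[0]_t, with [0]_t kept as a formal symbol and set to 0 after cancellation, so that X_G = [r]_t! [n-r]_t! e_r e_{n-r}. For s < r nothing is changed. -}

module Defs where

open import Data.Bool.Base using (if_then_else_)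
open import Data.Fin.Base as Fin using (Fin; toℕ)
import Data.Fin.Properties as Fin
open import Data.Integer.Base as ℤ using (ℤ; +_; -[1+_]; 0ℤ; 1ℤ; -1ℤ)
open import Data.List.Base as List using (List; []; _∷_; map; foldr; filter; length; replicate; upTo; allFin; cartesianProduct; cartesianProductWith)
open import Data.List.Relation.Unary.All as All using (All)
open import Data.List.Relation.Unary.Linked using (Linked)
open import Data.Nat.Base using (ℕ; zero; suc; _+_; _*_; _∸_; _≤_; _<_; _≥_; z≤n; s≤s)
open import Data.Nat.ListAction using (sum)
open import Data.Nat.Properties using (_≟_; _≤?_; _<?_; <-≤-trans; <-trans; <-irrefl; ≤-<-trans)
open import Data.Product.Base using (Σ; _×_; _,_)
open import Data.Rational.Unnormalised.Base as ℚᵘ using (ℚᵘ)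
open import Data.Sum.Base using (_⊎_)
open import Data.Vec.Base as Vec using (Vec; []; _∷_; lookup; count)
open import Level using (0ℓ)
open import Relation.Binary.Core using (Rel)
open import Relation.Binary.Definitions using (Decidable; Irreflexive; Symmetric)
open import Relation.Binary.Structures using (IsDecStrictPartialOrder)
open import Relation.Binary.PropositionalEquality using (_≡_; _≢_; refl; sym; isEquivalence; resp₂)
open import Relation.Nullary using (¬_; Dec; does; ¬?)
open import Relation.Nullary.Decidable using (_×-dec_; _→-dec_)

-- The vertex v : Fin n stands for the element suc (toℕ v) of [n] = {1,…,n}.
label : ∀ {n} → Fin n → ℕ
label v = suc (toℕ v)

record Graph (n : ℕ) : Set₁ where
  field
    Adj        : Rel (Fin n) 0ℓ
    adj?       : Decidable Adj
    adj-sym    : Symmetric Adj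
    adj-irrefl : Irreflexive _≡_ Adj

-- Only the values m 1, …, m (n ∸ 1) are constrained or ever used.
record NaturalUnitIntervalOrder (n : ℕ) : Set where
  field
    m       : ℕ → ℕ
    m-mono  : ∀ i → 1 ≤ i → suc i < n → m i ≤ m (suc i)
    m-upper : ∀ i → 1 ≤ i → i < n → m i ≤ n
    m-lower : ∀ i → 1 ≤ i → i < n → i ≤ m i

  infix 4 _<ₚ_ _<ₚ?_

  _<ₚ_ : Rel (Fin n) 0ℓ
  i <ₚ j = label i < n × m (label i) < label j

  _<ₚ?_ : Decidable _<ₚ_
  i <ₚ? j = label i <? n ×-dec m (label i) <? label j

  isDecStrictPartialOrder : IsDecStrictPartialOrder _≡_ _<ₚ_
  isDecStrictPartialOrder = record
    { isStrictPartialOrder = record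
      { isEquivalence = isEquivalence
      ; irrefl = λ { {i} refl (i<n , mi<i) →
          <-irrefl refl (≤-<-trans (m-lower (label i) (s≤s z≤n) i<n) mi<i) }
      ; trans = λ { {_} {j} (i<n , mi<j) (j<n , mj<k) →
          i<n , <-trans (<-≤-trans mi<j (m-lower (label j) (s≤s z≤n) j<n)) mj<k }
      ; <-resp-≈ = resp₂ _<ₚ_
      }
    ; _≟_  = Fin._≟_
    ; _<?_ = _<ₚ?_
    }

incomparabilityGraph : ∀ {n} {_≺_ : Rel (Fin n) 0ℓ} →
                       IsDecStrictPartialOrder _≡_ _≺_ → Graph n
incomparabilityGraph {n} {_≺_} po = record
  { Adj        = λ i j → i ≢ j × ¬ (i ≺ j) × ¬ (j ≺ i)
  ; adj?       = λ i j → ¬? (i Fin.≟ j) ×-dec ¬? (i ≺? j) ×-dec ¬? (j ≺? i)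
  ; adj-sym    = λ (i≢j , i⊀j , j⊀i) → (λ j≡i → i≢j (sym j≡i)) , j⊀i , i⊀j
  ; adj-irrefl = λ i≡j (i≢j , _) → i≢j i≡j
  }
  where open IsDecStrictPartialOrder po using () renaming (_<?_ to _≺?_)

inc : ∀ {n} → NaturalUnitIntervalOrder n → Graph n
inc P = incomparabilityGraph (NaturalUnitIntervalOrder.isDecStrictPartialOrder P)

-- Polynomials in t over ℤ: coefficient lists, constant term first.
-- Trailing zeros are allowed, so equality is _≈_.

Poly : Set
Poly = List ℤ

coeff : Poly → ℕ → ℤ
coeff []      _       = 0ℤ
coeff (a ∷ p) zero    = a
coeff (a ∷ p) (suc i) = coeff p i

infix 4 _≈_
_≈_ : Rel Poly 0ℓ
p ≈ q = ∀ i → coeff p i ≡ coeff q i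

0ₚ 1ₚ : Poly
0ₚ = []
1ₚ = 1ℤ ∷ []

infixl 6 _+ₚ_
infixl 7 _*ₚ_ _·ₚ_

_+ₚ_ : Poly → Poly → Poly
[]      +ₚ q       = q
(a ∷ p) +ₚ []      = a ∷ p
(a ∷ p) +ₚ (b ∷ q) = (a ℤ.+ b) ∷ (p +ₚ q)

_·ₚ_ : ℤ → Poly → Poly
c ·ₚ p = map (c ℤ.*_) p

_*ₚ_ : Poly → Poly → Poly
[]      *ₚ q = []
(a ∷ p) *ₚ q = (a ·ₚ q) +ₚ (0ℤ ∷ (p *ₚ q))

sumₚ : List Poly → Poly
sumₚ = foldr _+ₚ_ 0ₚ

t^_ : ℕ → Poly
t^ zero  = 1ₚ
t^ suc k = 0ℤ ∷ (t^ k)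

[_]ₜ : ℕ → Poly
[ k ]ₜ = replicate k 1ℤ

[_]ₜ! : ℕ → Poly
[ zero  ]ₜ! = 1ₚ
[ suc k ]ₜ! = [ k ]ₜ! *ₚ [ suc k ]ₜ

-- Formal power series in x₁, x₂, …: the list α = (α₁,…,α_k) stands for the
-- monomial x₁^α₁ ⋯ x_k^α_k, and a series sends a monomial to its coefficient.

Series : Set
Series = List ℕ → ℤ

Seriesₜ : Set
Seriesₜ = List ℕ → Poly

infix 4 _≈ₛ_
_≈ₛ_ : Rel Seriesₜ 0ℓ
F ≈ₛ H = ∀ α → F α ≈ H α

sumℤ : List ℤ → ℤ
sumℤ = foldr ℤ._+_ 0ℤ

-- All (β , γ) with β + γ = α entrywise.
splits : List ℕ → List (List ℕ × List ℕ)
splits []      = ([] , []) ∷ []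
splits (a ∷ α) = cartesianProductWith (λ b (β , γ) → b ∷ β , (a ∸ b) ∷ γ) (upTo (suc a)) (splits α)

infixl 7 _*ₛ_
_*ₛ_ : Series → Series → Series
(f *ₛ g) α = sumℤ (map (λ (β , γ) → f β ℤ.* g γ) (splits α))

1ₛ : Series
1ₛ α = if does (sum α ≟ 0) then 1ℤ else 0ℤ

infixl 6 _-ₛ_
_-ₛ_ : Series → Series → Series
(f -ₛ g) α = f α ℤ.- g α

-- The squarefree monomials of degree k.
elementary : ℕ → Series
elementary k α = if does (All.all? (_≤? 1) α ×-dec sum α ≟ k) then 1ℤ else 0ℤ

-- Parts equal to 0 contribute the factor e₀ = 1, so e (n ∷ 0 ∷ []) is eₙ.
e : List ℕ → Series
e = foldr (λ k f → elementary k *ₛ f) 1ₛ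

IsPartition : List ℕ → Set
IsPartition μ = Linked _≥_ μ × All (1 ≤_) μ

-- Colorings with colors x₁,…,x_k.
colorings : (n k : ℕ) → List (Vec (Fin k) n)
colorings zero    k = [] ∷ []
colorings (suc n) k = cartesianProductWith _∷_ (allFin k) (colorings n k)

module _ {n : ℕ} (G : Graph n) where
  open Graph G

  Proper : ∀ {k} → Vec (Fin k) n → Set
  Proper κ = ∀ i j → Adj i j → lookup κ i ≢ lookup κ j

  proper? : ∀ {k} (κ : Vec (Fin k) n) → Dec (Proper κ)
  proper? κ = Fin.all? λ i → Fin.all? λ j →
    adj? i j →-dec ¬? (lookup κ i Fin.≟ lookup κ j)

  asc : ∀ {k} → Vec (Fin k) n → ℕ
  asc κ = length (filter
    (λ (i , j) → i Fin.<? j ×-dec adj? i j ×-dec lookup κ i Fin.<? lookup κ j)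
    (cartesianProduct (allFin n) (allFin n)))

-- ∏ᵥ x_{κ(v)} is the monomial α.
HasContent : ∀ {n} (α : List ℕ) → Vec (Fin (length α)) n → Set
HasContent α κ = ∀ c → count (c Fin.≟_) κ ≡ List.lookup α c

hasContent? : ∀ {n} (α : List ℕ) (κ : Vec (Fin (length α)) n) → Dec (HasContent α κ)
hasContent? α κ = Fin.all? λ c → count (c Fin.≟_) κ ≟ List.lookup α c

-- A coloring contributing to the coefficient of x₁^α₁ ⋯ x_k^α_k uses only the
-- colors 1,…,k, so the sum over all κ : V → ℙ is finite in each coefficient.
chromaticQSym : ∀ {n} → Graph n → Seriesₜ
chromaticQSym {n} G α = sumₚ (map (λ κ → t^ asc G κ)
  (filter (λ κ → proper? G κ ×-dec hasContent? α κ) (colorings n (length α))))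

EPositiveSeries : Series → Set
EPositiveSeries f = Σ (List (ℤ × List ℕ)) λ cs →
  All (λ (c , μ) → 0ℤ ℤ.≤ c × IsPartition μ) cs ×
  (∀ α → f α ≡ sumℤ (map (λ (c , μ) → c ℤ.* e μ α) cs))

-- The series a_i in F = Σ a_i tⁱ, with a_i = 0 for i < 0.
coeffₜ : Seriesₜ → ℤ → Series
coeffₜ F (+ i)    α = coeff (F α) i
coeffₜ F -[1+ _ ] α = 0ℤ

EPositive : Seriesₜ → Set
EPositive F = ∀ (i : ℕ) → EPositiveSeries (coeffₜ F (+ i))

Palindromic : Seriesₜ → ℚᵘ → Set
Palindromic F c = ∀ (i j : ℤ) → (i ℚᵘ./ 1) ℚᵘ.+ (j ℚᵘ./ 1) ℚᵘ.≃ c ℚᵘ.+ c →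
  ∀ α → coeffₜ F i α ≡ coeffₜ F j α

EUnimodal : Seriesₜ → ℚᵘ → Set
EUnimodal F c = Palindromic F c ×
  (∀ (i : ℕ) → (+ i ℚᵘ./ 1) ℚᵘ.< c →
    EPositiveSeries (coeffₜ F (+ suc i) -ₛ coeffₜ F (+ i)))

-- The coefficient of e_(n-ℓ,ℓ).
--
-- When r = s the denominator contains [-1]ₜ!, and the numerator may contain
-- [-1]ₜ! and [0]ₜ = 0.  The recursion [0]ₜ! = [0]ₜ [-1]ₜ! forces
-- [-1]ₜ! = 1/[0]ₜ, so z = [0]ₜ is kept as a formal symbol, [-1]ₜ! is z⁻¹, and
-- z is set to 0 only after cancellation.  When s < r no power of z occurs and
-- this is ordinary division in ℤ[t].

infix 5 z^_·_
record ZTerm : Set where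
  constructor z^_·_
  field
    order : ℤ
    part  : Poly
open ZTerm public

infixl 7 _⊗_
_⊗_ : ZTerm → ZTerm → ZTerm
(z^ a · p) ⊗ (z^ b · q) = z^ (a ℤ.+ b) · (p *ₚ q)

⟪_⟫ : Poly → ZTerm
⟪ p ⟫ = z^ 0ℤ · p

-- [k]ₜ
[_]ᶻ : ℕ → ZTerm
[ zero  ]ᶻ = z^ 1ℤ · 1ₚ
[ suc k ]ᶻ = ⟪ [ suc k ]ₜ ⟫

-- [k-1]ₜ!
[_-1]ᶻ! : ℕ → ZTerm
[ zero  -1]ᶻ! = z^ -1ℤ · 1ₚ
[ suc k -1]ᶻ! = ⟪ [ k ]ₜ! ⟫

-- c is the value of N / D at z = 0.  Every D used here has a monic part, so
-- c is unique up to _≈_.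
_IsQuotientOf_by_ : Poly → ZTerm → ZTerm → Set
c IsQuotientOf N by D =
  (order N ≡ order D × c *ₚ part D ≈ part N) ⊎
  (order D ℤ.< order N × c ≈ 0ₚ)

-- For ℓ ≤ min(n-r, s) and s ≤ r ≤ n no subtraction below is truncated.
numerator : (n r s ℓ : ℕ) → ZTerm
numerator n r s ℓ =
  ⟪ t^ ((r ∸ s) * ℓ) ⟫ ⊗ ⟪ [ n ∸ r ]ₜ! ⟫ ⊗ ⟪ [ s ]ₜ! ⟫
    ⊗ [ r ∸ ℓ -1]ᶻ! ⊗ [ n ∸ s ∸ ℓ -1]ᶻ! ⊗ [ n ∸ 2 * ℓ ]ᶻ

denominator : (n r s ℓ : ℕ) → ZTerm
denominator n r s ℓ =
  ⟪ [ n ∸ r ∸ ℓ ]ₜ! ⟫ ⊗ ⟪ [ s ∸ ℓ ]ₜ! ⟫ ⊗ [ r ∸ s -1]ᶻ!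

-- Σ_{ℓ=0}^{k} C_ℓ(t) e_(n-ℓ,ℓ)
twoPartSum : (n k : ℕ) → (ℕ → Poly) → Seriesₜ
twoPartSum n k C α =
  sumₚ (map (λ ℓ → e (n ∸ ℓ ∷ ℓ ∷ []) α ·ₚ C ℓ) (upTo (suc k)))

{-# OPTIONS --safe #-}
module Submission where

-- The graph is complete except that the a = s first (low) vertices are not
-- joined to the b = n-r last (high) ones; let m = r-s.  A color class is thus
-- a single vertex or a low-high pair, and deleting the class of the least
-- color leaves a graph of the same kind.  Hence the coefficient N(a,m,b;α) of
-- x^α in X_G satisfies
--   N(a,m,b; 1∷α) = t^m [a] N(a-1,m,b;α) + t^b [m] N(a,m-1,b;α) + [b] N(a,m,b-1;α)
--   N(a,m,b; 2∷α) = t^m [a][b] N(a-1,m,b-1;α)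
-- and vanishes if α has a part above 2.  The coefficients C_ℓ(a,m,b) of the
-- theorem satisfy the matching recursion
--   C_ℓ + C_{ℓ+1} = t^m [a] C_ℓ(a-1,m,b) + t^b [m] C_ℓ(a,m-1,b) + [b] C_ℓ(a,m,b-1)
-- for m > 0, which reduces to one identity between quantum numbers; for m = 0
-- the graph is a disjoint union of two complete graphs.  Finally C_ℓ is a
-- product of powers of t and quantum numbers, and multiplication by these
-- keeps a polynomial symmetric and unimodal.

open import Data.Nat using (ℕ; _∸_; _*_; _≤_; _<_; _⊓_)
open import Data.Nat.Combinatorics using (_C_)
open import Data.Integer as ℤ using (+_)
open import Data.Rational.Unnormalised as ℚᵘ using (ℚᵘ)
open import Data.Product using (∃; _×_)
open import Relation.Binary.PropositionalEquality using (_≡_)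
open import Defs

open import Algebra.Bundles using (CommutativeMonoid; CommutativeSemiring; Monoid)
import Algebra.Properties.CommutativeMonoid.Sum as CommutativeMonoidSum
import Algebra.Properties.CommutativeSemigroup as CommutativeSemigroupProperties
import Algebra.Properties.Semiring.Sum as SemiringSum
import Algebra.Solver.Ring.NaturalCoefficients.Default as SemiringSolver
open import Algebra.Structures.Biased using (isCommutativeSemiringˡ)
open import Data.Bool using (Bool; true; false; if_then_else_)
open import Data.Fin as Fin using (Fin; zero; suc; toℕ)
import Data.Fin.Properties as Fin
open import Data.Integer using (ℤ; -[1+_]; 0ℤ; 1ℤ; -1ℤ)
import Data.Integer.Properties as ℤ
open import Data.Integer.Tactic.RingSolver using () renaming (solve-∀ to solveℤ-∀)
open import Data.List as List using (List; []; _∷_; _++_; map; filter; length; replicate; upTo; allFin; applyUpTo; cartesianProduct; cartesianProductWith)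
import Data.List.Properties as List
open import Data.List.Relation.Unary.All as All using (All; []; _∷_)
import Data.List.Relation.Unary.All.Properties as All
open import Data.List.Relation.Unary.Linked using ([-]; _∷_)
open import Data.Nat using (zero; suc; pred; _+_; _≤?_; _<?_; z≤n; s≤s)
open import Data.Nat.Combinatorics using (nC1≡n; nCk+nC[k+1]≡[n+1]C[k+1])
import Data.Nat.Properties as ℕ
open import Data.Nat.Tactic.RingSolver using (solve-∀)
open import Data.Product using (_,_)
open import Data.Sum using (_⊎_; inj₁; inj₂)
open import Data.Vec as Vec using (Vec; []; _∷_; lookup; count; fromList; _[_]≔_)
import Data.Vec.Properties as Vec
open import Function using (_∘_; id)
open import Level using (0ℓ)
open import Relation.Binary using (IsEquivalence; tri<; tri≈; tri>)
import Relation.Binary.Reasoning.Setoid as SetoidReasoning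
open import Relation.Binary.PropositionalEquality as ≡ using (_≢_; cong; cong₂; module ≡-Reasoning)
open import Relation.Nullary using (¬_; Dec; yes; no; does; contradiction; ¬?)
open import Relation.Nullary.Decidable using (dec-true; _×-dec_; _→-dec_)

-- The case m = 0 is separate because there the recursion can fail coefficient by coefficient. For m
-- > 0, removing one vertex leaves n - 1 ≥ 2 min(a,b), so every product e_i e_j that occurs has j ≤
-- min(a,b) ≤ i, and none occurs a second time as e_j e_i. For m = 0 and a = b, at ℓ = a, the left
-- side is [a]! [a]! and the right side is 0: the two sides of the expansion agree only once e_i e_j
-- is identified with e_j e_i. The disjoint union is therefore computed directly, and the symmetry
-- of the product enters exactly there. The comparison is made at every monomial α, so the symmetry
-- of X_G is a result and not an input. The main obstacle on the combinatorial side is that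
-- colorings are enumerated vertex by vertex, while the recursion removes a color. The sums
-- therefore carry a weight per block and color, which remembers the vertices treated before and can
-- be split by color.

module ListFold (M : Monoid 0ℓ 0ℓ) where

  open Monoid M renaming (_≈_ to _≐_)

  -- Instantiated at the integers under addition and at the polynomials under addition and under
  -- multiplication; `sumℤ` and `sumₚ` are instances by computation.
  fold : List Carrier → Carrier
  fold = List.foldr _∙_ ε

  fold-++ : ∀ xs ys → fold (xs ++ ys) ≐ fold xs ∙ fold ys
  fold-++ []       ys = sym (identityˡ _)
  fold-++ (x ∷ xs) ys = trans (∙-congˡ (fold-++ xs ys)) (sym (assoc x _ _))

  fold-cong : ∀ {A : Set} {f g : A → Carrier} → (∀ x → f x ≐ g x) → ∀ xs → fold (map f xs) ≐ fold (map g xs)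
  fold-cong f≐g []       = refl
  fold-cong f≐g (x ∷ xs) = ∙-cong (f≐g x) (fold-cong f≐g xs)

  fold-cartesianProductWith : ∀ {A B D : Set} (f : D → Carrier) (g : A → B → D) xs ys →
    fold (map f (cartesianProductWith g xs ys)) ≐ fold (map (λ x → fold (map (λ y → f (g x y)) ys)) xs)
  fold-cartesianProductWith f g []       ys = refl
  fold-cartesianProductWith f g (x ∷ xs) ys = trans
    (reflexive (cong fold (List.map-++ f (map (g x) ys) _)))
    (trans (fold-++ (map f (map (g x) ys)) _)
      (∙-cong (reflexive (cong fold (≡.sym (List.map-∘ ys)))) (fold-cartesianProductWith f g xs ys)))

  -- Turns the sum over proper colorings of given content into an unrestricted sum, and the count of
  -- ascents into an unrestricted product.
  fold-filter : ∀ {A : Set} {P : A → Set} (P? : ∀ x → Dec (P x)) (f : A → Carrier) xs →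
    fold (map f (filter P? xs)) ≐ fold (map (λ x → if does (P? x) then f x else ε) xs)
  fold-filter P? f []       = refl
  fold-filter P? f (x ∷ xs) with does (P? x)
  ... | true  = ∙-congˡ (fold-filter P? f xs)
  ... | false = trans (fold-filter P? f xs) (sym (identityˡ _))

-- Polynomials as a commutative semiring

-- _≈_ unfolds to a function type, from which its arguments cannot
-- be inferred; the record keeps them visible.
infix 4 _≋_
record _≋_ (p q : Poly) : Set where
  constructor coeffwise
  field
    coeff-≡ : p ≈ q
open _≋_ public

coeff-+ : ∀ p q i → coeff (p +ₚ q) i ≡ coeff p i ℤ.+ coeff q i
coeff-+ []      q       i       = ≡.sym (ℤ.+-identityˡ _)
coeff-+ (a ∷ p) []      i       = ≡.sym (ℤ.+-identityʳ _)
coeff-+ (a ∷ p) (b ∷ q) zero    = ≡.refl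
coeff-+ (a ∷ p) (b ∷ q) (suc i) = coeff-+ p q i

coeff-· : ∀ c p i → coeff (c ·ₚ p) i ≡ c ℤ.* coeff p i
coeff-· c []      i       = ≡.sym (ℤ.*-zeroʳ c)
coeff-· c (a ∷ p) zero    = ≡.refl
coeff-· c (a ∷ p) (suc i) = coeff-· c p i

≋-isEquivalence : IsEquivalence _≋_
≋-isEquivalence = record
  { refl  = coeffwise λ _ → ≡.refl
  ; sym   = λ (coeffwise f) → coeffwise λ i → ≡.sym (f i)
  ; trans = λ (coeffwise f) (coeffwise g) → coeffwise λ i → ≡.trans (f i) (g i)
  }

module Additive where

  private module E = IsEquivalence ≋-isEquivalence

  +ₚ-cong : ∀ {p p′ q q′} → p ≋ p′ → q ≋ q′ → p +ₚ q ≋ p′ +ₚ q′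
  +ₚ-cong {p} {p′} {q} {q′} (coeffwise f) (coeffwise g) = coeffwise λ i →
    ≡.trans (coeff-+ p q i) (≡.trans (cong₂ ℤ._+_ (f i) (g i)) (≡.sym (coeff-+ p′ q′ i)))

  +ₚ-assoc : ∀ p q r → (p +ₚ q) +ₚ r ≋ p +ₚ (q +ₚ r)
  +ₚ-assoc p q r = coeffwise λ i → begin
    coeff ((p +ₚ q) +ₚ r) i                    ≡⟨ coeff-+ (p +ₚ q) r i ⟩
    coeff (p +ₚ q) i ℤ.+ coeff r i             ≡⟨ cong (ℤ._+ _) (coeff-+ p q i) ⟩
    coeff p i ℤ.+ coeff q i ℤ.+ coeff r i      ≡⟨ ℤ.+-assoc (coeff p i) (coeff q i) (coeff r i) ⟩
    coeff p i ℤ.+ (coeff q i ℤ.+ coeff r i)    ≡⟨ cong₂ ℤ._+_ (≡.refl {x = coeff p i}) (coeff-+ q r i) ⟨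
    coeff p i ℤ.+ coeff (q +ₚ r) i             ≡⟨ coeff-+ p (q +ₚ r) i ⟨
    coeff (p +ₚ (q +ₚ r)) i                    ∎
    where open ≡-Reasoning

  +ₚ-comm : ∀ p q → p +ₚ q ≋ q +ₚ p
  +ₚ-comm p q = coeffwise λ i →
    ≡.trans (coeff-+ p q i) (≡.trans (ℤ.+-comm (coeff p i) _) (≡.sym (coeff-+ q p i)))

  +ₚ-identityʳ : ∀ p → p +ₚ 0ₚ ≋ p
  +ₚ-identityʳ []      = E.refl
  +ₚ-identityʳ (a ∷ p) = E.refl

  ·ₚ-cong : ∀ c {p q} → p ≋ q → c ·ₚ p ≋ c ·ₚ q
  ·ₚ-cong c {p} {q} (coeffwise f) = coeffwise λ i →
    ≡.trans (coeff-· c p i) (≡.trans (cong (c ℤ.*_) (f i)) (≡.sym (coeff-· c q i)))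

  ∷-cong : ∀ {a b p q} → a ≡ b → p ≋ q → a ∷ p ≋ b ∷ q
  ∷-cong a≡b (coeffwise f) = coeffwise λ { zero → a≡b ; (suc i) → f i }

  0∷0 : 0ℤ ∷ [] ≋ 0ₚ
  0∷0 = coeffwise λ { zero → ≡.refl ; (suc i) → ≡.refl }

  ·ₚ-distribʳ : ∀ a b p → (a ℤ.+ b) ·ₚ p ≋ a ·ₚ p +ₚ b ·ₚ p
  ·ₚ-distribʳ a b []      = E.refl
  ·ₚ-distribʳ a b (c ∷ p) = ∷-cong (ℤ.*-distribʳ-+ c a b) (·ₚ-distribʳ a b p)

  ·ₚ-distribˡ : ∀ c p q → c ·ₚ (p +ₚ q) ≋ c ·ₚ p +ₚ c ·ₚ q
  ·ₚ-distribˡ c []      q       = E.refl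
  ·ₚ-distribˡ c (a ∷ p) []      = E.refl
  ·ₚ-distribˡ c (a ∷ p) (b ∷ q) = ∷-cong (ℤ.*-distribˡ-+ c a b) (·ₚ-distribˡ c p q)

  ·ₚ-assoc : ∀ a b p → (a ℤ.* b) ·ₚ p ≋ a ·ₚ (b ·ₚ p)
  ·ₚ-assoc a b []      = E.refl
  ·ₚ-assoc a b (c ∷ p) = ∷-cong (ℤ.*-assoc a b c) (·ₚ-assoc a b p)

  ·ₚ-zero : ∀ p → 0ℤ ·ₚ p ≋ 0ₚ
  ·ₚ-zero []      = E.refl
  ·ₚ-zero (a ∷ p) = E.trans (∷-cong ≡.refl (·ₚ-zero p)) 0∷0

  ·ₚ-identity : ∀ p → 1ℤ ·ₚ p ≋ p
  ·ₚ-identity []      = E.refl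
  ·ₚ-identity (a ∷ p) = ∷-cong (ℤ.*-identityˡ a) (·ₚ-identity p)

  ·ₚ-shift : ∀ c p → c ·ₚ (0ℤ ∷ p) ≋ 0ℤ ∷ c ·ₚ p
  ·ₚ-shift c p = ∷-cong (ℤ.*-zeroʳ c) E.refl

module Multiplicative where

  open Additive
  private module E = IsEquivalence ≋-isEquivalence
  private +-semigroup = record
            { isCommutativeSemigroup = record
              { isSemigroup = record
                { isMagma = record { isEquivalence = ≋-isEquivalence ; ∙-cong = +ₚ-cong }
                ; assoc   = +ₚ-assoc
                }
              ; comm = +ₚ-comm
              }
            }
  open CommutativeSemigroupProperties +-semigroup using (interchange; x∙yz≈y∙xz)

  *ₚ-congʳ : ∀ p {q q′} → q ≋ q′ → p *ₚ q ≋ p *ₚ q′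
  *ₚ-congʳ []      q≋q′ = E.refl
  *ₚ-congʳ (a ∷ p) q≋q′ = +ₚ-cong (·ₚ-cong a q≋q′) (∷-cong ≡.refl (*ₚ-congʳ p q≋q′))

  *ₚ-zeroʳ : ∀ p → p *ₚ 0ₚ ≋ 0ₚ
  *ₚ-zeroʳ []      = E.refl
  *ₚ-zeroʳ (a ∷ p) = E.trans (∷-cong ≡.refl (*ₚ-zeroʳ p)) 0∷0

  -- The mirror image of the defining clause of `_*ₚ_`, which recurses on the left; with it
  -- commutativity is an induction.
  *ₚ-∷ʳ : ∀ p b q → p *ₚ (b ∷ q) ≋ b ·ₚ p +ₚ (0ℤ ∷ p *ₚ q)
  *ₚ-∷ʳ []      b q = E.sym 0∷0
  *ₚ-∷ʳ (a ∷ p) b q = ∷-cong (cong (ℤ._+ 0ℤ) (ℤ.*-comm a b))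
    (E.trans (+ₚ-cong E.refl (*ₚ-∷ʳ p b q)) (x∙yz≈y∙xz (a ·ₚ q) (b ·ₚ p) _))

  *ₚ-comm : ∀ p q → p *ₚ q ≋ q *ₚ p
  *ₚ-comm []      q = E.sym (*ₚ-zeroʳ q)
  *ₚ-comm (a ∷ p) q = E.trans (+ₚ-cong E.refl (∷-cong ≡.refl (*ₚ-comm p q))) (E.sym (*ₚ-∷ʳ q a p))

  -- Equal polynomials may be lists of different lengths, so congruence in the left factor does not
  -- follow the recursion; it is obtained from the right factor by commutativity.
  *ₚ-cong : ∀ {p p′ q q′} → p ≋ p′ → q ≋ q′ → p *ₚ q ≋ p′ *ₚ q′
  *ₚ-cong {p} {p′} {q} {q′} p≋p′ q≋q′ = E.trans (*ₚ-congʳ p q≋q′)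
    (E.trans (*ₚ-comm p q′) (E.trans (*ₚ-congʳ q′ p≋p′) (*ₚ-comm q′ p′)))

  *ₚ-distribʳ : ∀ r p q → (p +ₚ q) *ₚ r ≋ p *ₚ r +ₚ q *ₚ r
  *ₚ-distribʳ r []      q       = E.refl
  *ₚ-distribʳ r (a ∷ p) []      = E.sym (+ₚ-identityʳ _)
  *ₚ-distribʳ r (a ∷ p) (b ∷ q) = E.trans
    (+ₚ-cong (·ₚ-distribʳ a b r) (∷-cong ≡.refl (*ₚ-distribʳ r p q)))
    (interchange (a ·ₚ r) (b ·ₚ r) (0ℤ ∷ p *ₚ r) (0ℤ ∷ q *ₚ r))

  ·ₚ-*ₚ : ∀ c p q → (c ·ₚ p) *ₚ q ≋ c ·ₚ (p *ₚ q)
  ·ₚ-*ₚ c []      q = E.refl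
  ·ₚ-*ₚ c (a ∷ p) q = E.trans
    (+ₚ-cong (·ₚ-assoc c a q) (E.trans (∷-cong ≡.refl (·ₚ-*ₚ c p q)) (E.sym (·ₚ-shift c (p *ₚ q)))))
    (E.sym (·ₚ-distribˡ c (a ·ₚ q) (0ℤ ∷ p *ₚ q)))

  shift-*ₚ : ∀ p q → (0ℤ ∷ p) *ₚ q ≋ 0ℤ ∷ p *ₚ q
  shift-*ₚ p q = +ₚ-cong (·ₚ-zero q) E.refl

  *ₚ-assoc : ∀ p q r → (p *ₚ q) *ₚ r ≋ p *ₚ (q *ₚ r)
  *ₚ-assoc []      q r = E.refl
  *ₚ-assoc (a ∷ p) q r = E.trans (*ₚ-distribʳ r (a ·ₚ q) (0ℤ ∷ p *ₚ q))
    (+ₚ-cong (·ₚ-*ₚ a q r) (E.trans (shift-*ₚ (p *ₚ q) r) (∷-cong ≡.refl (*ₚ-assoc p q r))))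

  *ₚ-identityˡ : ∀ p → 1ₚ *ₚ p ≋ p
  *ₚ-identityˡ p = E.trans (+ₚ-cong (·ₚ-identity p) 0∷0) (+ₚ-identityʳ p)

polySemiring : CommutativeSemiring 0ℓ 0ℓ
polySemiring = record
  { _≈_ = _≋_ ; _+_ = _+ₚ_ ; _*_ = _*ₚ_ ; 0# = 0ₚ ; 1# = 1ₚ
  ; isCommutativeSemiring = isCommutativeSemiringˡ record
    { +-isCommutativeMonoid = record
      { isMonoid = record
        { isSemigroup = record
          { isMagma = record { isEquivalence = ≋-isEquivalence ; ∙-cong = +ₚ-cong }
          ; assoc   = +ₚ-assoc
          }
        ; identity = (λ _ → E.refl) , +ₚ-identityʳ
        }
      ; comm = +ₚ-comm
      }
    ; *-isCommutativeMonoid = record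
      { isMonoid = record
        { isSemigroup = record
          { isMagma = record { isEquivalence = ≋-isEquivalence ; ∙-cong = *ₚ-cong }
          ; assoc   = *ₚ-assoc
          }
        ; identity = *ₚ-identityˡ , λ p → E.trans (*ₚ-comm p 1ₚ) (*ₚ-identityˡ p)
        }
      ; comm = *ₚ-comm
      }
    ; distribʳ = *ₚ-distribʳ
    ; zeroˡ    = λ _ → E.refl
    }
  }
  where
  open Additive
  open Multiplicative
  module E = IsEquivalence ≋-isEquivalence

open CommutativeSemiring polySemiring using (refl; sym; trans; reflexive; setoid; semiring; +-commutativeMonoid; *-commutativeMonoid; +-cong; +-congˡ; +-congʳ; +-assoc; +-identityʳ; *-cong; *-congˡ; *-congʳ; *-assoc; *-comm; *-identityˡ; *-identityʳ; distribˡ; distribʳ; zeroˡ; zeroʳ)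
open SetoidReasoning setoid
open SemiringSolver polySemiring using (solve; _:+_; _:*_; _:=_; con)
open SemiringSum semiring using (sum; *-distribˡ-sum)
open CommutativeMonoidSum +-commutativeMonoid using (sum-cong-≋)
open CommutativeMonoidSum *-commutativeMonoid using () renaming (sum to product; sum-cong-≋ to product-cong; ∑-distrib-+ to product-distrib-*)

-- Quantum numbers

t : Poly
t = t^ 1

t-shift : ∀ p → 0ℤ ∷ p ≋ t *ₚ p
t-shift p = sym (trans (Multiplicative.shift-*ₚ 1ₚ p) (Additive.∷-cong ≡.refl (*-identityˡ p)))

t^-suc : ∀ k → t^ suc k ≋ t *ₚ t^ k
t^-suc k = t-shift (t^ k)

t^-+ : ∀ i j → t^ (i + j) ≋ t^ i *ₚ t^ j
t^-+ zero    j = sym (*-identityˡ _)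
t^-+ (suc i) j = begin
  t^ suc (i + j)             ≈⟨ t^-suc (i + j) ⟩
  t *ₚ t^ (i + j)            ≈⟨ *-congˡ {t} (t^-+ i j) ⟩
  t *ₚ (t^ i *ₚ t^ j)        ≈⟨ *-assoc t (t^ i) (t^ j) ⟨
  t *ₚ t^ i *ₚ t^ j          ≈⟨ *-congʳ (t^-suc i) ⟨
  t^ suc i *ₚ t^ j           ∎

[suc] : ∀ k → [ suc k ]ₜ ≋ 1ₚ +ₚ t *ₚ [ k ]ₜ
[suc] k = +-congˡ {1ₚ} (t-shift [ k ]ₜ)

-- Over u = t - 1 the quantum numbers satisfy subtraction-free identities:
-- t^k = 1 + u[k] and [i+j] = [i] + [j] + u[i][j].
u : Poly
u = -1ℤ ∷ 1ℤ ∷ []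

t^≋ : ∀ k → t^ k ≋ 1ₚ +ₚ u *ₚ [ k ]ₜ
t^≋ zero    = coeffwise λ { zero → ≡.refl ; (suc zero) → ≡.refl ; (suc (suc i)) → ≡.refl }
t^≋ (suc k) = begin
  t^ suc k                                       ≈⟨ t^-suc k ⟩
  t *ₚ t^ k                                      ≈⟨ *-congˡ {t} (t^≋ k) ⟩
  -- `t` is `1ₚ +ₚ u` by computation.
  (1ₚ +ₚ u) *ₚ (1ₚ +ₚ u *ₚ [ k ]ₜ)               ≈⟨ solve 2 (λ v x → (con 1 :+ v) :* (con 1 :+ v :* x) := con 1 :+ v :* (con 1 :+ (con 1 :+ v) :* x)) refl u [ k ]ₜ ⟩
  1ₚ +ₚ u *ₚ (1ₚ +ₚ t *ₚ [ k ]ₜ)                 ≈⟨ +-congˡ {1ₚ} (*-congˡ {u} ([suc] k)) ⟨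
  1ₚ +ₚ u *ₚ [ suc k ]ₜ                          ∎

[+] : ∀ i j → [ i + j ]ₜ ≋ [ i ]ₜ +ₚ t^ i *ₚ [ j ]ₜ
[+] zero    j = sym (*-identityˡ _)
[+] (suc i) j = begin
  [ suc i + j ]ₜ                                 ≈⟨ [suc] (i + j) ⟩
  1ₚ +ₚ t *ₚ [ i + j ]ₜ                          ≈⟨ +-congˡ {1ₚ} (*-congˡ {t} ([+] i j)) ⟩
  1ₚ +ₚ t *ₚ ([ i ]ₜ +ₚ t^ i *ₚ [ j ]ₜ)          ≈⟨ solve 4 (λ t x p y → con 1 :+ t :* (x :+ p :* y) := (con 1 :+ t :* x) :+ t :* p :* y) refl t [ i ]ₜ (t^ i) [ j ]ₜ ⟩
  (1ₚ +ₚ t *ₚ [ i ]ₜ) +ₚ t *ₚ t^ i *ₚ [ j ]ₜ     ≈⟨ +-cong ([suc] i) (*-congʳ (t^-suc i)) ⟨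
  [ suc i ]ₜ +ₚ t^ suc i *ₚ [ j ]ₜ               ∎

-- The form met when a block of k vertices grows by one in front: choosing the new vertex passes k
-- later neighbours and contributes `t^ k`.
[suc]′ : ∀ k → [ suc k ]ₜ ≋ [ k ]ₜ +ₚ t^ k
[suc]′ k = begin
  [ suc k ]ₜ               ≡⟨ cong [_]ₜ (ℕ.+-comm 1 k) ⟩
  [ k + 1 ]ₜ               ≈⟨ [+] k 1 ⟩
  [ k ]ₜ +ₚ t^ k *ₚ 1ₚ     ≈⟨ +-congˡ {[ k ]ₜ} (*-identityʳ _) ⟩
  [ k ]ₜ +ₚ t^ k           ∎

-- Deleting a color class

-- Vertices 1,…,s are low, s+1,…,r are mid and r+1,…,n are high: the graph is
-- complete except that low vertices are not joined to high ones.
data Block : Set where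
  low mid high : Block

adjacent : Block → Block → Bool
adjacent low  high = false
adjacent high low  = false
adjacent _    _    = true

-- t, 0 or 1 according to whether an edge from a vertex of color c to a later
-- vertex of color d is an ascent, is monochromatic, or is neither.
edge : ∀ {k} → Fin k → Fin k → Poly
edge zero    zero    = 0ₚ
edge zero    (suc d) = t
edge (suc c) zero    = 1ₚ
edge (suc c) (suc d) = edge c d

pairWeight : ∀ {k} → Block → Block → Fin k → Fin k → Poly
pairWeight x y c d = if adjacent x y then edge c d else 1ₚ

isZero : ∀ {k} → Vec ℕ k → Poly
isZero []          = 1ₚ
isZero (zero  ∷ β) = isZero β
isZero (suc _ ∷ β) = 0ₚ

lower : ℕ → (ℕ → Poly) → Poly
lower zero    f = 0ₚ
lower (suc b) f = f b

-- f (β - e_c), or 0 if β_c = 0.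
use : ∀ {k} → Vec ℕ k → Fin k → (Vec ℕ k → Poly) → Poly
use (b ∷ β) zero    f = lower b λ b′ → f (b′ ∷ β)
use (b ∷ β) (suc c) f = use β c λ β′ → f (b ∷ β′)

-- Sum over the colorings of the vertex list τ with content β; the weight w
-- records the influence of the vertices colored before.
colorSum : ∀ {k} → (Block → Fin k → Poly) → List Block → Vec ℕ k → Poly
colorSum w []      β = isZero β
colorSum w (x ∷ τ) β = sum λ c → use β c λ β′ →
  w x c *ₚ colorSum (λ y d → w y d *ₚ pairWeight x y c d) τ β′

-- Here x is an earlier vertex in the least class, and the Boolean says whether y joins it. If y
-- does not, its color is larger, so an edge is an ascent.
classWeight : Block → Block → Bool → Poly
classWeight x y true  = if adjacent x y then 0ₚ else 1ₚ
classWeight x y false = if adjacent x y then t  else 1ₚ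

-- Sum over the sets of c vertices of τ forming the class of the least color,
-- with h evaluated at the list of remaining vertices.
classSum : (Block → Bool → Poly) → ℕ → List Block → (List Block → Poly) → Poly
classSum w zero    []      h = h []
classSum w (suc c) []      h = 0ₚ
classSum w zero    (x ∷ τ) h = w x false *ₚ classSum w zero τ (h ∘ (x ∷_))
classSum w (suc c) (x ∷ τ) h =
  w x true *ₚ classSum (λ y b → w y b *ₚ classWeight x y b) c τ h
    +ₚ w x false *ₚ classSum w (suc c) τ (h ∘ (x ∷_))

use-cong : ∀ {k} (β : Vec ℕ k) c {f g : Vec ℕ k → Poly} → (∀ β′ → f β′ ≋ g β′) → use β c f ≋ use β c g
use-cong (zero  ∷ β) zero    f≋g = refl
use-cong (suc b ∷ β) zero    f≋g = f≋g (b ∷ β)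
use-cong (b     ∷ β) (suc c) f≋g = use-cong β c λ β′ → f≋g (b ∷ β′)

*-use : ∀ {k} p (β : Vec ℕ k) c f → p *ₚ use β c f ≋ use β c λ β′ → p *ₚ f β′
*-use p (zero  ∷ β) zero    f = zeroʳ p
*-use p (suc b ∷ β) zero    f = refl
*-use p (b     ∷ β) (suc c) f = *-use p β c λ β′ → f (b ∷ β′)

sum-cong : ∀ {k} {f g : Fin k → Poly} → (∀ i → f i ≋ g i) → sum f ≋ sum g
sum-cong = sum-cong-≋

-- Linearity in h, here and in the lemmas below, moves the choice of the least class past the choice
-- of color for a vertex outside it.
classSum-+ : ∀ w c τ h h′ →
  classSum w c τ (λ ρ → h ρ +ₚ h′ ρ) ≋ classSum w c τ h +ₚ classSum w c τ h′
classSum-+ w zero    []      h h′ = refl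
classSum-+ w (suc c) []      h h′ = refl
classSum-+ w zero    (x ∷ τ) h h′ = trans (*-congˡ {w x false} (classSum-+ w zero τ _ _)) (distribˡ (w x false) _ _)
classSum-+ w (suc c) (x ∷ τ) h h′ = trans
  (+-cong (*-congˡ {w x true} (classSum-+ _ c τ h h′)) (*-congˡ {w x false} (classSum-+ w (suc c) τ _ _)))
  (solve 6 (λ p q a b c d → p :* (a :+ b) :+ q :* (c :+ d) := (p :* a :+ q :* c) :+ (p :* b :+ q :* d)) refl
    (w x true) (w x false) (classSum _ c τ h) (classSum _ c τ h′) (classSum w (suc c) τ _) (classSum w (suc c) τ _))

classSum-* : ∀ w c τ p h → classSum w c τ (λ ρ → p *ₚ h ρ) ≋ p *ₚ classSum w c τ h
classSum-* w zero    []      p h = refl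
classSum-* w (suc c) []      p h = sym (zeroʳ p)
classSum-* w zero    (x ∷ τ) p h = trans (*-congˡ {w x false} (classSum-* w zero τ p _))
  (solve 3 (λ a b c → a :* (b :* c) := b :* (a :* c)) refl (w x false) p (classSum w zero τ _))
classSum-* w (suc c) (x ∷ τ) p h = trans
  (+-cong (*-congˡ {w x true} (classSum-* _ c τ p h)) (*-congˡ {w x false} (classSum-* w (suc c) τ p _)))
  (solve 5 (λ a b p s r → a :* (p :* s) :+ b :* (p :* r) := p :* (a :* s :+ b :* r)) refl
    (w x true) (w x false) p (classSum _ c τ h) (classSum w (suc c) τ _))

classSum-0 : ∀ w c τ → classSum w c τ (λ _ → 0ₚ) ≋ 0ₚ
classSum-0 w c τ = classSum-* w c τ 0ₚ (λ _ → 0ₚ)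

classSum-sum : ∀ w c τ {k} (h : Fin k → List Block → Poly) →
  classSum w c τ (λ ρ → sum λ i → h i ρ) ≋ sum λ i → classSum w c τ (h i)
classSum-sum w c τ {zero}  h = classSum-0 w c τ
classSum-sum w c τ {suc k} h = trans (classSum-+ w c τ _ _) (+-congˡ {classSum w c τ (h zero)} (classSum-sum w c τ (h ∘ suc)))

classSum-use : ∀ w c τ {k} (β : Vec ℕ k) d (h : Vec ℕ k → List Block → Poly) →
  classSum w c τ (λ ρ → use β d λ β′ → h β′ ρ) ≋ use β d λ β′ → classSum w c τ (h β′)
classSum-use w c τ (zero  ∷ β) zero    h = classSum-0 w c τ
classSum-use w c τ (suc b ∷ β) zero    h = refl
classSum-use w c τ (b     ∷ β) (suc d) h = classSum-use w c τ β d λ β′ → h (b ∷ β′)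

-- The factor of a vertex outside the least class followed by one inside it: with or without an
-- edge, there is neither an ascent nor a conflict.
if-same : ∀ b → (if b then 1ₚ else 1ₚ) ≋ 1ₚ
if-same true  = refl
if-same false = refl


-- An exchange of summations: `colorSum` colors one vertex after another, `classSum` fixes the whole
-- least class. It works because the weight at a larger color factors into `w₀ x false`, due to the
-- least class, and `w₁ x d`, due to the other colors, and multiplying by `pairWeight` keeps this
-- factorization.
colorSum-split : ∀ {k} τ (w : Block → Fin (suc k) → Poly) w₀ w₁ c (β : Vec ℕ k) →
  (∀ x → w x zero ≋ w₀ x true) → (∀ x d → w x (suc d) ≋ w₀ x false *ₚ w₁ x d) →
  colorSum w τ (c ∷ β) ≋ classSum w₀ c τ λ ρ → colorSum w₁ ρ β
colorSum-split []      w w₀ w₁ zero    β eq₀ eq₁ = refl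
colorSum-split []      w w₀ w₁ (suc c) β eq₀ eq₁ = refl
colorSum-split {k} (x ∷ τ) w w₀ w₁ c β eq₀ eq₁ = trans (+-congˡ {first c} rest) (combine c)
  where
  first : ℕ → Poly
  first c = use (c ∷ β) zero λ β′ → w x zero *ₚ colorSum (λ y d → w y d *ₚ pairWeight x y zero d) τ β′

  later : Fin k → Vec ℕ k → List Block → Poly
  later d β′ ρ = w₁ x d *ₚ colorSum (λ y d′ → w₁ y d′ *ₚ pairWeight x y d d′) ρ β′

  rest : sum (λ d → use (c ∷ β) (suc d) λ β′ →
           w x (suc d) *ₚ colorSum (λ y d′ → w y d′ *ₚ pairWeight x y (suc d) d′) τ β′)
         ≋ w₀ x false *ₚ classSum w₀ c τ (λ ρ → colorSum w₁ (x ∷ ρ) β)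
  rest = begin
    sum (λ d → use β d λ β′ →
      w x (suc d) *ₚ colorSum (λ y d′ → w y d′ *ₚ pairWeight x y (suc d) d′) τ (c ∷ β′))
      ≈⟨ (sum-cong λ d → use-cong β d λ β′ → *-cong (eq₁ x d)
           (colorSum-split τ _ w₀ (λ y d′ → w₁ y d′ *ₚ pairWeight x y d d′) c β′
             (λ y → trans (*-cong (eq₀ y) (if-same (adjacent x y))) (*-identityʳ _))
             (λ y d′ → trans (*-congʳ (eq₁ y d′)) (*-assoc (w₀ y false) _ _)))) ⟩
    sum (λ d → use β d λ β′ →
      (w₀ x false *ₚ w₁ x d) *ₚ classSum w₀ c τ (λ ρ → colorSum (λ y d′ → w₁ y d′ *ₚ pairWeight x y d d′) ρ β′))
      ≈⟨ (sum-cong λ d → use-cong β d λ β′ → trans (*-assoc (w₀ x false) _ _)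
           (*-congˡ {w₀ x false} (sym (classSum-* w₀ c τ (w₁ x d) _)))) ⟩
    sum (λ d → use β d λ β′ → w₀ x false *ₚ classSum w₀ c τ (later d β′))
      ≈⟨ (sum-cong λ d → sym (trans (*-congˡ {w₀ x false} (classSum-use w₀ c τ β d (later d)))
           (*-use (w₀ x false) β d _))) ⟩
    sum (λ d → w₀ x false *ₚ classSum w₀ c τ (λ ρ → use β d λ β′ → later d β′ ρ))
      ≈⟨ *-distribˡ-sum {k} (w₀ x false) _ ⟨
    w₀ x false *ₚ sum (λ d → classSum w₀ c τ (λ ρ → use β d λ β′ → later d β′ ρ))
      ≈⟨ *-congˡ {w₀ x false} (classSum-sum w₀ c τ {k} _) ⟨
    w₀ x false *ₚ classSum w₀ c τ (λ ρ → colorSum w₁ (x ∷ ρ) β) ∎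

  combine : ∀ c → first c +ₚ w₀ x false *ₚ classSum w₀ c τ (λ ρ → colorSum w₁ (x ∷ ρ) β)
                  ≋ classSum w₀ c (x ∷ τ) (λ ρ → colorSum w₁ ρ β)
  -- With the least color used up, `first` is `0ₚ` and `classSum` skips x by definition.
  combine zero    = refl
  combine (suc c) = +-congʳ (*-cong (eq₀ x) (colorSum-split τ _ _ w₁ c β
    (λ y → *-congʳ (eq₀ y))
    (λ y d → trans (*-congʳ (eq₁ y d))
      (solve 3 (λ a b c → a :* b :* c := a :* c :* b) refl (w₀ y false) (w₁ y d) (classWeight x y false)))))

blocks : ℕ → ℕ → ℕ → List Block
blocks a m b = replicate a low ++ (replicate m mid ++ replicate b high)

after : (Block → Bool → Poly) → Block → Block → Bool → Poly
after w x y b = w y b *ₚ classWeight x y b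

-- The weight of a vertex with exactly one earlier neighbour in the class, while `Free` means none.
-- Two do not occur: a second member after a low vertex must be high, and then all later vertices
-- are high, hence not joined to the low one.
record Blocked (w : Block → Bool → Poly) (x : Block) : Set where
  constructor blocked
  field
    pick-0 : w x true ≋ 0ₚ
    skip-t : w x false ≋ t

record Free (w : Block → Bool → Poly) (x : Block) : Set where
  constructor free
  field
    pick-1 : w x true ≋ 1ₚ
    skip-1 : w x false ≋ 1ₚ

open Blocked
open Free

Free⇒Blocked : ∀ w x y → adjacent x y ≡ true → Free w y → Blocked (after w x) y
Free⇒Blocked w x y adj f = blocked
  (trans (*-congˡ {w y true} (reflexive (cong (λ b → if b then 0ₚ else 1ₚ) adj))) (zeroʳ (w y true)))
  (trans (*-cong (skip-1 f) (reflexive (cong (λ b → if b then t else 1ₚ) adj))) (*-identityˡ t))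

Free⇒Free : ∀ w x y → adjacent x y ≡ false → Free w y → Free (after w x) y
Free⇒Free w x y adj f = free
  (trans (*-cong (pick-1 f) (reflexive (cong (λ b → if b then 0ₚ else 1ₚ) adj))) (*-identityˡ 1ₚ))
  (trans (*-cong (skip-1 f) (reflexive (cong (λ b → if b then t else 1ₚ) adj))) (*-identityˡ 1ₚ))

free-none : ∀ w τ h → All (Free w) τ → classSum w 0 τ h ≋ h τ
free-none w []      h []       = refl
free-none w (x ∷ τ) h (f ∷ fs) = trans (*-cong (skip-1 f) (free-none w τ _ fs)) (*-identityˡ _)

-- Each blocked vertex is skipped at the cost of a factor t; branches that pick one carry the factor
-- 0, whatever weights they lead to.
blocked-prefix : ∀ w c σ τ h → All (Blocked w) σ →
  classSum w c (σ ++ τ) h ≋ t^ length σ *ₚ classSum w c τ (h ∘ (σ ++_))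
blocked-prefix w c       []      τ h []       = sym (*-identityˡ _)
blocked-prefix w zero    (x ∷ σ) τ h (f ∷ fs) = begin
  w x false *ₚ classSum w 0 (σ ++ τ) _      ≈⟨ *-cong (skip-t f) (blocked-prefix w 0 σ τ _ fs) ⟩
  t *ₚ (t^ length σ *ₚ classSum w 0 τ _)    ≈⟨ *-assoc t (t^ length σ) _ ⟨
  t *ₚ t^ length σ *ₚ classSum w 0 τ _      ≈⟨ *-congʳ (t^-suc (length σ)) ⟨
  t^ suc (length σ) *ₚ classSum w 0 τ _     ∎
blocked-prefix w (suc c) (x ∷ σ) τ h (f ∷ fs) = begin
  w x true *ₚ picked +ₚ w x false *ₚ classSum w (suc c) (σ ++ τ) _
    ≈⟨ +-cong (*-congʳ (pick-0 f)) (*-cong (skip-t f) (blocked-prefix w (suc c) σ τ _ fs)) ⟩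
  t *ₚ (t^ length σ *ₚ classSum w (suc c) τ _)    ≈⟨ *-assoc t (t^ length σ) _ ⟨
  t *ₚ t^ length σ *ₚ classSum w (suc c) τ _      ≈⟨ *-congʳ (t^-suc (length σ)) ⟨
  t^ suc (length σ) *ₚ classSum w (suc c) τ _     ∎
  where picked = classSum (after w x) c (σ ++ τ) h

blocked-none : ∀ w τ h → All (Blocked w) τ → classSum w 0 τ h ≋ t^ length τ *ₚ h τ
blocked-none w τ h fs = ≡.subst (λ σ → classSum w 0 σ h ≋ t^ length τ *ₚ h σ) (List.++-identityʳ τ)
  (blocked-prefix w 0 τ [] h fs)

blocked-some : ∀ w c τ h → All (Blocked w) τ → classSum w (suc c) τ h ≋ 0ₚ
blocked-some w c τ h fs = ≡.subst (λ σ → classSum w (suc c) σ h ≋ 0ₚ) (List.++-identityʳ τ)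
  (trans (blocked-prefix w (suc c) τ [] h fs) (zeroʳ (t^ length τ)))

-- In the inductions below, putting the skipped vertex back in front gives a block of size
-- `suc (pred a)`. At a = 0 this is the wrong size, but the factor `[ 0 ]ₜ` vanishes.
[]-suc-pred : ∀ a (g : ℕ → Poly) → [ a ]ₜ *ₚ g (suc (pred a)) ≋ [ a ]ₜ *ₚ g a
[]-suc-pred zero    g = refl
[]-suc-pred (suc a) g = refl

module _ (w : Block → Bool → Poly) (fᴴ : Free w high) where

  private
    spentᴴ : ∀ b → All (Blocked (after w high)) (replicate b high)
    spentᴴ b = All.replicate⁺ b (Free⇒Blocked w high high ≡.refl fᴴ)

  high-one : ∀ b h → classSum w 1 (replicate b high) h ≋ [ b ]ₜ *ₚ h (replicate (pred b) high)
  high-one zero    h = refl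
  high-one (suc b) h = begin
    w high true *ₚ classSum (after w high) 0 τ h +ₚ w high false *ₚ classSum w 1 τ (h ∘ (high ∷_))
      ≈⟨ +-cong (*-cong (pick-1 fᴴ) (blocked-none _ τ h (spentᴴ b))) (*-cong (skip-1 fᴴ) (high-one b _)) ⟩
    1ₚ *ₚ (t^ length τ *ₚ h τ) +ₚ 1ₚ *ₚ ([ b ]ₜ *ₚ h (replicate (suc (pred b)) high))
      ≈⟨ +-cong (*-congˡ {1ₚ} (*-congʳ (reflexive (cong t^_ (List.length-replicate b)))))
                (*-congˡ {1ₚ} ([]-suc-pred b (λ b → h (replicate b high)))) ⟩
    1ₚ *ₚ (t^ b *ₚ h τ) +ₚ 1ₚ *ₚ ([ b ]ₜ *ₚ h τ)
      ≈⟨ solve 3 (λ p x y → con 1 :* (p :* y) :+ con 1 :* (x :* y) := (x :+ p) :* y) refl (t^ b) [ b ]ₜ (h τ) ⟩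
    ([ b ]ₜ +ₚ t^ b) *ₚ h τ      ≈⟨ *-congʳ ([suc]′ b) ⟨
    [ suc b ]ₜ *ₚ h τ            ∎
    where τ = replicate b high

  high-two : ∀ c b h → classSum w (suc (suc c)) (replicate b high) h ≋ 0ₚ
  high-two c zero    h = refl
  high-two c (suc b) h = begin
    w high true *ₚ classSum (after w high) (suc c) τ h +ₚ w high false *ₚ classSum w (suc (suc c)) τ (h ∘ (high ∷_))
      ≈⟨ +-cong (*-congˡ {w high true} (blocked-some _ c τ h (spentᴴ b))) (*-congˡ {w high false} (high-two c b _)) ⟩
    w high true *ₚ 0ₚ +ₚ w high false *ₚ 0ₚ
      ≈⟨ +-cong (zeroʳ (w high true)) (zeroʳ (w high false)) ⟩
    0ₚ ∎
    where τ = replicate b high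

module _ (w : Block → Bool → Poly) (fᴹ : Free w mid) (fᴴ : Free w high) where

  private
    upper : ℕ → ℕ → List Block
    upper m b = replicate m mid ++ replicate b high

    spentᴹ : ∀ m b → All (Blocked (after w mid)) (upper m b)
    spentᴹ m b = All.++⁺ (All.replicate⁺ m (Free⇒Blocked w mid mid ≡.refl fᴹ))
                         (All.replicate⁺ b (Free⇒Blocked w mid high ≡.refl fᴴ))

    length-upper : ∀ m b → t^ length (upper m b) ≋ t^ m *ₚ t^ b
    length-upper m b = trans (reflexive (cong t^_ (≡.trans (List.length-++ (replicate m mid))
      (cong₂ _+_ (List.length-replicate m) (List.length-replicate b))))) (t^-+ m b)

  mid-one : ∀ m b h → classSum w 1 (upper m b) h ≋
    t^ b *ₚ ([ m ]ₜ *ₚ h (upper (pred m) b)) +ₚ [ b ]ₜ *ₚ h (upper m (pred b))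
  mid-one zero    b h = trans (high-one w fᴴ b h) (+-congʳ (sym (zeroʳ (t^ b))))
  mid-one (suc m) b h = begin
    w mid true *ₚ classSum (after w mid) 0 τ h +ₚ w mid false *ₚ classSum w 1 τ (h ∘ (mid ∷_))
      ≈⟨ +-cong (*-cong (pick-1 fᴹ) (blocked-none _ τ h (spentᴹ m b))) (*-cong (skip-1 fᴹ) (mid-one m b _)) ⟩
    1ₚ *ₚ (t^ length τ *ₚ h τ) +ₚ
      1ₚ *ₚ (t^ b *ₚ ([ m ]ₜ *ₚ h (upper (suc (pred m)) b)) +ₚ [ b ]ₜ *ₚ h (upper (suc m) (pred b)))
      ≈⟨ +-cong (*-congˡ {1ₚ} (*-congʳ (length-upper m b)))
                (*-congˡ {1ₚ} (+-congʳ (*-congˡ {t^ b} ([]-suc-pred m (λ m → h (upper m b)))))) ⟩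
    1ₚ *ₚ (t^ m *ₚ t^ b *ₚ h τ) +ₚ 1ₚ *ₚ (t^ b *ₚ ([ m ]ₜ *ₚ h τ) +ₚ [ b ]ₜ *ₚ h (upper (suc m) (pred b)))
      ≈⟨ solve 5 (λ p q x y z → con 1 :* (p :* q :* y) :+ con 1 :* (q :* (x :* y) :+ z) := q :* ((x :+ p) :* y) :+ z) refl
           (t^ m) (t^ b) [ m ]ₜ (h τ) ([ b ]ₜ *ₚ h (upper (suc m) (pred b))) ⟩
    t^ b *ₚ (([ m ]ₜ +ₚ t^ m) *ₚ h τ) +ₚ [ b ]ₜ *ₚ h (upper (suc m) (pred b))
      ≈⟨ +-congʳ (*-congˡ {t^ b} (*-congʳ ([suc]′ m))) ⟨
    t^ b *ₚ ([ suc m ]ₜ *ₚ h τ) +ₚ [ b ]ₜ *ₚ h (upper (suc m) (pred b)) ∎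
    where τ = upper m b

  mid-two : ∀ c m b h → classSum w (suc (suc c)) (upper m b) h ≋ 0ₚ
  mid-two c zero    b h = high-two w fᴴ c b h
  mid-two c (suc m) b h = begin
    w mid true *ₚ classSum (after w mid) (suc c) τ h +ₚ w mid false *ₚ classSum w (suc (suc c)) τ (h ∘ (mid ∷_))
      ≈⟨ +-cong (*-congˡ {w mid true} (blocked-some _ c τ h (spentᴹ m b))) (*-congˡ {w mid false} (mid-two c m b _)) ⟩
    w mid true *ₚ 0ₚ +ₚ w mid false *ₚ 0ₚ
      ≈⟨ +-cong (zeroʳ (w mid true)) (zeroʳ (w mid false)) ⟩
    0ₚ ∎
    where τ = upper m b

module _ (w : Block → Bool → Poly) (fᴸ : Free w low) (fᴹ : Free w mid) (fᴴ : Free w high) where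

  private
    w′ : Block → Bool → Poly
    w′ = after w low

    free-high : Free w′ high
    free-high = Free⇒Free w low high ≡.refl fᴴ

    after-low : ∀ c a m b h → classSum w′ c (blocks a m b) h ≋
      t^ a *ₚ (t^ m *ₚ classSum w′ c (replicate b high) (λ ρ → h (replicate a low ++ (replicate m mid ++ ρ))))
    after-low c a m b h = begin
      classSum w′ c (blocks a m b) h
        ≈⟨ blocked-prefix w′ c (replicate a low) _ h (All.replicate⁺ a (Free⇒Blocked w low low ≡.refl fᴸ)) ⟩
      t^ length (replicate a low) *ₚ classSum w′ c (replicate m mid ++ replicate b high) _
        ≈⟨ *-cong (reflexive (cong t^_ (List.length-replicate a)))
             (blocked-prefix w′ c (replicate m mid) _ _ (All.replicate⁺ m (Free⇒Blocked w low mid ≡.refl fᴹ))) ⟩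
      t^ a *ₚ (t^ length (replicate m mid) *ₚ classSum w′ c (replicate b high) _)
        ≈⟨ *-congˡ {t^ a} (*-congʳ (reflexive (cong t^_ (List.length-replicate m)))) ⟩
      t^ a *ₚ (t^ m *ₚ classSum w′ c (replicate b high) _) ∎

  -- The chosen vertex contributes t for each later neighbour: the later lows and all mids if it is
  -- low, the later mids and all highs if it is mid, the later highs if it is high. Its position
  -- within the block runs through the exponents of a quantum number.
  class-one : ∀ a m b h → classSum w 1 (blocks a m b) h ≋
    t^ m *ₚ ([ a ]ₜ *ₚ h (blocks (pred a) m b)) +ₚ
    (t^ b *ₚ ([ m ]ₜ *ₚ h (blocks a (pred m) b)) +ₚ [ b ]ₜ *ₚ h (blocks a m (pred b)))
  class-one zero    m b h = trans (mid-one w fᴹ fᴴ m b h) (+-congʳ (sym (zeroʳ (t^ m))))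
  class-one (suc a) m b h = begin
    w low true *ₚ classSum w′ 0 τ h +ₚ w low false *ₚ classSum w 1 τ (h ∘ (low ∷_))
      ≈⟨ +-cong (*-cong (pick-1 fᴸ) (trans (after-low 0 a m b h) (*-congˡ {t^ a} (*-congˡ {t^ m}
                  (free-none w′ (replicate b high) _ (All.replicate⁺ b free-high))))))
                (*-cong (skip-1 fᴸ) (class-one a m b _)) ⟩
    1ₚ *ₚ (t^ a *ₚ (t^ m *ₚ h τ)) +ₚ 1ₚ *ₚ (t^ m *ₚ ([ a ]ₜ *ₚ h (blocks (suc (pred a)) m b)) +ₚ others)
      ≈⟨ +-congˡ {1ₚ *ₚ (t^ a *ₚ (t^ m *ₚ h τ))} (*-congˡ {1ₚ} (+-congʳ (*-congˡ {t^ m}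
           ([]-suc-pred a (λ a → h (blocks a m b)))))) ⟩
    1ₚ *ₚ (t^ a *ₚ (t^ m *ₚ h τ)) +ₚ 1ₚ *ₚ (t^ m *ₚ ([ a ]ₜ *ₚ h τ) +ₚ others)
      ≈⟨ solve 5 (λ p q x y z → con 1 :* (p :* (q :* y)) :+ con 1 :* (q :* (x :* y) :+ z) := q :* ((x :+ p) :* y) :+ z) refl
           (t^ a) (t^ m) [ a ]ₜ (h τ) others ⟩
    t^ m *ₚ (([ a ]ₜ +ₚ t^ a) *ₚ h τ) +ₚ others
      ≈⟨ +-congʳ (*-congˡ {t^ m} (*-congʳ ([suc]′ a))) ⟨
    t^ m *ₚ ([ suc a ]ₜ *ₚ h τ) +ₚ others ∎
    where
    τ = blocks a m b
    others = t^ b *ₚ ([ m ]ₜ *ₚ h (blocks (suc a) (pred m) b)) +ₚ [ b ]ₜ *ₚ h (blocks (suc a) m (pred b))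

  -- Two nonadjacent vertices are a low and a high one. A mid vertex lies after the low and before
  -- the high member, so it gives one ascent; hence `t^ m` appears once and the two positions are
  -- independent.
  class-two : ∀ a m b h → classSum w 2 (blocks a m b) h ≋
    t^ m *ₚ ([ a ]ₜ *ₚ ([ b ]ₜ *ₚ h (blocks (pred a) m (pred b))))
  class-two zero    m b h = trans (mid-two w fᴹ fᴴ 0 m b h) (sym (zeroʳ (t^ m)))
  class-two (suc a) m b h = begin
    w low true *ₚ classSum w′ 1 (blocks a m b) h +ₚ w low false *ₚ classSum w 2 (blocks a m b) (h ∘ (low ∷_))
      ≈⟨ +-cong (*-cong (pick-1 fᴸ) (trans (after-low 1 a m b h) (*-congˡ {t^ a} (*-congˡ {t^ m}
                  (high-one w′ free-high b _)))))
                (*-cong (skip-1 fᴸ) (class-two a m b _)) ⟩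
    1ₚ *ₚ (t^ a *ₚ (t^ m *ₚ ([ b ]ₜ *ₚ h τ))) +ₚ
      1ₚ *ₚ (t^ m *ₚ ([ a ]ₜ *ₚ ([ b ]ₜ *ₚ h (blocks (suc (pred a)) m (pred b)))))
      ≈⟨ +-congˡ {1ₚ *ₚ (t^ a *ₚ (t^ m *ₚ ([ b ]ₜ *ₚ h τ)))} (*-congˡ {1ₚ} (*-congˡ {t^ m}
           ([]-suc-pred a (λ a → [ b ]ₜ *ₚ h (blocks a m (pred b)))))) ⟩
    1ₚ *ₚ (t^ a *ₚ (t^ m *ₚ ([ b ]ₜ *ₚ h τ))) +ₚ 1ₚ *ₚ (t^ m *ₚ ([ a ]ₜ *ₚ ([ b ]ₜ *ₚ h τ)))
      ≈⟨ solve 4 (λ p q x y → con 1 :* (p :* (q :* y)) :+ con 1 :* (q :* (x :* y)) := q :* ((x :+ p) :* y)) refl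
           (t^ a) (t^ m) [ a ]ₜ ([ b ]ₜ *ₚ h τ) ⟩
    t^ m *ₚ (([ a ]ₜ +ₚ t^ a) *ₚ ([ b ]ₜ *ₚ h τ))
      ≈⟨ *-congˡ {t^ m} (*-congʳ ([suc]′ a)) ⟨
    t^ m *ₚ ([ suc a ]ₜ *ₚ ([ b ]ₜ *ₚ h τ)) ∎
    where
    τ = blocks a m (pred b)

  class-three : ∀ c a m b h → classSum w (suc (suc (suc c))) (blocks a m b) h ≋ 0ₚ
  class-three c zero    m b h = mid-two w fᴹ fᴴ (suc c) m b h
  class-three c (suc a) m b h = begin
    w low true *ₚ classSum w′ (suc (suc c)) τ h +ₚ w low false *ₚ classSum w (suc (suc (suc c))) τ (h ∘ (low ∷_))
      ≈⟨ +-cong (*-congˡ {w low true} (trans (after-low (suc (suc c)) a m b h)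
                  (trans (*-congˡ {t^ a} (trans (*-congˡ {t^ m} (high-two w′ free-high c b _)) (zeroʳ (t^ m)))) (zeroʳ (t^ a)))))
                (*-congˡ {w low false} (class-three c a m b _)) ⟩
    w low true *ₚ 0ₚ +ₚ w low false *ₚ 0ₚ
      ≈⟨ +-cong (zeroʳ (w low true)) (zeroʳ (w low false)) ⟩
    0ₚ ∎
    where τ = blocks a m b

-- The coefficients of the expansion

-- The rising product [k] [k+1] ⋯ [k+y-1]. It stands for the quotient [k+y-1]! / [k-1]! and still
-- makes sense at k = 0, where it is 0 for y > 0.
rise : ℕ → ℕ → Poly
rise k zero    = 1ₚ
rise k (suc y) = [ k ]ₜ *ₚ rise (suc k) y

rise-snoc : ∀ k y → rise k (suc y) ≋ rise k y *ₚ [ k + y ]ₜ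
rise-snoc k zero    = trans (*-comm [ k ]ₜ 1ₚ) (*-congˡ {1ₚ} (reflexive (cong [_]ₜ (≡.sym (ℕ.+-identityʳ k)))))
rise-snoc k (suc y) = begin
  [ k ]ₜ *ₚ rise (suc k) (suc y)                      ≈⟨ *-congˡ {[ k ]ₜ} (rise-snoc (suc k) y) ⟩
  [ k ]ₜ *ₚ (rise (suc k) y *ₚ [ suc k + y ]ₜ)        ≈⟨ *-assoc [ k ]ₜ (rise (suc k) y) [ suc k + y ]ₜ ⟨
  [ k ]ₜ *ₚ rise (suc k) y *ₚ [ suc k + y ]ₜ          ≡⟨ cong (λ i → rise k (suc y) *ₚ [ i ]ₜ) (≡.sym (ℕ.+-suc k y)) ⟩
  rise k (suc y) *ₚ [ k + suc y ]ₜ                    ∎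

factorial-rise : ∀ y k → [ k ]ₜ! *ₚ rise (suc k) y ≋ [ y + k ]ₜ!
factorial-rise zero    k = *-identityʳ _
factorial-rise (suc y) k = begin
  [ k ]ₜ! *ₚ ([ suc k ]ₜ *ₚ rise (suc (suc k)) y)     ≈⟨ *-assoc [ k ]ₜ! [ suc k ]ₜ (rise (suc (suc k)) y) ⟨
  [ suc k ]ₜ! *ₚ rise (suc (suc k)) y                 ≈⟨ factorial-rise y (suc k) ⟩
  [ y + suc k ]ₜ!                                     ≡⟨ cong [_]ₜ! (ℕ.+-suc y k) ⟩
  [ suc y + k ]ₜ!                                     ∎

-- [x+m-1]! [y+m-1]! [x+y+m] / [m-1]!, including its limit at m = 0.
tail : ℕ → ℕ → ℕ → Poly
tail zero    y       m = [ y + m ]ₜ!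
tail (suc x) zero    m = [ suc x + m ]ₜ!
tail (suc x) (suc y) m = [ suc (suc (x + y + m)) ]ₜ *ₚ ([ x + m ]ₜ! *ₚ rise m (suc y))

tail-zero : ∀ x m → tail x 0 m ≡ [ x + m ]ₜ!
tail-zero zero    m = ≡.refl
tail-zero (suc x) m = ≡.refl

-- For m > 0 the three clauses of `tail` are one formula. They are separated for the sake of m = 0,
-- where [m-1]! cancels outright if x or y is 0, and otherwise a factor `[ 0 ]ₜ` survives in `rise`.
tail-suc : ∀ x y k → tail x y (suc k) ≋ [ suc (x + y + k) ]ₜ *ₚ ([ x + k ]ₜ! *ₚ rise (suc k) y)
tail-suc zero y k = begin
  [ y + suc k ]ₜ!                                              ≡⟨ cong [_]ₜ! (ℕ.+-suc y k) ⟩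
  [ y + k ]ₜ! *ₚ [ suc (y + k) ]ₜ                              ≈⟨ *-comm [ y + k ]ₜ! [ suc (y + k) ]ₜ ⟩
  [ suc (y + k) ]ₜ *ₚ [ y + k ]ₜ!                              ≈⟨ *-congˡ {[ suc (y + k) ]ₜ} (factorial-rise y k) ⟨
  [ suc (y + k) ]ₜ *ₚ ([ k ]ₜ! *ₚ rise (suc k) y)              ∎
tail-suc (suc x) zero k = begin
  [ suc x + suc k ]ₜ!                                          ≡⟨ cong [_]ₜ! (ℕ.+-suc (suc x) k) ⟩
  [ suc x + k ]ₜ! *ₚ [ suc (suc x + k) ]ₜ                      ≈⟨ *-comm [ suc x + k ]ₜ! [ suc (suc x + k) ]ₜ ⟩
  [ suc (suc x + k) ]ₜ *ₚ [ suc x + k ]ₜ!                      ≈⟨ *-congˡ {[ suc (suc x + k) ]ₜ} (*-identityʳ _) ⟨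
  [ suc (suc x + k) ]ₜ *ₚ ([ suc x + k ]ₜ! *ₚ 1ₚ)              ≡⟨ cong (λ i → [ suc (i + k) ]ₜ *ₚ ([ suc x + k ]ₜ! *ₚ 1ₚ)) (≡.sym (ℕ.+-identityʳ (suc x))) ⟩
  [ suc (suc x + 0 + k) ]ₜ *ₚ ([ suc x + k ]ₜ! *ₚ 1ₚ)          ∎
tail-suc (suc x) (suc y) k = reflexive (cong₂ (λ i j → [ i ]ₜ *ₚ ([ j ]ₜ! *ₚ rise (suc k) (suc y)))
  (cong (λ i → suc (suc i)) (≡.trans (ℕ.+-suc (x + y) k) (cong (_+ k) (≡.sym (ℕ.+-suc x y)))))
  (ℕ.+-suc x k))

-- The coefficient of e_(n-j,j) for blocks of sizes a, m and b.
eCoeff : ℕ → ℕ → ℕ → ℕ → Poly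
eCoeff zero    a       m b       = tail a b m
eCoeff (suc j) zero    m b       = 0ₚ
eCoeff (suc j) (suc a) m zero    = 0ₚ
eCoeff (suc j) (suc a) m (suc b) = t^ m *ₚ ([ suc a ]ₜ *ₚ ([ suc b ]ₜ *ₚ eCoeff j a m b))

eCoeff-noHigh : ∀ j a m → eCoeff (suc j) a m 0 ≡ 0ₚ
eCoeff-noHigh j zero    m = ≡.refl
eCoeff-noHigh j (suc a) m = ≡.refl

-- The factor `[ a ]ₜ` absorbs the vanishing clause at a = 0, so the recursion can be proved without
-- splitting on a; `eCoeff-sucˡ` does the same for b.
eCoeff-sucʳ : ∀ j a m b → eCoeff (suc j) a m (suc b) ≋ t^ m *ₚ ([ a ]ₜ *ₚ ([ suc b ]ₜ *ₚ eCoeff j (pred a) m b))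
eCoeff-sucʳ j zero    m b = sym (zeroʳ (t^ m))
eCoeff-sucʳ j (suc a) m b = refl

eCoeff-sucˡ : ∀ j a m b → eCoeff (suc j) (suc a) m b ≋ t^ m *ₚ ([ suc a ]ₜ *ₚ ([ b ]ₜ *ₚ eCoeff j a m (pred b)))
eCoeff-sucˡ j a m zero    = sym (trans (*-congˡ {t^ m} (zeroʳ [ suc a ]ₜ)) (zeroʳ (t^ m)))
eCoeff-sucˡ j a m (suc b) = refl

eCoeff-vanishes : ∀ j a m b → b ⊓ a < j → eCoeff j a m b ≋ 0ₚ
eCoeff-vanishes (suc j) zero    m b       lt       = refl
eCoeff-vanishes (suc j) (suc a) m zero    lt       = refl
eCoeff-vanishes (suc j) (suc a) m (suc b) (s≤s lt) = begin
  t^ m *ₚ ([ suc a ]ₜ *ₚ ([ suc b ]ₜ *ₚ eCoeff j a m b))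
    ≈⟨ *-congˡ {t^ m} (*-congˡ {[ suc a ]ₜ} (*-congˡ {[ suc b ]ₜ} (eCoeff-vanishes j a m b lt))) ⟩
  t^ m *ₚ ([ suc a ]ₜ *ₚ ([ suc b ]ₜ *ₚ 0ₚ))
    ≈⟨ solve 3 (λ p q r → p :* (q :* (r :* con 0)) := con 0) refl (t^ m) [ suc a ]ₜ [ suc b ]ₜ ⟩
  0ₚ ∎

[+]′ : ∀ i j → [ i + j ]ₜ ≋ [ i ]ₜ +ₚ ([ j ]ₜ +ₚ u *ₚ ([ i ]ₜ *ₚ [ j ]ₜ))
[+]′ i j = trans ([+] i j) (trans (+-congˡ {[ i ]ₜ} (*-congʳ (t^≋ i)))
  (solve 3 (λ v x y → x :+ (con 1 :+ v :* x) :* y := x :+ (y :+ v :* (x :* y))) refl u [ i ]ₜ [ j ]ₜ))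

-- This is what `tail-recursion` becomes for block sizes x+1, k+1, y+1 once the common factor is
-- removed. With n = x+y+k+3, the numbers [n], [n-1], [n-2] come from the graphs with 0, 1 and 2
-- vertices deleted.
quantum-identity : ∀ x y k →
  [ suc x + k ]ₜ *ₚ [ suc y + k ]ₜ *ₚ [ suc (suc (suc (x + (y + k)))) ]ₜ
    +ₚ t^ suc k *ₚ [ suc x ]ₜ *ₚ [ suc y ]ₜ *ₚ [ suc (x + (y + k)) ]ₜ
  ≋ [ suc (suc (x + (y + k))) ]ₜ *ₚ
    (t^ suc k *ₚ [ suc x ]ₜ *ₚ [ suc y + k ]ₜ +ₚ
      (t^ suc y *ₚ [ suc k ]ₜ *ₚ [ k ]ₜ +ₚ [ suc y ]ₜ *ₚ [ suc x + k ]ₜ))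
quantum-identity x y k = begin
  [ suc x + k ]ₜ *ₚ [ suc y + k ]ₜ *ₚ [ suc (suc (suc (x + (y + k)))) ]ₜ
    +ₚ t^ suc k *ₚ [ suc x ]ₜ *ₚ [ suc y ]ₜ *ₚ [ suc (x + (y + k)) ]ₜ
    ≈⟨ +-cong (*-cong (*-cong X+k Y+k) N+1) (*-cong (*-cong (*-cong t^K X) Y) N-1) ⟩
  _
    -- Everything is now written in the atoms `u`, `[ x ]ₜ`, `[ y ]ₜ`, `[ k ]ₜ` with natural
    -- coefficients, and the identity holds with these as free variables.
    ≈⟨ solve 4 (λ v p q w →
         let t    = con 1 :+ v
             plus = λ i j → i :+ (j :+ v :* (i :* j))
             X    = con 1 :+ t :* p
             Y    = con 1 :+ t :* q
             K    = con 1 :+ t :* w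
             t^K  = t :* (con 1 :+ v :* w)
             t^Y  = t :* (con 1 :+ v :* q)
             X+k  = plus X w
             Y+k  = plus Y w
             N-1  = con 1 :+ t :* plus p (plus q w)
             N    = con 1 :+ t :* N-1
             N+1  = con 1 :+ t :* N
         in X+k :* Y+k :* N+1 :+ t^K :* X :* Y :* N-1
              := N :* (t^K :* X :* Y+k :+ (t^Y :* K :* w :+ Y :* X+k)))
         refl u [ x ]ₜ [ y ]ₜ [ k ]ₜ ⟩
  _
    ≈⟨ *-cong N (+-cong (*-cong (*-cong t^K X) Y+k) (+-cong (*-cong (*-cong t^Y ([suc] k)) refl) (*-cong Y X+k))) ⟨
  [ suc (suc (x + (y + k))) ]ₜ *ₚ
    (t^ suc k *ₚ [ suc x ]ₜ *ₚ [ suc y + k ]ₜ +ₚ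
      (t^ suc y *ₚ [ suc k ]ₜ *ₚ [ k ]ₜ +ₚ [ suc y ]ₜ *ₚ [ suc x + k ]ₜ)) ∎
  where
  plus-cong : ∀ {i i′ j j′} → i ≋ i′ → j ≋ j′ → i +ₚ (j +ₚ u *ₚ (i *ₚ j)) ≋ i′ +ₚ (j′ +ₚ u *ₚ (i′ *ₚ j′))
  plus-cong i≋ j≋ = +-cong i≋ (+-cong j≋ (*-congˡ {u} (*-cong i≋ j≋)))
  next : ∀ n {p} → [ n ]ₜ ≋ p → [ suc n ]ₜ ≋ 1ₚ +ₚ t *ₚ p
  next n eq = trans ([suc] n) (+-congˡ {1ₚ} (*-congˡ {t} eq))
  X   = [suc] x
  Y   = [suc] y
  t^K = trans (t^-suc k) (*-congˡ {t} (t^≋ k))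
  t^Y = trans (t^-suc y) (*-congˡ {t} (t^≋ y))
  X+k = trans ([+]′ (suc x) k) (plus-cong X (refl {[ k ]ₜ}))
  Y+k = trans ([+]′ (suc y) k) (plus-cong Y (refl {[ k ]ₜ}))
  N-1 = next (x + (y + k)) (trans ([+]′ x (y + k)) (plus-cong (refl {[ x ]ₜ}) ([+]′ y k)))
  N   = next (suc (x + (y + k))) N-1
  N+1 = next (suc (suc (x + (y + k)))) N

-- If a or b is 0 the graph is complete, and the recursion splits the last factor of [n]! by `[+]`.
-- Otherwise all five tails are multiples of `f *ₚ R`, and the cofactors satisfy `quantum-identity`.
tail-recursion : ∀ a k b →
  tail a b (suc k) +ₚ eCoeff 1 a (suc k) b ≋
    t^ suc k *ₚ ([ a ]ₜ *ₚ tail (pred a) b (suc k)) +ₚ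
    (t^ b *ₚ ([ suc k ]ₜ *ₚ tail a b k) +ₚ [ b ]ₜ *ₚ tail a (pred b) (suc k))
tail-recursion zero k b = begin
  [ b + suc k ]ₜ! +ₚ 0ₚ                                              ≈⟨ +-identityʳ _ ⟩
  [ b + suc k ]ₜ!                                                    ≡⟨ cong [_]ₜ! (ℕ.+-suc b k) ⟩
  [ b + k ]ₜ! *ₚ [ suc (b + k) ]ₜ                                    ≡⟨ cong (λ i → [ b + k ]ₜ! *ₚ [ i ]ₜ) (≡.sym (ℕ.+-suc b k)) ⟩
  [ b + k ]ₜ! *ₚ [ b + suc k ]ₜ                                      ≈⟨ *-congˡ {[ b + k ]ₜ!} ([+] b (suc k)) ⟩
  [ b + k ]ₜ! *ₚ ([ b ]ₜ +ₚ t^ b *ₚ [ suc k ]ₜ)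
    ≈⟨ solve 4 (λ f x p y → f :* (x :+ p :* y) := p :* (y :* f) :+ x :* f) refl [ b + k ]ₜ! [ b ]ₜ (t^ b) [ suc k ]ₜ ⟩
  t^ b *ₚ ([ suc k ]ₜ *ₚ [ b + k ]ₜ!) +ₚ [ b ]ₜ *ₚ [ b + k ]ₜ!
    ≈⟨ +-cong (sym (zeroʳ (t^ suc k))) (+-congˡ {t^ b *ₚ ([ suc k ]ₜ *ₚ [ b + k ]ₜ!)} (shift b)) ⟩
  t^ suc k *ₚ 0ₚ +ₚ (t^ b *ₚ ([ suc k ]ₜ *ₚ [ b + k ]ₜ!) +ₚ [ b ]ₜ *ₚ [ pred b + suc k ]ₜ!) ∎
  where
  shift : ∀ b → [ b ]ₜ *ₚ [ b + k ]ₜ! ≋ [ b ]ₜ *ₚ [ pred b + suc k ]ₜ!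
  shift zero    = refl
  shift (suc b) = reflexive (cong (λ i → [ suc b ]ₜ *ₚ [ i ]ₜ!) (≡.sym (ℕ.+-suc b k)))
tail-recursion (suc a) k zero = begin
  [ suc a + suc k ]ₜ! +ₚ 0ₚ                                          ≈⟨ +-identityʳ _ ⟩
  [ a + suc k ]ₜ! *ₚ [ suc (a + suc k) ]ₜ
    ≡⟨ cong (λ i → [ a + suc k ]ₜ! *ₚ [ i ]ₜ) (ℕ.+-comm (suc a) (suc k)) ⟩
  [ a + suc k ]ₜ! *ₚ [ suc k + suc a ]ₜ                              ≈⟨ *-congˡ {[ a + suc k ]ₜ!} ([+] (suc k) (suc a)) ⟩
  [ a + suc k ]ₜ! *ₚ ([ suc k ]ₜ +ₚ t^ suc k *ₚ [ suc a ]ₜ)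
    ≈⟨ solve 4 (λ f x p y → f :* (x :+ p :* y) := p :* (y :* f) :+ (con 1 :* (x :* f) :+ con 0)) refl
         [ a + suc k ]ₜ! [ suc k ]ₜ (t^ suc k) [ suc a ]ₜ ⟩
  t^ suc k *ₚ ([ suc a ]ₜ *ₚ [ a + suc k ]ₜ!) +ₚ (1ₚ *ₚ ([ suc k ]ₜ *ₚ [ a + suc k ]ₜ!) +ₚ 0ₚ)
    ≡⟨ cong₂ (λ p q → t^ suc k *ₚ ([ suc a ]ₜ *ₚ p) +ₚ (1ₚ *ₚ ([ suc k ]ₜ *ₚ q) +ₚ 0ₚ))
         (≡.sym (tail-zero a (suc k))) (cong [_]ₜ! (ℕ.+-suc a k)) ⟩
  t^ suc k *ₚ ([ suc a ]ₜ *ₚ tail a 0 (suc k)) +ₚ (1ₚ *ₚ ([ suc k ]ₜ *ₚ [ suc a + k ]ₜ!) +ₚ 0ₚ) ∎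
tail-recursion (suc a) k (suc b) = begin
  tail (suc a) (suc b) (suc k) +ₚ t^ suc k *ₚ ([ suc a ]ₜ *ₚ ([ suc b ]ₜ *ₚ tail a b (suc k)))
    ≈⟨ +-cong both (*-congˡ {t^ suc k} (*-congˡ {[ suc a ]ₜ} (*-congˡ {[ suc b ]ₜ} neither))) ⟩
  N+1 *ₚ (f *ₚ A+k *ₚ (R *ₚ B+k)) +ₚ t^ suc k *ₚ ([ suc a ]ₜ *ₚ ([ suc b ]ₜ *ₚ (N-1 *ₚ (f *ₚ R))))
    ≈⟨ solve 9 (λ x y n z p a b f r → n :* (f :* x :* (r :* y)) :+ p :* (a :* (b :* (z :* (f :* r))))
                 := (x :* y :* n :+ p :* a :* b :* z) :* (f :* r)) refl
         A+k B+k N+1 N-1 (t^ suc k) [ suc a ]ₜ [ suc b ]ₜ f R ⟩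
  (A+k *ₚ B+k *ₚ N+1 +ₚ t^ suc k *ₚ [ suc a ]ₜ *ₚ [ suc b ]ₜ *ₚ N-1) *ₚ (f *ₚ R)
    ≈⟨ *-congʳ (quantum-identity a b k) ⟩
  (N *ₚ (t^ suc k *ₚ [ suc a ]ₜ *ₚ B+k +ₚ (t^ suc b *ₚ [ suc k ]ₜ *ₚ [ k ]ₜ +ₚ [ suc b ]ₜ *ₚ A+k))) *ₚ (f *ₚ R)
    ≈⟨ solve 11 (λ x y n p a q k1 k b f r → (n :* (p :* a :* y :+ (q :* k1 :* k :+ b :* x))) :* (f :* r)
                  := p :* (a :* (n :* (f :* (r :* y)))) :+ (q :* (k1 :* (n :* (f :* (k :* r)))) :+ b :* (n :* (f :* x :* r)))) refl
         A+k B+k N (t^ suc k) [ suc a ]ₜ (t^ suc b) [ suc k ]ₜ [ k ]ₜ [ suc b ]ₜ f R ⟩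
  t^ suc k *ₚ ([ suc a ]ₜ *ₚ (N *ₚ (f *ₚ (R *ₚ B+k)))) +ₚ
    (t^ suc b *ₚ ([ suc k ]ₜ *ₚ (N *ₚ (f *ₚ ([ k ]ₜ *ₚ R)))) +ₚ [ suc b ]ₜ *ₚ (N *ₚ (f *ₚ A+k *ₚ R)))
    ≈⟨ +-cong (*-congˡ {t^ suc k} (*-congˡ {[ suc a ]ₜ} onlyB))
         (+-cong (*-congˡ {t^ suc b} (*-congˡ {[ suc k ]ₜ} lower-k)) (*-congˡ {[ suc b ]ₜ} onlyA)) ⟨
  t^ suc k *ₚ ([ suc a ]ₜ *ₚ tail a (suc b) (suc k)) +ₚ
    (t^ suc b *ₚ ([ suc k ]ₜ *ₚ tail (suc a) (suc b) k) +ₚ [ suc b ]ₜ *ₚ tail (suc a) b (suc k)) ∎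
  where
  A+k = [ suc a + k ]ₜ
  B+k = [ suc b + k ]ₜ
  N-1 = [ suc (a + (b + k)) ]ₜ
  N   = [ suc (suc (a + (b + k))) ]ₜ
  N+1 = [ suc (suc (suc (a + (b + k)))) ]ₜ
  f   = [ a + k ]ₜ!
  R   = rise (suc k) b

  snoc : rise (suc k) (suc b) ≋ R *ₚ B+k
  snoc = trans (rise-snoc (suc k) b) (*-congˡ {R} (reflexive (cong (λ i → [ suc i ]ₜ) (ℕ.+-comm k b))))

  a+sb : a + suc b + k ≡ suc (a + (b + k))
  a+sb = ≡.trans (cong (_+ k) (ℕ.+-suc a b)) (cong suc (ℕ.+-assoc a b k))

  both : tail (suc a) (suc b) (suc k) ≋ N+1 *ₚ (f *ₚ A+k *ₚ (R *ₚ B+k))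
  both = trans (tail-suc (suc a) (suc b) k)
    (*-cong (reflexive (cong (λ i → [ suc (suc i) ]ₜ) a+sb)) (*-congˡ {[ suc a + k ]ₜ!} snoc))

  neither : tail a b (suc k) ≋ N-1 *ₚ (f *ₚ R)
  neither = trans (tail-suc a b k) (*-congʳ (reflexive (cong (λ i → [ suc i ]ₜ) (ℕ.+-assoc a b k))))

  onlyB : tail a (suc b) (suc k) ≋ N *ₚ (f *ₚ (R *ₚ B+k))
  onlyB = trans (tail-suc a (suc b) k)
    (*-cong (reflexive (cong (λ i → [ suc i ]ₜ) a+sb)) (*-congˡ {f} snoc))

  onlyA : tail (suc a) b (suc k) ≋ N *ₚ (f *ₚ A+k *ₚ R)
  onlyA = trans (tail-suc (suc a) b k) (*-congʳ (reflexive (cong (λ i → [ suc (suc i) ]ₜ) (ℕ.+-assoc a b k))))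

  -- Since k may be 0, this uses the third clause of `tail` and not `tail-suc`; the factor `[ k ]ₜ`
  -- is the front factor of `rise k (suc b)`.
  lower-k : tail (suc a) (suc b) k ≋ N *ₚ (f *ₚ ([ k ]ₜ *ₚ R))
  lower-k = *-congʳ (reflexive (cong (λ i → [ suc (suc i) ]ₜ) (ℕ.+-assoc a b k)))

-- For j, a, b > 0 every term contains the factor that `eCoeff` gains when j, a and b each grow by
-- 1, which reduces the claim to j - 1.
eCoeff-recursion : ∀ j a k b →
  eCoeff j a (suc k) b +ₚ eCoeff (suc j) a (suc k) b ≋
    t^ suc k *ₚ ([ a ]ₜ *ₚ eCoeff j (pred a) (suc k) b) +ₚ
    (t^ b *ₚ ([ suc k ]ₜ *ₚ eCoeff j a k b) +ₚ [ b ]ₜ *ₚ eCoeff j a (suc k) (pred b))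
eCoeff-recursion zero    a       k b    = tail-recursion a k b
eCoeff-recursion (suc j) zero    k b    = sym (solve 4 (λ p q x y → p :* con 0 :+ (q :* (x :* con 0) :+ y :* con 0) := con 0) refl
  (t^ suc k) (t^ b) [ suc k ]ₜ [ b ]ₜ)
eCoeff-recursion (suc j) (suc a) k zero = sym (begin
  t^ suc k *ₚ ([ suc a ]ₜ *ₚ eCoeff (suc j) a (suc k) 0) +ₚ (1ₚ *ₚ ([ suc k ]ₜ *ₚ 0ₚ) +ₚ 0ₚ)
    ≡⟨ cong (λ p → t^ suc k *ₚ ([ suc a ]ₜ *ₚ p) +ₚ (1ₚ *ₚ ([ suc k ]ₜ *ₚ 0ₚ) +ₚ 0ₚ)) (eCoeff-noHigh j a (suc k)) ⟩
  t^ suc k *ₚ ([ suc a ]ₜ *ₚ 0ₚ) +ₚ (1ₚ *ₚ ([ suc k ]ₜ *ₚ 0ₚ) +ₚ 0ₚ)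
    ≈⟨ solve 3 (λ p x y → p :* (x :* con 0) :+ (con 1 :* (y :* con 0) :+ con 0) := con 0) refl (t^ suc k) [ suc a ]ₜ [ suc k ]ₜ ⟩
  0ₚ ∎)
eCoeff-recursion (suc j) (suc a) k (suc b) = begin
  T *ₚ (A *ₚ (B *ₚ eCoeff j a (suc k) b)) +ₚ T *ₚ (A *ₚ (B *ₚ eCoeff (suc j) a (suc k) b))
    ≈⟨ solve 5 (λ t a b x y → t :* (a :* (b :* x)) :+ t :* (a :* (b :* y)) := t :* (a :* (b :* (x :+ y)))) refl
         T A B (eCoeff j a (suc k) b) (eCoeff (suc j) a (suc k) b) ⟩
  T *ₚ (A *ₚ (B *ₚ (eCoeff j a (suc k) b +ₚ eCoeff (suc j) a (suc k) b)))
    ≈⟨ *-congˡ {T} (*-congˡ {A} (*-congˡ {B} (eCoeff-recursion j a k b))) ⟩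
  T *ₚ (A *ₚ (B *ₚ (T *ₚ ([ a ]ₜ *ₚ x) +ₚ (t^ b *ₚ (K *ₚ y) +ₚ [ b ]ₜ *ₚ z))))
    -- One t must be detached: the term with a mid vertex deleted has only `t^ k` in its
    -- coefficient, and the spare t turns `t^ b` into `t^ suc b`.
    ≈⟨ *-congʳ (t^-suc k) ⟩
  t *ₚ t^ k *ₚ (A *ₚ (B *ₚ (T *ₚ ([ a ]ₜ *ₚ x) +ₚ (t^ b *ₚ (K *ₚ y) +ₚ [ b ]ₜ *ₚ z))))
    ≈⟨ solve 12 (λ t tk T A B K a b tb x y z →
           t :* tk :* (A :* (B :* (T :* (a :* x) :+ (tb :* (K :* y) :+ b :* z))))
        := T :* (A :* ((t :* tk) :* (a :* (B :* x)))) :+ (t :* tb :* (K :* (tk :* (A :* (B :* y)))) :+ B :* ((t :* tk) :* (A :* (b :* z))))) refl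
         t (t^ k) T A B K [ a ]ₜ [ b ]ₜ (t^ b) x y z ⟩
  T *ₚ (A *ₚ ((t *ₚ t^ k) *ₚ ([ a ]ₜ *ₚ (B *ₚ x)))) +ₚ
    (t *ₚ t^ b *ₚ (K *ₚ (t^ k *ₚ (A *ₚ (B *ₚ y)))) +ₚ B *ₚ ((t *ₚ t^ k) *ₚ (A *ₚ ([ b ]ₜ *ₚ z))))
    ≈⟨ +-cong (*-congˡ {T} (*-congˡ {A} (*-congʳ (t^-suc k)))) (+-cong (*-congʳ (t^-suc b)) (*-congˡ {B} (*-congʳ (t^-suc k)))) ⟨
  T *ₚ (A *ₚ (T *ₚ ([ a ]ₜ *ₚ (B *ₚ x)))) +ₚ
    (t^ suc b *ₚ (K *ₚ (t^ k *ₚ (A *ₚ (B *ₚ y)))) +ₚ B *ₚ (T *ₚ (A *ₚ ([ b ]ₜ *ₚ z))))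
    ≈⟨ +-cong (*-congˡ {T} (*-congˡ {A} (eCoeff-sucʳ j a (suc k) b)))
         (+-congˡ {t^ suc b *ₚ (K *ₚ eCoeff (suc j) (suc a) k (suc b))} (*-congˡ {B} (eCoeff-sucˡ j a (suc k) b))) ⟨
  T *ₚ (A *ₚ eCoeff (suc j) a (suc k) (suc b)) +ₚ
    (t^ suc b *ₚ (K *ₚ eCoeff (suc j) (suc a) k (suc b)) +ₚ B *ₚ eCoeff (suc j) (suc a) (suc k) b) ∎
  where
  T = t^ suc k
  A = [ suc a ]ₜ
  B = [ suc b ]ₜ
  K = [ suc k ]ₜ
  x = eCoeff j (pred a) (suc k) b
  y = eCoeff j a k b
  z = eCoeff j a (suc k) (pred b)

-- Sums of products of two elementary symmetric functions

down : ℕ → (ℕ → ℤ) → ℤ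
down zero    f = 0ℤ
down (suc i) f = f i

unit : ℕ → ℕ → ℤ
unit zero    zero    = 1ℤ
unit zero    (suc j) = 0ℤ
unit (suc i) j       = 0ℤ

-- The coefficient of the monomial α in e_i e_j.
ee : ℕ → ℕ → List ℕ → ℤ
ee i j []                        = unit i j
ee i j (zero              ∷ α) = ee i j α
ee i j (suc zero          ∷ α) = down i (λ i′ → ee i′ j α) ℤ.+ down j (λ j′ → ee i j′ α)
ee i j (suc (suc zero)    ∷ α) = down i λ i′ → down j λ j′ → ee i′ j′ α
ee i j (suc (suc (suc c)) ∷ α) = 0ℤ

down-cong : ∀ i {f g} → (∀ i′ → f i′ ≡ g i′) → down i f ≡ down i g
down-cong zero    f≡g = ≡.refl
down-cong (suc i) f≡g = f≡g i

down-swap : ∀ i j (f : ℕ → ℕ → ℤ) → down i (λ i′ → down j (f i′)) ≡ down j (λ j′ → down i λ i′ → f i′ j′)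
down-swap zero    zero    f = ≡.refl
down-swap zero    (suc j) f = ≡.refl
down-swap (suc i) zero    f = ≡.refl
down-swap (suc i) (suc j) f = ≡.refl

ee-sym : ∀ i j α → ee i j α ≡ ee j i α
ee-sym zero    zero    []                      = ≡.refl
ee-sym zero    (suc j) []                      = ≡.refl
ee-sym (suc i) zero    []                      = ≡.refl
ee-sym (suc i) (suc j) []                      = ≡.refl
ee-sym i j (zero              ∷ α) = ee-sym i j α
ee-sym i j (suc zero          ∷ α) = ≡.trans
  (cong₂ ℤ._+_ (down-cong i λ i′ → ee-sym i′ j α) (down-cong j λ j′ → ee-sym i j′ α))
  (ℤ.+-comm (down i _) (down j _))
ee-sym i j (suc (suc zero)    ∷ α) = ≡.trans
  (down-cong i λ i′ → down-cong j λ j′ → ee-sym i′ j′ α) (down-swap i j _)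
ee-sym i j (suc (suc (suc c)) ∷ α) = ≡.refl

const : ℤ → Poly
const c = c ∷ []

const-0 : ∀ p → const 0ℤ *ₚ p ≋ 0ₚ
const-0 p = *-congʳ {p} Additive.0∷0

·ₚ-const : ∀ c p → c ·ₚ p ≋ const c *ₚ p
·ₚ-const c p = sym (trans (+-congˡ {c ·ₚ p} Additive.0∷0) (+-identityʳ _))

-- The summand takes both indices, instead of j and n ∸ j, so that either can be shifted without
-- truncated subtraction.
antidiagonal : ℕ → (ℕ → ℕ → Poly) → Poly
antidiagonal zero    g = g 0 0
antidiagonal (suc n) g = g (suc n) 0 +ₚ antidiagonal n (λ i j → g i (suc j))

antidiagonal-cong : ∀ n {g h} → (∀ i j → i + j ≡ n → g i j ≋ h i j) → antidiagonal n g ≋ antidiagonal n h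
antidiagonal-cong zero    g≋h = g≋h 0 0 ≡.refl
antidiagonal-cong (suc n) g≋h = +-cong (g≋h (suc n) 0 (ℕ.+-identityʳ _))
  (antidiagonal-cong n λ i j eq → g≋h i (suc j) (≡.trans (ℕ.+-suc i j) (cong suc eq)))

antidiagonal-+ : ∀ n g h → antidiagonal n (λ i j → g i j +ₚ h i j) ≋ antidiagonal n g +ₚ antidiagonal n h
antidiagonal-+ zero    g h = refl
antidiagonal-+ (suc n) g h = trans (+-congˡ {g (suc n) 0 +ₚ h (suc n) 0} (antidiagonal-+ n _ _))
  (solve 4 (λ a b c d → (a :+ b) :+ (c :+ d) := (a :+ c) :+ (b :+ d)) refl
    (g (suc n) 0) (h (suc n) 0) (antidiagonal n _) (antidiagonal n _))

antidiagonal-* : ∀ n p g → p *ₚ antidiagonal n g ≋ antidiagonal n (λ i j → p *ₚ g i j)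
antidiagonal-* zero    p g = refl
antidiagonal-* (suc n) p g = trans (distribˡ p _ _) (+-congˡ {p *ₚ g (suc n) 0} (antidiagonal-* n p _))

antidiagonal-0 : ∀ n {g} → (∀ i j → i + j ≡ n → g i j ≋ 0ₚ) → antidiagonal n g ≋ 0ₚ
antidiagonal-0 zero    g≋0 = g≋0 0 0 ≡.refl
antidiagonal-0 (suc n) g≋0 = +-cong (g≋0 (suc n) 0 (ℕ.+-identityʳ _))
  (antidiagonal-0 n λ i j eq → g≋0 i (suc j) (≡.trans (ℕ.+-suc i j) (cong suc eq)))

antidiagonal-first : ∀ n {g} → (∀ i j → g i (suc j) ≋ 0ₚ) → antidiagonal n g ≋ g n 0
antidiagonal-first zero    g≋0 = refl
antidiagonal-first (suc n) {g} g≋0 = trans (+-congˡ {g (suc n) 0} (antidiagonal-0 n λ i j _ → g≋0 i j)) (+-identityʳ _)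

antidiagonal-last : ∀ n g → antidiagonal (suc n) g ≋ antidiagonal n (λ i j → g (suc i) j) +ₚ g 0 (suc n)
antidiagonal-last zero    g = refl
antidiagonal-last (suc n) g = trans (+-congˡ {g (suc (suc n)) 0} (antidiagonal-last n (λ i j → g i (suc j))))
  (sym (+-assoc (g (suc (suc n)) 0) _ _))

eSum : ℕ → (ℕ → Poly) → List ℕ → Poly
eSum n K α = antidiagonal n λ i j → const (ee i j α) *ₚ K j

eSum-cong : ∀ n α {K L} → (∀ j → K j ≋ L j) → eSum n K α ≋ eSum n L α
eSum-cong n α K≋L = antidiagonal-cong n λ i j _ → *-congˡ {const (ee i j α)} (K≋L j)

eSum-+ : ∀ n α K L → eSum n (λ j → K j +ₚ L j) α ≋ eSum n K α +ₚ eSum n L α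
eSum-+ n α K L = trans (antidiagonal-cong n λ i j _ → distribˡ (const (ee i j α)) (K j) (L j)) (antidiagonal-+ n _ _)

eSum-* : ∀ n α p K → p *ₚ eSum n K α ≋ eSum n (λ j → p *ₚ K j) α
eSum-* n α p K = trans (antidiagonal-* n p _) (antidiagonal-cong n λ i j _ →
  solve 3 (λ p c x → p :* (c :* x) := c :* (p :* x)) refl p (const (ee i j α)) (K j))

eSum-[] : ∀ n K → eSum (suc n) K [] ≋ 0ₚ
eSum-[] n K = antidiagonal-0 (suc n) {λ i j → const (ee i j []) *ₚ K j} λ
  { zero    (suc j) _ → const-0 (K (suc j))
  ; (suc i) j       _ → const-0 (K j)
  }

-- Taking one variable out of a product lowers one of its two indices, so e_i e_j receives `K j`
-- from e_{i+1} e_j and `K (suc j)` from e_i e_{j+1}.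
eSum-1 : ∀ n K α → eSum (suc n) K (1 ∷ α) ≋ eSum n (λ j → K j +ₚ K (suc j)) α
eSum-1 n K α = begin
  eSum (suc n) K (1 ∷ α)
    ≈⟨ antidiagonal-cong (suc n) (λ i j _ → distribʳ (K j) (const (f i j)) (const (g i j))) ⟩
  antidiagonal (suc n) (λ i j → const (f i j) *ₚ K j +ₚ const (g i j) *ₚ K j)
    ≈⟨ antidiagonal-+ (suc n) (λ i j → const (f i j) *ₚ K j) (λ i j → const (g i j) *ₚ K j) ⟩
  antidiagonal (suc n) (λ i j → const (f i j) *ₚ K j) +ₚ antidiagonal (suc n) (λ i j → const (g i j) *ₚ K j)
    ≈⟨ +-cong (trans (antidiagonal-last n (λ i j → const (f i j) *ₚ K j)) (+-congˡ {eSum n K α} (const-0 (K (suc n)))))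
              (+-congʳ {eSum n (K ∘ suc) α} (const-0 (K 0))) ⟩
  (eSum n K α +ₚ 0ₚ) +ₚ eSum n (K ∘ suc) α
    ≈⟨ +-congʳ {eSum n (K ∘ suc) α} (+-identityʳ (eSum n K α)) ⟩
  eSum n K α +ₚ eSum n (K ∘ suc) α
    ≈⟨ eSum-+ n α K (K ∘ suc) ⟨
  eSum n (λ j → K j +ₚ K (suc j)) α ∎
  where
  f g : ℕ → ℕ → ℤ
  f i j = down i (λ i′ → ee i′ j α)
  g i j = down j (λ j′ → ee i j′ α)

-- A square uses the variable in both factors, so e_i e_j is reached from e_{i+1} e_{j+1} alone.
eSum-2 : ∀ n K α → eSum (suc (suc n)) K (2 ∷ α) ≋ eSum n (K ∘ suc) α
eSum-2 n K α = begin
  const 0ℤ *ₚ K 0 +ₚ antidiagonal (suc n) (λ i j → const (down i λ i′ → ee i′ j α) *ₚ K (suc j))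
    ≈⟨ +-cong (const-0 (K 0)) (antidiagonal-last n (λ i j → const (down i λ i′ → ee i′ j α) *ₚ K (suc j))) ⟩
  eSum n (K ∘ suc) α +ₚ const 0ℤ *ₚ K (suc (suc n))
    ≈⟨ +-congˡ {eSum n (K ∘ suc) α} (const-0 (K (suc (suc n)))) ⟩
  eSum n (K ∘ suc) α +ₚ 0ₚ
    ≈⟨ +-identityʳ _ ⟩
  eSum n (K ∘ suc) α ∎

-- For graphs without low or without high vertices, whose degree may be 1, out of reach of `eSum-2`.
-- Only j = 0 remains, and e_0 cannot supply its half of the square.
eSum-2-vanishes : ∀ n K α → (∀ j → K (suc j) ≋ 0ₚ) → eSum n K (2 ∷ α) ≋ 0ₚ
eSum-2-vanishes n K α K≋0 = antidiagonal-0 n {λ i j → const (ee i j (2 ∷ α)) *ₚ K j} λ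
  { zero    zero    _ → const-0 (K 0)
  ; (suc i) zero    _ → const-0 (K 0)
  ; i       (suc j) _ → trans (*-congˡ {const (ee i (suc j) (2 ∷ α))} (K≋0 j)) (zeroʳ (const (ee i (suc j) (2 ∷ α))))
  }

-- Block sums as combinations of the products e_i e_j

blockSum : ℕ → ℕ → ℕ → List ℕ → Poly
blockSum a m b α = colorSum (λ _ _ → 1ₚ) (blocks a m b) (fromList α)

module _ where

  private
    w : Block → Bool → Poly
    w _ _ = 1ₚ

    all-free : ∀ x → Free w x
    all-free x = free refl refl

    split : ∀ a m b c α → blockSum a m b (c ∷ α) ≋ classSum w c (blocks a m b) (λ ρ → colorSum (λ _ _ → 1ₚ) ρ (fromList α))
    split a m b c α = colorSum-split (blocks a m b) _ w _ c (fromList α) (λ _ → refl) (λ _ _ → refl)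

  blockSum-0 : ∀ a m b α → blockSum a m b (0 ∷ α) ≋ blockSum a m b α
  blockSum-0 a m b α = trans (split a m b 0 α) (free-none w (blocks a m b) _ (All.universal all-free _))

  blockSum-1 : ∀ a m b α → blockSum a m b (1 ∷ α) ≋
    t^ m *ₚ ([ a ]ₜ *ₚ blockSum (pred a) m b α) +ₚ
    (t^ b *ₚ ([ m ]ₜ *ₚ blockSum a (pred m) b α) +ₚ [ b ]ₜ *ₚ blockSum a m (pred b) α)
  blockSum-1 a m b α = trans (split a m b 1 α) (class-one w (all-free low) (all-free mid) (all-free high) a m b _)

  blockSum-2 : ∀ a m b α → blockSum a m b (2 ∷ α) ≋
    t^ m *ₚ ([ a ]ₜ *ₚ ([ b ]ₜ *ₚ blockSum (pred a) m (pred b) α))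
  blockSum-2 a m b α = trans (split a m b 2 α) (class-two w (all-free low) (all-free mid) (all-free high) a m b _)

  blockSum-3 : ∀ c a m b α → blockSum a m b (suc (suc (suc c)) ∷ α) ≋ 0ₚ
  blockSum-3 c a m b α = trans (split a m b (suc (suc (suc c))) α) (class-three w (all-free low) (all-free mid) (all-free high) c a m b _)

  blockSum-[] : ∀ a m b → blockSum a m b [] ≋ const (ee (a + m + b) 0 [])
  blockSum-[] zero    zero    zero    = refl
  blockSum-[] zero    zero    (suc b) = sym Additive.0∷0
  blockSum-[] zero    (suc m) b       = sym Additive.0∷0
  blockSum-[] (suc a) m       b       = sym Additive.0∷0

-- With no mid vertices the graph is a disjoint union of two complete graphs.
blockSum-disjoint : ∀ α a b → blockSum a 0 b α ≋ const (ee a b α) *ₚ ([ a ]ₜ! *ₚ [ b ]ₜ!)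
blockSum-disjoint [] a b = trans (blockSum-[] a 0 b) (base a b)
  where
  base : ∀ a b → const (ee (a + 0 + b) 0 []) ≋ const (ee a b []) *ₚ ([ a ]ₜ! *ₚ [ b ]ₜ!)
  base zero    zero    = refl
  base zero    (suc b) = trans Additive.0∷0 (sym (const-0 (1ₚ *ₚ [ suc b ]ₜ!)))
  base (suc a) b       = trans Additive.0∷0 (sym (const-0 ([ suc a ]ₜ! *ₚ [ b ]ₜ!)))
blockSum-disjoint (0 ∷ α) a b = trans (blockSum-0 a 0 b α) (blockSum-disjoint α a b)
blockSum-disjoint (1 ∷ α) a b = begin
  blockSum a 0 b (1 ∷ α)
    ≈⟨ blockSum-1 a 0 b α ⟩
  1ₚ *ₚ ([ a ]ₜ *ₚ blockSum (pred a) 0 b α) +ₚ (t^ b *ₚ 0ₚ +ₚ [ b ]ₜ *ₚ blockSum a 0 (pred b) α)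
    ≈⟨ +-cong (*-congˡ {1ₚ} (lhs a)) (+-congˡ {t^ b *ₚ 0ₚ} (rhs b)) ⟩
  1ₚ *ₚ (const x *ₚ ([ a ]ₜ! *ₚ [ b ]ₜ!)) +ₚ (t^ b *ₚ 0ₚ +ₚ const y *ₚ ([ a ]ₜ! *ₚ [ b ]ₜ!))
    ≈⟨ solve 4 (λ x y f p → con 1 :* (x :* f) :+ (p :* con 0 :+ y :* f) := (x :+ y) :* f) refl
         (const x) (const y) ([ a ]ₜ! *ₚ [ b ]ₜ!) (t^ b) ⟩
  const (x ℤ.+ y) *ₚ ([ a ]ₜ! *ₚ [ b ]ₜ!) ∎
  where
  x = down a (λ i → ee i b α)
  y = down b (λ j → ee a j α)
  lhs : ∀ a → [ a ]ₜ *ₚ blockSum (pred a) 0 b α ≋ const (down a λ i → ee i b α) *ₚ ([ a ]ₜ! *ₚ [ b ]ₜ!)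
  lhs zero    = sym (const-0 (1ₚ *ₚ [ b ]ₜ!))
  lhs (suc a) = trans (*-congˡ {[ suc a ]ₜ} (blockSum-disjoint α a b))
    (solve 4 (λ n c f g → n :* (c :* (f :* g)) := c :* (f :* n :* g)) refl [ suc a ]ₜ (const (ee a b α)) [ a ]ₜ! [ b ]ₜ!)
  rhs : ∀ b → [ b ]ₜ *ₚ blockSum a 0 (pred b) α ≋ const (down b λ j → ee a j α) *ₚ ([ a ]ₜ! *ₚ [ b ]ₜ!)
  rhs zero    = sym (const-0 ([ a ]ₜ! *ₚ 1ₚ))
  rhs (suc b) = trans (*-congˡ {[ suc b ]ₜ} (blockSum-disjoint α a b))
    (solve 4 (λ n c f g → n :* (c :* (f :* g)) := c :* (f :* (g :* n))) refl [ suc b ]ₜ (const (ee a b α)) [ a ]ₜ! [ b ]ₜ!)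
blockSum-disjoint (2 ∷ α) a b = trans (blockSum-2 a 0 b α) (cases a b)
  where
  cases : ∀ a b → 1ₚ *ₚ ([ a ]ₜ *ₚ ([ b ]ₜ *ₚ blockSum (pred a) 0 (pred b) α)) ≋ const (ee a b (2 ∷ α)) *ₚ ([ a ]ₜ! *ₚ [ b ]ₜ!)
  cases zero    b       = trans (zeroʳ 1ₚ) (sym (const-0 (1ₚ *ₚ [ b ]ₜ!)))
  cases (suc a) zero    = trans (trans (*-congˡ {1ₚ} (zeroʳ [ suc a ]ₜ)) (zeroʳ 1ₚ)) (sym (const-0 ([ suc a ]ₜ! *ₚ 1ₚ)))
  cases (suc a) (suc b) = trans (*-congˡ {1ₚ} (*-congˡ {[ suc a ]ₜ} (*-congˡ {[ suc b ]ₜ} (blockSum-disjoint α a b))))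
    (solve 5 (λ n k c f g → con 1 :* (n :* (k :* (c :* (f :* g)))) := c :* (f :* n :* (g :* k))) refl
      [ suc a ]ₜ [ suc b ]ₜ (const (ee a b α)) [ a ]ₜ! [ b ]ₜ!)
blockSum-disjoint (suc (suc (suc c)) ∷ α) a b = trans (blockSum-3 c a 0 b α) (sym (const-0 ([ a ]ₜ! *ₚ [ b ]ₜ!)))

-- At m = 0 only j = min(a,b) has a nonzero coefficient, which leaves the value of g at (max, min);
-- symmetry of g turns it into `g a b`. The general g lets the induction shift both indices at once.
eSum-disjoint : ∀ a b (g : ℕ → ℕ → ℤ) → (∀ i j → g i j ≡ g j i) →
  antidiagonal (a + b) (λ i j → const (g i j) *ₚ eCoeff j a 0 b) ≋ const (g a b) *ₚ ([ a ]ₜ! *ₚ [ b ]ₜ!)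
eSum-disjoint zero b g g-sym = begin
  antidiagonal b (λ i j → const (g i j) *ₚ eCoeff j 0 0 b)
    ≈⟨ antidiagonal-first b {λ i j → const (g i j) *ₚ eCoeff j 0 0 b} (λ i j → zeroʳ (const (g i (suc j)))) ⟩
  const (g b 0) *ₚ [ b + 0 ]ₜ!
    ≡⟨ cong₂ (λ c i → const c *ₚ [ i ]ₜ!) (g-sym b 0) (ℕ.+-identityʳ b) ⟩
  const (g 0 b) *ₚ [ b ]ₜ!
    ≈⟨ *-congˡ {const (g 0 b)} (*-identityˡ [ b ]ₜ!) ⟨
  const (g 0 b) *ₚ (1ₚ *ₚ [ b ]ₜ!) ∎
eSum-disjoint (suc a) zero g g-sym = begin
  antidiagonal (suc a + 0) (λ i j → const (g i j) *ₚ eCoeff j (suc a) 0 0)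
    ≈⟨ antidiagonal-first (suc a + 0) {λ i j → const (g i j) *ₚ eCoeff j (suc a) 0 0} (λ i j → zeroʳ (const (g i (suc j)))) ⟩
  const (g (suc a + 0) 0) *ₚ [ suc a + 0 ]ₜ!
    ≡⟨ cong (λ i → const (g i 0) *ₚ [ i ]ₜ!) (ℕ.+-identityʳ (suc a)) ⟩
  const (g (suc a) 0) *ₚ [ suc a ]ₜ!
    ≈⟨ *-congˡ {const (g (suc a) 0)} (*-identityʳ [ suc a ]ₜ!) ⟨
  const (g (suc a) 0) *ₚ ([ suc a ]ₜ! *ₚ 1ₚ) ∎
eSum-disjoint (suc a) (suc b) g g-sym = begin
  const (g (suc a + suc b) 0) *ₚ tail (suc a) (suc b) 0 +ₚ
    antidiagonal (a + suc b) (λ i j → const (g i (suc j)) *ₚ eCoeff (suc j) (suc a) 0 (suc b))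
    ≈⟨ +-congʳ (solve 3 (λ c x y → c :* (x :* (y :* con 0)) := con 0) refl
         (const (g (suc a + suc b) 0)) [ suc (suc (a + b + 0)) ]ₜ [ a + 0 ]ₜ!) ⟩
  antidiagonal (a + suc b) (λ i j → const (g i (suc j)) *ₚ eCoeff (suc j) (suc a) 0 (suc b))
    ≡⟨ cong (λ n → antidiagonal n (λ i j → const (g i (suc j)) *ₚ eCoeff (suc j) (suc a) 0 (suc b))) (ℕ.+-suc a b) ⟩
  antidiagonal (suc (a + b)) (λ i j → const (g i (suc j)) *ₚ eCoeff (suc j) (suc a) 0 (suc b))
    ≈⟨ antidiagonal-last (a + b) (λ i j → const (g i (suc j)) *ₚ eCoeff (suc j) (suc a) 0 (suc b)) ⟩
  antidiagonal (a + b) (λ i j → const (g (suc i) (suc j)) *ₚ eCoeff (suc j) (suc a) 0 (suc b))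
    +ₚ const (g 0 (suc (suc (a + b)))) *ₚ eCoeff (suc (suc (a + b))) (suc a) 0 (suc b)
    ≈⟨ +-cong
         (antidiagonal-cong (a + b) λ i j _ → solve 4 (λ c x y z → c :* (con 1 :* (x :* (y :* z))) := (x :* y) :* (c :* z)) refl
           (const (g (suc i) (suc j))) [ suc a ]ₜ [ suc b ]ₜ (eCoeff j a 0 b))
         (trans (*-congˡ {const (g 0 (suc (suc (a + b))))} (eCoeff-vanishes (suc (suc (a + b))) (suc a) 0 (suc b) (s≤s (s≤s (ℕ.≤-trans (ℕ.m⊓n≤n b a) (ℕ.m≤m+n a b))))))
           (zeroʳ (const (g 0 (suc (suc (a + b))))))) ⟩
  antidiagonal (a + b) (λ i j → ([ suc a ]ₜ *ₚ [ suc b ]ₜ) *ₚ (const (g (suc i) (suc j)) *ₚ eCoeff j a 0 b)) +ₚ 0ₚ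
    ≈⟨ +-identityʳ _ ⟩
  antidiagonal (a + b) (λ i j → ([ suc a ]ₜ *ₚ [ suc b ]ₜ) *ₚ (const (g (suc i) (suc j)) *ₚ eCoeff j a 0 b))
    ≈⟨ antidiagonal-* (a + b) ([ suc a ]ₜ *ₚ [ suc b ]ₜ) _ ⟨
  ([ suc a ]ₜ *ₚ [ suc b ]ₜ) *ₚ antidiagonal (a + b) (λ i j → const (g (suc i) (suc j)) *ₚ eCoeff j a 0 b)
    ≈⟨ *-congˡ {[ suc a ]ₜ *ₚ [ suc b ]ₜ} (eSum-disjoint a b (λ i j → g (suc i) (suc j)) (λ i j → g-sym (suc i) (suc j))) ⟩
  ([ suc a ]ₜ *ₚ [ suc b ]ₜ) *ₚ (const (g (suc a) (suc b)) *ₚ ([ a ]ₜ! *ₚ [ b ]ₜ!))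
    ≈⟨ solve 5 (λ x y c f h → (x :* y) :* (c :* (f :* h)) := c :* (f :* x :* (h :* y))) refl
         [ suc a ]ₜ [ suc b ]ₜ (const (g (suc a) (suc b))) [ a ]ₜ! [ b ]ₜ! ⟩
  const (g (suc a) (suc b)) *ₚ ([ suc a ]ₜ! *ₚ [ suc b ]ₜ!) ∎

-- The induction is on α alone, for all block sizes together; when deleting the only mid vertex
-- leaves m = 0, the first clause takes over.
blockSum≋eSum : ∀ α a m b → blockSum a m b α ≋ eSum (a + (m + b)) (λ j → eCoeff j a m b) α
blockSum≋eSum α a zero b = trans (blockSum-disjoint α a b)
  (sym (eSum-disjoint a b (λ i j → ee i j α) (λ i j → ee-sym i j α)))
blockSum≋eSum [] a (suc k) b = begin
  blockSum a (suc k) b []                                      ≈⟨ blockSum-[] a (suc k) b ⟩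
  const (ee (a + suc k + b) 0 [])                              ≡⟨ cong (λ i → const (ee i 0 [])) (cong (_+ b) (ℕ.+-suc a k)) ⟩
  const 0ℤ                                                     ≈⟨ Additive.0∷0 ⟩
  0ₚ                                                           ≈⟨ eSum-[] (a + (k + b)) (λ j → eCoeff j a (suc k) b) ⟨
  eSum (suc (a + (k + b))) (λ j → eCoeff j a (suc k) b) []     ≡⟨ cong (λ n → eSum n (λ j → eCoeff j a (suc k) b) []) (≡.sym (ℕ.+-suc a (k + b))) ⟩
  eSum (a + suc (k + b)) (λ j → eCoeff j a (suc k) b) []       ∎
blockSum≋eSum (0 ∷ α) a (suc k) b = trans (blockSum-0 a (suc k) b α) (blockSum≋eSum α a (suc k) b)
blockSum≋eSum (1 ∷ α) a (suc k) b = begin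
  blockSum a (suc k) b (1 ∷ α)
    ≈⟨ blockSum-1 a (suc k) b α ⟩
  T *ₚ ([ a ]ₜ *ₚ blockSum (pred a) (suc k) b α) +ₚ
    (t^ b *ₚ ([ suc k ]ₜ *ₚ blockSum a k b α) +ₚ [ b ]ₜ *ₚ blockSum a (suc k) (pred b) α)
    ≈⟨ +-cong (*-congˡ {T} (lowTerm a)) (+-cong (*-congˡ {t^ b} (*-congˡ {[ suc k ]ₜ} (blockSum≋eSum α a k b))) (highTerm b)) ⟩
  T *ₚ ([ a ]ₜ *ₚ eSum n (λ j → eCoeff j (pred a) (suc k) b) α) +ₚ
    (t^ b *ₚ ([ suc k ]ₜ *ₚ eSum n (λ j → eCoeff j a k b) α) +ₚ [ b ]ₜ *ₚ eSum n (λ j → eCoeff j a (suc k) (pred b)) α)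
    ≈⟨ +-cong (scale T [ a ]ₜ _) (+-cong (scale (t^ b) [ suc k ]ₜ _) (eSum-* n α [ b ]ₜ _)) ⟩
  eSum n (λ j → T *ₚ ([ a ]ₜ *ₚ eCoeff j (pred a) (suc k) b)) α +ₚ
    (eSum n (λ j → t^ b *ₚ ([ suc k ]ₜ *ₚ eCoeff j a k b)) α +ₚ eSum n (λ j → [ b ]ₜ *ₚ eCoeff j a (suc k) (pred b)) α)
    ≈⟨ +-congˡ {eSum n (λ j → T *ₚ ([ a ]ₜ *ₚ eCoeff j (pred a) (suc k) b)) α} (eSum-+ n α _ _) ⟨
  _
    ≈⟨ eSum-+ n α _ _ ⟨
  _
    ≈⟨ eSum-cong n α (λ j → eCoeff-recursion j a k b) ⟨
  eSum n (λ j → eCoeff j a (suc k) b +ₚ eCoeff (suc j) a (suc k) b) α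
    ≈⟨ eSum-1 n (λ j → eCoeff j a (suc k) b) α ⟨
  eSum (suc n) (λ j → eCoeff j a (suc k) b) (1 ∷ α)
    ≡⟨ cong (λ n → eSum n (λ j → eCoeff j a (suc k) b) (1 ∷ α)) (≡.sym (ℕ.+-suc a (k + b))) ⟩
  eSum (a + suc (k + b)) (λ j → eCoeff j a (suc k) b) (1 ∷ α) ∎
  where
  n = a + (k + b)
  T = t^ suc k

  scale : ∀ p q K → p *ₚ (q *ₚ eSum n K α) ≋ eSum n (λ j → p *ₚ (q *ₚ K j)) α
  scale p q K = trans (*-congˡ {p} (eSum-* n α q K)) (eSum-* n α p _)

  lowTerm : ∀ a → [ a ]ₜ *ₚ blockSum (pred a) (suc k) b α ≋ [ a ]ₜ *ₚ eSum (a + (k + b)) (λ j → eCoeff j (pred a) (suc k) b) α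
  lowTerm zero    = refl
  lowTerm (suc a) = *-congˡ {[ suc a ]ₜ} (trans (blockSum≋eSum α a (suc k) b)
    (reflexive (cong (λ n → eSum n (λ j → eCoeff j a (suc k) b) α) (ℕ.+-suc a (k + b)))))

  highTerm : ∀ b → [ b ]ₜ *ₚ blockSum a (suc k) (pred b) α ≋ [ b ]ₜ *ₚ eSum (a + (k + b)) (λ j → eCoeff j a (suc k) (pred b)) α
  highTerm zero    = refl
  highTerm (suc b) = *-congˡ {[ suc b ]ₜ} (trans (blockSum≋eSum α a (suc k) b)
    (reflexive (cong (λ n → eSum (a + n) (λ j → eCoeff j a (suc k) b) α) (≡.sym (ℕ.+-suc k b)))))
blockSum≋eSum (2 ∷ α) a (suc k) b = trans (blockSum-2 a (suc k) b α) (cases a b)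
  where
  T = t^ suc k
  cases : ∀ a b → T *ₚ ([ a ]ₜ *ₚ ([ b ]ₜ *ₚ blockSum (pred a) (suc k) (pred b) α)) ≋ eSum (a + suc (k + b)) (λ j → eCoeff j a (suc k) b) (2 ∷ α)
  cases zero    b       = trans (zeroʳ T) (sym (eSum-2-vanishes (suc (k + b)) (λ j → eCoeff j 0 (suc k) b) α λ j → refl))
  cases (suc a) zero    = trans (trans (*-congˡ {T} (zeroʳ [ suc a ]ₜ)) (zeroʳ T))
    (sym (eSum-2-vanishes (suc a + suc (k + 0)) (λ j → eCoeff j (suc a) (suc k) 0) α λ j → refl))
  cases (suc a) (suc b) = begin
    T *ₚ ([ suc a ]ₜ *ₚ ([ suc b ]ₜ *ₚ blockSum a (suc k) b α))
      ≈⟨ *-congˡ {T} (*-congˡ {[ suc a ]ₜ} (*-congˡ {[ suc b ]ₜ} (blockSum≋eSum α a (suc k) b))) ⟩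
    T *ₚ ([ suc a ]ₜ *ₚ ([ suc b ]ₜ *ₚ eSum n (λ j → eCoeff j a (suc k) b) α))
      ≈⟨ *-congˡ {T} (*-congˡ {[ suc a ]ₜ} (eSum-* n α [ suc b ]ₜ _)) ⟩
    T *ₚ ([ suc a ]ₜ *ₚ eSum n (λ j → [ suc b ]ₜ *ₚ eCoeff j a (suc k) b) α)
      ≈⟨ *-congˡ {T} (eSum-* n α [ suc a ]ₜ _) ⟩
    T *ₚ eSum n (λ j → [ suc a ]ₜ *ₚ ([ suc b ]ₜ *ₚ eCoeff j a (suc k) b)) α
      ≈⟨ eSum-* n α T _ ⟩
    eSum n (λ j → eCoeff (suc j) (suc a) (suc k) (suc b)) α
      ≈⟨ eSum-2 n (λ j → eCoeff j (suc a) (suc k) (suc b)) α ⟨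
    eSum (suc (suc n)) (λ j → eCoeff j (suc a) (suc k) (suc b)) (2 ∷ α)
      ≡⟨ cong (λ n → eSum (suc n) (λ j → eCoeff j (suc a) (suc k) (suc b)) (2 ∷ α))
           (≡.trans (≡.sym (ℕ.+-suc a (suc (k + b)))) (cong (λ i → a + suc i) (≡.sym (ℕ.+-suc k b)))) ⟩
    eSum (suc a + suc (k + suc b)) (λ j → eCoeff j (suc a) (suc k) (suc b)) (2 ∷ α) ∎
    where n = a + suc (k + b)
blockSum≋eSum (suc (suc (suc c)) ∷ α) a (suc k) b = trans (blockSum-3 c a (suc k) b α)
  (sym (antidiagonal-0 (a + suc (k + b)) λ i j _ → const-0 (eCoeff j a (suc k) b)))

-- Products of elementary symmetric functions as power series

open ListFold ℤ.+-0-monoid using () renaming (fold-cartesianProductWith to sumℤ-cartesianProductWith)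

sumℤ-0 : ∀ {A : Set} (f : A → ℤ) → (∀ x → f x ≡ 0ℤ) → ∀ xs → sumℤ (map f xs) ≡ 0ℤ
sumℤ-0 f f≡0 []       = ≡.refl
sumℤ-0 f f≡0 (x ∷ xs) = cong₂ ℤ._+_ (f≡0 x) (sumℤ-0 f f≡0 xs)

*ₛ-∷ : ∀ f g a α → (f *ₛ g) (a ∷ α) ≡
  sumℤ (map (λ b → ((λ β → f (b ∷ β)) *ₛ (λ γ → g (a ∸ b ∷ γ))) α) (upTo (suc a)))
*ₛ-∷ f g a α = sumℤ-cartesianProductWith (λ (β , γ) → f β ℤ.* g γ) _ (upTo (suc a)) (splits α)

*ₛ-cong : ∀ {f f′ g g′ : Series} → (∀ β → f β ≡ f′ β) → (∀ γ → g γ ≡ g′ γ) → ∀ α → (f *ₛ g) α ≡ (f′ *ₛ g′) α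
*ₛ-cong f≡ g≡ α = cong sumℤ (List.map-cong (λ (β , γ) → cong₂ ℤ._*_ (f≡ β) (g≡ γ)) (splits α))

*ₛ-zeroˡ : ∀ {f : Series} g → (∀ β → f β ≡ 0ℤ) → ∀ α → (f *ₛ g) α ≡ 0ℤ
*ₛ-zeroˡ g f≡0 α = sumℤ-0 _ (λ (β , γ) → cong (ℤ._* g γ) (f≡0 β)) (splits α)

*ₛ-zeroʳ : ∀ f {g : Series} → (∀ γ → g γ ≡ 0ℤ) → ∀ α → (f *ₛ g) α ≡ 0ℤ
*ₛ-zeroʳ f g≡0 α = sumℤ-0 _ (λ (β , γ) → ≡.trans (cong (f β ℤ.*_) (g≡0 γ)) (ℤ.*-zeroʳ (f β))) (splits α)

elementary-[] : ∀ k → elementary k [] ≡ unit k 0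
elementary-[] zero    = ≡.refl
elementary-[] (suc k) = ≡.refl

elementary-1 : ∀ k α → elementary k (1 ∷ α) ≡ down k λ k′ → elementary k′ α
elementary-1 (suc k) α = ≡.refl
elementary-1 zero    α with does (All.all? (_≤? 1) α)
... | true  = ≡.refl
... | false = ≡.refl

down-*ₛˡ : ∀ i (f : ℕ → Series) g α → ((λ β → down i λ i′ → f i′ β) *ₛ g) α ≡ down i λ i′ → (f i′ *ₛ g) α
down-*ₛˡ zero    f g α = *ₛ-zeroˡ g (λ _ → ≡.refl) α
down-*ₛˡ (suc i) f g α = ≡.refl

down-*ₛʳ : ∀ f j (g : ℕ → Series) α → (f *ₛ (λ γ → down j λ j′ → g j′ γ)) α ≡ down j λ j′ → (f *ₛ g j′) α
down-*ₛʳ f zero    g α = *ₛ-zeroʳ f (λ _ → ≡.refl) α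
down-*ₛʳ f (suc j) g α = ≡.refl

-- By the exponent of the leading variable, of which a squarefree factor takes at most 1: an
-- exponent 1 goes to either factor, 2 splits only as 1 + 1, and larger ones not at all.
elementary-*ₛ : ∀ i j α → (elementary i *ₛ elementary j) α ≡ ee i j α
elementary-*ₛ i j [] = ≡.trans (cong₂ (λ x y → x ℤ.* y ℤ.+ 0ℤ) (elementary-[] i) (elementary-[] j)) (units i j)
  where
  units : ∀ i j → unit i 0 ℤ.* unit j 0 ℤ.+ 0ℤ ≡ unit i j
  units zero    zero    = ≡.refl
  units zero    (suc j) = ≡.refl
  units (suc i) zero    = ≡.refl
  units (suc i) (suc j) = ≡.refl
elementary-*ₛ i j (zero ∷ α) = ≡.trans (*ₛ-∷ (elementary i) (elementary j) 0 α)
  (≡.trans (ℤ.+-identityʳ _) (elementary-*ₛ i j α))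
elementary-*ₛ i j (suc zero ∷ α) = ≡.trans
    (*ₛ-∷ (elementary i) (elementary j) 1 α)
    (≡.trans
    (cong₂ ℤ._+_
         (≡.trans (*ₛ-cong {elementary i} (λ _ → ≡.refl) (elementary-1 j) α)
           (≡.trans (down-*ₛʳ (elementary i) j elementary α) (down-cong j λ j′ → elementary-*ₛ i j′ α)))
         (≡.trans (ℤ.+-identityʳ _) (≡.trans (*ₛ-cong {g = elementary j} (elementary-1 i) (λ _ → ≡.refl) α)
           (≡.trans (down-*ₛˡ i elementary (elementary j) α) (down-cong i λ i′ → elementary-*ₛ i′ j α)))))
    (ℤ.+-comm (down j _) (down i _)))
elementary-*ₛ i j (suc (suc zero) ∷ α) = ≡.trans
    (*ₛ-∷ (elementary i) (elementary j) 2 α)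
    (≡.trans
    (cong₂ ℤ._+_ (*ₛ-zeroʳ (elementary i) (λ _ → ≡.refl) α) (cong₂ ℤ._+_ middle
         (cong (ℤ._+ 0ℤ) (*ₛ-zeroˡ (elementary j) (λ _ → ≡.refl) α))))
    (≡.trans (ℤ.+-identityˡ _) (ℤ.+-identityʳ _)))
  where
  middle : ((λ β → elementary i (1 ∷ β)) *ₛ (λ γ → elementary j (1 ∷ γ))) α ≡ ee i j (2 ∷ α)
  middle = ≡.trans (*ₛ-cong (elementary-1 i) (elementary-1 j) α)
    (≡.trans (down-*ₛˡ i elementary (λ γ → down j λ j′ → elementary j′ γ) α)
      (down-cong i λ i′ → ≡.trans (down-*ₛʳ (elementary i′) j elementary α) (down-cong j λ j′ → elementary-*ₛ i′ j′ α)))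
elementary-*ₛ i j (suc (suc (suc c)) ∷ α) = ≡.trans (*ₛ-∷ (elementary i) (elementary j) (suc (suc (suc c))) α)
  (sumℤ-0 _ vanishes (upTo (suc (suc (suc (suc c))))))
  where
  vanishes : ∀ b → ((λ β → elementary i (b ∷ β)) *ₛ (λ γ → elementary j (suc (suc (suc c)) ∸ b ∷ γ))) α ≡ 0ℤ
  vanishes zero          = *ₛ-zeroʳ (elementary i) (λ _ → ≡.refl) α
  vanishes (suc zero)    = *ₛ-zeroʳ (λ β → elementary i (1 ∷ β)) (λ _ → ≡.refl) α
  vanishes (suc (suc b)) = *ₛ-zeroˡ (λ γ → elementary j (suc c ∸ b ∷ γ)) (λ _ → ≡.refl) α

-- The unit that ends the product in `e` is read as e_0, so that a one-part `e` is covered by `ee`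
-- as well.
1ₛ≡elementary-0 : ∀ α → 1ₛ α ≡ elementary 0 α
1ₛ≡elementary-0 []          = ≡.refl
1ₛ≡elementary-0 (zero  ∷ α) = 1ₛ≡elementary-0 α
1ₛ≡elementary-0 (suc zero ∷ α) = ≡.sym (elementary-1 0 α)
1ₛ≡elementary-0 (suc (suc c) ∷ α) = ≡.refl

e-one : ∀ i α → e (i ∷ []) α ≡ ee i 0 α
e-one i α = ≡.trans (*ₛ-cong {elementary i} (λ _ → ≡.refl) 1ₛ≡elementary-0 α) (elementary-*ₛ i 0 α)

ee-0 : ∀ i α → ee i 0 α ≡ elementary i α
ee-0 i []                        = ≡.sym (elementary-[] i)
ee-0 i (zero              ∷ α) = ee-0 i α
ee-0 i (suc zero          ∷ α) = ≡.trans (ℤ.+-identityʳ _)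
  (≡.trans (down-cong i λ i′ → ee-0 i′ α) (≡.sym (elementary-1 i α)))
ee-0 zero    (suc (suc zero)    ∷ α) = ≡.refl
ee-0 (suc i) (suc (suc zero)    ∷ α) = ≡.refl
ee-0 i (suc (suc (suc c)) ∷ α) = ≡.refl

e-two : ∀ i j α → e (i ∷ j ∷ []) α ≡ ee i j α
e-two i j α = ≡.trans (*ₛ-cong {elementary i} (λ _ → ≡.refl) (λ γ → ≡.trans (e-one j γ) (ee-0 j γ)) α) (elementary-*ₛ i j α)

antidiagonal≋sumₚ : ∀ n g → antidiagonal n g ≋ sumₚ (applyUpTo (λ ℓ → g (n ∸ ℓ) ℓ) (suc n))
antidiagonal≋sumₚ zero    g = sym (+-identityʳ _)
antidiagonal≋sumₚ (suc n) g = +-congˡ {g (suc n) 0} (antidiagonal≋sumₚ n λ i j → g i (suc j))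

sumₚ-cong : ∀ n {f g} → (∀ ℓ → f ℓ ≋ g ℓ) → sumₚ (applyUpTo f n) ≋ sumₚ (applyUpTo g n)
sumₚ-cong zero    f≋g = refl
sumₚ-cong (suc n) f≋g = +-cong (f≋g 0) (sumₚ-cong n λ ℓ → f≋g (suc ℓ))

sumₚ-truncate : ∀ {k n} → k ≤ n → ∀ f → (∀ ℓ → k ≤ ℓ → f ℓ ≋ 0ₚ) →
  sumₚ (applyUpTo f n) ≋ sumₚ (applyUpTo f k)
sumₚ-truncate {n = zero}  z≤n f f≋0 = refl
sumₚ-truncate {n = suc n} z≤n f f≋0 = +-cong (f≋0 0 z≤n) (sumₚ-truncate {n = n} z≤n (f ∘ suc) λ ℓ _ → f≋0 (suc ℓ) z≤n)
sumₚ-truncate (s≤s k≤n)       f f≋0 = +-congˡ {f 0} (sumₚ-truncate k≤n (f ∘ suc) λ ℓ k≤ℓ → f≋0 (suc ℓ) (s≤s k≤ℓ))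

eSum≋twoPartSum : ∀ n k K α → k ≤ n → (∀ ℓ → k < ℓ → K ℓ ≋ 0ₚ) → eSum n K α ≋ twoPartSum n k K α
eSum≋twoPartSum n k K α k≤n K≋0 = begin
  antidiagonal n (λ i j → const (ee i j α) *ₚ K j)
    ≈⟨ antidiagonal≋sumₚ n _ ⟩
  sumₚ (applyUpTo (λ ℓ → const (ee (n ∸ ℓ) ℓ α) *ₚ K ℓ) (suc n))
    ≈⟨ sumₚ-truncate (s≤s k≤n) _ (λ ℓ k<ℓ → trans (*-congˡ {const (ee (n ∸ ℓ) ℓ α)} (K≋0 ℓ k<ℓ)) (zeroʳ (const (ee (n ∸ ℓ) ℓ α)))) ⟩
  sumₚ (applyUpTo (λ ℓ → const (ee (n ∸ ℓ) ℓ α) *ₚ K ℓ) (suc k))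
    ≈⟨ sumₚ-cong (suc k) (λ ℓ → trans (reflexive (cong (λ c → const c *ₚ K ℓ) (≡.sym (e-two (n ∸ ℓ) ℓ α))))
         (sym (·ₚ-const (e (n ∸ ℓ ∷ ℓ ∷ []) α) (K ℓ)))) ⟩
  sumₚ (applyUpTo (λ ℓ → e (n ∸ ℓ ∷ ℓ ∷ []) α ·ₚ K ℓ) (suc k))
    ≡⟨ cong sumₚ (List.map-applyUpTo id (λ ℓ → e (n ∸ ℓ ∷ ℓ ∷ []) α ·ₚ K ℓ) (suc k)) ⟨
  twoPartSum n k K α ∎

-- Colorings as vectors

open ListFold (CommutativeMonoid.monoid +-commutativeMonoid) using () renaming
  (fold-cong to sumL-cong; fold-cartesianProductWith to sumL-cartesianProductWith; fold-filter to sumL-filter)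
open ListFold (CommutativeMonoid.monoid *-commutativeMonoid) using () renaming
  (fold to productL; fold-cartesianProductWith to productL-cartesianProductWith; fold-filter to productL-filter)

sumL-tabulate : ∀ {k} {A : Set} (f : A → Poly) (g : Fin k → A) → sumₚ (map f (List.tabulate g)) ≋ sum (f ∘ g)
sumL-tabulate {zero}  f g = refl
sumL-tabulate {suc k} f g = +-congˡ {f (g zero)} (sumL-tabulate f (g ∘ suc))

productL-tabulate : ∀ {k} {A : Set} (f : A → Poly) (g : Fin k → A) → productL (map f (List.tabulate g)) ≋ product (f ∘ g)
productL-tabulate {zero}  f g = refl
productL-tabulate {suc k} f g = *-congˡ {f (g zero)} (productL-tabulate f (g ∘ suc))

product-zero : ∀ {k} (f : Fin k → Poly) i → f i ≋ 0ₚ → product f ≋ 0ₚ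
product-zero f zero    fi≋0 = *-congʳ {product (f ∘ suc)} fi≋0
product-zero f (suc i) fi≋0 = trans (*-congˡ {f zero} (product-zero (f ∘ suc) i fi≋0)) (zeroʳ (f zero))

product-cong′ : ∀ {k} {f g : Fin k → Poly} → (∀ i → f i ≋ g i) → product f ≋ product g
product-cong′ = product-cong

coloringSum : ∀ n k → (Vec (Fin k) n → Poly) → Poly
coloringSum zero    k f = f []
coloringSum (suc n) k f = sum λ c → coloringSum n k λ κ → f (c ∷ κ)

sumₚ-colorings : ∀ n k f → sumₚ (map f (colorings n k)) ≋ coloringSum n k f
sumₚ-colorings zero    k f = +-identityʳ _
sumₚ-colorings (suc n) k f = begin
  sumₚ (map f (cartesianProductWith _∷_ (allFin k) (colorings n k)))
    ≈⟨ sumL-cartesianProductWith f _∷_ (allFin k) (colorings n k) ⟩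
  sumₚ (map (λ c → sumₚ (map (λ κ → f (c ∷ κ)) (colorings n k))) (allFin k))
    ≈⟨ sumL-cong (λ c → sumₚ-colorings n k λ κ → f (c ∷ κ)) (allFin k) ⟩
  sumₚ (map (λ c → coloringSum n k λ κ → f (c ∷ κ)) (allFin k))
    ≈⟨ sumL-tabulate (λ c → coloringSum n k λ κ → f (c ∷ κ)) id ⟩
  coloringSum (suc n) k f ∎

coloringSum-cong : ∀ n k {f g} → (∀ κ → f κ ≋ g κ) → coloringSum n k f ≋ coloringSum n k g
coloringSum-cong zero    k f≋g = f≋g []
coloringSum-cong (suc n) k f≋g = sum-cong λ c → coloringSum-cong n k λ κ → f≋g (c ∷ κ)

coloringSum-* : ∀ n k p f → coloringSum n k (λ κ → p *ₚ f κ) ≋ p *ₚ coloringSum n k f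
coloringSum-* zero    k p f = refl
coloringSum-* (suc n) k p f = trans (sum-cong λ c → coloringSum-* n k p λ κ → f (c ∷ κ)) (sym (*-distribˡ-sum {k} p _))

coloringSum-use : ∀ n k {l} (β : Vec ℕ l) d (h : Vec ℕ l → Vec (Fin k) n → Poly) →
  coloringSum n k (λ κ → use β d λ β′ → h β′ κ) ≋ use β d λ β′ → coloringSum n k (h β′)
coloringSum-use n k (zero  ∷ β) zero    h = coloringSum-* n k 0ₚ λ _ → 0ₚ
coloringSum-use n k (suc b ∷ β) zero    h = refl
coloringSum-use n k (b     ∷ β) (suc d) h = coloringSum-use n k β d λ β′ → h (b ∷ β′)

content : ∀ {k n} → Vec ℕ k → Vec (Fin k) n → Poly
content β []      = isZero β
content β (c ∷ κ) = use β c λ β′ → content β′ κ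

-- ∏_{i<j} F i j
pairs : ∀ {n} → (Fin n → Fin n → Poly) → Poly
pairs {zero}  F = 1ₚ
pairs {suc n} F = product (λ j → F zero (suc j)) *ₚ pairs λ i j → F (suc i) (suc j)

coloringWeight : ∀ {n k} → (Fin n → Block) → Vec (Fin k) n → Poly
coloringWeight τ κ = pairs λ i j → pairWeight (τ i) (τ j) (lookup κ i) (lookup κ j)

-- Once the leading vertex has color c, its row of pair weights has one factor for each remaining
-- vertex and can be absorbed into w.
coloringSum≋colorSum : ∀ n {k} (τ : Fin n → Block) (w : Block → Fin k → Poly) β →
  coloringSum n k (λ κ → content β κ *ₚ (product (λ i → w (τ i) (lookup κ i)) *ₚ coloringWeight τ κ))
    ≋ colorSum w (List.tabulate τ) β
coloringSum≋colorSum zero        τ w β = trans (*-congˡ {isZero β} (*-identityˡ 1ₚ)) (*-identityʳ _)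
coloringSum≋colorSum (suc n) {k} τ w β = sum-cong λ c → begin
  coloringSum n k (λ κ → use β c (λ β′ → content β′ κ) *ₚ
      ((w x c *ₚ product (λ i → w (σ i) (lookup κ i))) *ₚ (row c κ *ₚ coloringWeight σ κ)))
    ≈⟨ coloringSum-cong n k (λ κ → trans (*-comm (use β c λ β′ → content β′ κ) _)
         (*-use ((w x c *ₚ product (λ i → w (σ i) (lookup κ i))) *ₚ (row c κ *ₚ coloringWeight σ κ)) β c _)) ⟩
  coloringSum n k (λ κ → use β c λ β′ →
      ((w x c *ₚ product (λ i → w (σ i) (lookup κ i))) *ₚ (row c κ *ₚ coloringWeight σ κ)) *ₚ content β′ κ)
    ≈⟨ coloringSum-cong n k (λ κ → use-cong β c λ β′ → solve 5 (λ x p r q z → (x :* p :* (r :* q)) :* z := x :* (z :* ((p :* r) :* q))) refl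
         (w x c) (product (λ i → w (σ i) (lookup κ i))) (row c κ) (coloringWeight σ κ) (content β′ κ)) ⟩
  coloringSum n k (λ κ → use β c λ β′ →
      w x c *ₚ (content β′ κ *ₚ ((product (λ i → w (σ i) (lookup κ i)) *ₚ row c κ) *ₚ coloringWeight σ κ)))
    ≈⟨ coloringSum-use n k β c _ ⟩
  use β c (λ β′ → coloringSum n k λ κ →
      w x c *ₚ (content β′ κ *ₚ ((product (λ i → w (σ i) (lookup κ i)) *ₚ row c κ) *ₚ coloringWeight σ κ)))
    ≈⟨ use-cong β c (λ β′ → trans (coloringSum-* n k (w x c) _) (*-congˡ {w x c} (trans
         (coloringSum-cong n k λ κ → *-congˡ {content β′ κ} (*-congʳ {coloringWeight σ κ} (sym (product-distrib-* {n} _ _))))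
         (coloringSum≋colorSum n σ (λ y d → w y d *ₚ pairWeight x y c d) β′)))) ⟩
  use β c (λ β′ → w x c *ₚ colorSum (λ y d → w y d *ₚ pairWeight x y c d) (List.tabulate σ) β′) ∎
  where
  x = τ zero
  σ = τ ∘ suc
  row : Fin k → Vec (Fin k) n → Poly
  row c κ = product λ j → pairWeight x (σ j) c (lookup κ j)

use-zero : ∀ {k} (β : Vec ℕ k) c f → lookup β c ≡ 0 → use β c f ≡ 0ₚ
use-zero (zero ∷ β) zero    f eq = ≡.refl
use-zero (b    ∷ β) (suc c) f eq = use-zero β c _ eq

use-suc : ∀ {k} (β : Vec ℕ k) c f {b} → lookup β c ≡ suc b → use β c f ≡ f (β [ c ]≔ b)
use-suc (suc b ∷ β) zero    f ≡.refl = ≡.refl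
use-suc (b     ∷ β) (suc c) f eq     = use-suc β c _ eq

isZero-yes : ∀ {k} (β : Vec ℕ k) → (∀ c → 0 ≡ lookup β c) → isZero β ≋ 1ₚ
isZero-yes []          eq = refl
isZero-yes (zero  ∷ β) eq = isZero-yes β (eq ∘ suc)
isZero-yes (suc b ∷ β) eq = contradiction (eq zero) λ ()

isZero-no : ∀ {k} (β : Vec ℕ k) → ¬ (∀ c → 0 ≡ lookup β c) → isZero β ≋ 0ₚ
isZero-no []          neq = contradiction (λ ()) neq
isZero-no (zero  ∷ β) neq = isZero-no β λ eq → neq λ { zero → ≡.refl ; (suc c) → eq c }
isZero-no (suc b ∷ β) neq = refl

-- `HasContent` ties the colors to the length of α; with a vector the number of colors stays fixed
-- by its type while the induction lowers an entry.
Content : ∀ {k n} → Vec ℕ k → Vec (Fin k) n → Set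
Content β κ = ∀ c → count (c Fin.≟_) κ ≡ lookup β c

Content-tail : ∀ {k n} (β : Vec ℕ k) c (κ : Vec (Fin k) n) {b} → lookup β c ≡ suc b →
  Content β (c ∷ κ) → Content (β [ c ]≔ b) κ
Content-tail β c κ {b} eq h d with d Fin.≟ c | h d
... | yes ≡.refl | hd = ≡.trans (ℕ.suc-injective (≡.trans hd eq)) (≡.sym (Vec.lookup∘update d β b))
... | no  d≢c    | hd = ≡.trans hd (≡.sym (Vec.lookup∘update′ d≢c β b))

Content-cons : ∀ {k n} (β : Vec ℕ k) c (κ : Vec (Fin k) n) {b} → lookup β c ≡ suc b →
  Content (β [ c ]≔ b) κ → Content β (c ∷ κ)
Content-cons β c κ {b} eq h d with d Fin.≟ c | h d
... | yes ≡.refl | hd = ≡.trans (cong suc (≡.trans hd (Vec.lookup∘update d β b))) (≡.sym eq)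
... | no  d≢c    | hd = ≡.trans hd (Vec.lookup∘update′ d≢c β b)

Content-head : ∀ {k n} (β : Vec ℕ k) c (κ : Vec (Fin k) n) → lookup β c ≡ 0 → ¬ Content β (c ∷ κ)
Content-head β c κ eq h with c Fin.≟ c | h c
... | yes _   | hc = contradiction (≡.trans hc eq) λ ()
... | no  c≢c | _  = c≢c ≡.refl

content-yes : ∀ {k n} (β : Vec ℕ k) (κ : Vec (Fin k) n) → Content β κ → content β κ ≋ 1ₚ
content-yes β []      h = isZero-yes β h
content-yes β (c ∷ κ) h with lookup β c in eq
... | zero  = contradiction h (Content-head β c κ eq)
... | suc b = trans (reflexive (use-suc β c _ eq)) (content-yes (β [ c ]≔ b) κ (Content-tail β c κ eq h))

content-no : ∀ {k n} (β : Vec ℕ k) (κ : Vec (Fin k) n) → ¬ Content β κ → content β κ ≋ 0ₚ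
content-no β []      h = isZero-no β h
content-no β (c ∷ κ) h with lookup β c in eq
... | zero  = reflexive (use-zero β c _ eq)
... | suc b = trans (reflexive (use-suc β c _ eq)) (content-no (β [ c ]≔ b) κ (h ∘ Content-cons β c κ eq))

edge-≢ : ∀ {k} (c d : Fin k) → c ≢ d → edge c d ≡ (if does (c Fin.<? d) then t else 1ₚ)
edge-≢ zero    zero    c≢d = contradiction ≡.refl c≢d
edge-≢ zero    (suc d) c≢d = ≡.refl
edge-≢ (suc c) zero    c≢d = ≡.refl
edge-≢ (suc c) (suc d) c≢d = edge-≢ c d (c≢d ∘ cong suc)

edge-refl : ∀ {k} (c : Fin k) → edge c c ≡ 0ₚ
edge-refl zero    = ≡.refl
edge-refl (suc c) = edge-refl c

-- Passes to the product over all ordered pairs, the range over which `asc` counts.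
pairs≋product : ∀ {n} (F : Fin n → Fin n → Poly) →
  pairs F ≋ product λ i → product λ j → if does (i Fin.<? j) then F i j else 1ₚ
pairs≋product {zero}  F = refl
pairs≋product {suc n} F = *-cong (sym (*-identityˡ (product λ j → F zero (suc j))))
  (trans (pairs≋product λ i j → F (suc i) (suc j)) (product-cong′ λ i → sym (*-identityˡ (product λ j → if does (i Fin.<? j) then F (suc i) (suc j) else 1ₚ))))

t^-length : ∀ {A : Set} (xs : List A) → t^ length xs ≋ productL (map (λ _ → t) xs)
t^-length []       = refl
t^-length (x ∷ xs) = trans (t^-suc (length xs)) (*-congˡ {t} (t^-length xs))

module _ {n : ℕ} (G : Graph n) (τ : Fin n → Block)
  (adj⇒     : ∀ i j → i Fin.< j → Graph.Adj G i j → adjacent (τ i) (τ j) ≡ true)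
  (nonadj⇒  : ∀ i j → i Fin.< j → ¬ Graph.Adj G i j → adjacent (τ i) (τ j) ≡ false) where

  open Graph G

  private
    weight : ∀ {k} → Vec (Fin k) n → Fin n → Fin n → Poly
    weight κ i j = pairWeight (τ i) (τ j) (lookup κ i) (lookup κ j)

    ascent? : ∀ {k} (κ : Vec (Fin k) n) → ((i , j) : Fin n × Fin n) → Dec (i Fin.< j × Adj i j × lookup κ i Fin.< lookup κ j)
    ascent? κ (i , j) = i Fin.<? j ×-dec adj? i j ×-dec lookup κ i Fin.<? lookup κ j

    factor : ∀ {k} (κ : Vec (Fin k) n) → Proper G κ → ∀ i j (i<?j : Dec (i Fin.< j)) (ij? : Dec (Adj i j)) →
      (if does i<?j then weight κ i j else 1ₚ) ≋
      (if does (i<?j ×-dec ij? ×-dec lookup κ i Fin.<? lookup κ j) then t else 1ₚ)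
    factor κ proper i j (no _)    _          = refl
    factor κ proper i j (yes i<j) (yes adj) = reflexive (≡.trans
      (cong (λ b → if b then edge (lookup κ i) (lookup κ j) else 1ₚ) (adj⇒ i j i<j adj))
      (edge-≢ (lookup κ i) (lookup κ j) (proper i j adj)))
    factor κ proper i j (yes i<j) (no ¬adj) = reflexive
      (cong (λ b → if b then edge (lookup κ i) (lookup κ j) else 1ₚ) (nonadj⇒ i j i<j ¬adj))

  weight-proper : ∀ {k} (κ : Vec (Fin k) n) → Proper G κ → coloringWeight τ κ ≋ t^ asc G κ
  weight-proper κ proper = begin
    coloringWeight τ κ
      ≈⟨ pairs≋product (weight κ) ⟩
    product (λ i → product λ j → if does (i Fin.<? j) then weight κ i j else 1ₚ)
      ≈⟨ product-cong′ (λ i → product-cong′ λ j → factor κ proper i j (i Fin.<? j) (adj? i j)) ⟩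
    product (λ i → product λ j → if does (ascent? κ (i , j)) then t else 1ₚ)
      ≈⟨ product-cong′ (λ i → productL-tabulate (λ j → if does (ascent? κ (i , j)) then t else 1ₚ) id) ⟨
    product (λ i → productL (map (λ j → if does (ascent? κ (i , j)) then t else 1ₚ) (allFin n)))
      ≈⟨ productL-tabulate (λ i → productL (map (λ j → if does (ascent? κ (i , j)) then t else 1ₚ) (allFin n))) id ⟨
    productL (map (λ i → productL (map (λ j → if does (ascent? κ (i , j)) then t else 1ₚ) (allFin n))) (allFin n))
      ≈⟨ productL-cartesianProductWith (λ p → if does (ascent? κ p) then t else 1ₚ) _,_ (allFin n) (allFin n) ⟨
    productL (map (λ p → if does (ascent? κ p) then t else 1ₚ) (cartesianProduct (allFin n) (allFin n)))
      ≈⟨ productL-filter (ascent? κ) (λ _ → t) (cartesianProduct (allFin n) (allFin n)) ⟨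
    productL (map (λ _ → t) (filter (ascent? κ) (cartesianProduct (allFin n) (allFin n))))
      ≈⟨ t^-length (filter (ascent? κ) (cartesianProduct (allFin n) (allFin n))) ⟨
    t^ asc G κ ∎

  weight-improper : ∀ {k} (κ : Vec (Fin k) n) → ¬ Proper G κ → coloringWeight τ κ ≋ 0ₚ
  weight-improper κ improper
    with Fin.¬∀⟶∃¬ n _ (λ i → Fin.all? λ j → adj? i j →-dec ¬? (lookup κ i Fin.≟ lookup κ j)) improper
  ... | i , ¬row with Fin.¬∀⟶∃¬ n _ (λ j → adj? i j →-dec ¬? (lookup κ i Fin.≟ lookup κ j)) ¬row
  ... | j , bad with adj? i j | lookup κ i Fin.≟ lookup κ j
  ... | no ¬adj | _      = contradiction (λ adj → contradiction adj ¬adj) bad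
  ... | yes _   | no neq = contradiction (λ _ → neq) bad
  ... | yes adj | yes eq = trans (pairs≋product (weight κ)) vanishing
    where
    vanishes : ∀ i j → i Fin.< j → Adj i j → lookup κ i ≡ lookup κ j →
      product (λ i → product λ j → if does (i Fin.<? j) then weight κ i j else 1ₚ) ≋ 0ₚ
    vanishes i j i<j adj eq = product-zero _ i (product-zero (λ j → if does (i Fin.<? j) then weight κ i j else 1ₚ) j (reflexive
      (≡.trans (cong (λ b → if b then weight κ i j else 1ₚ) (dec-true (i Fin.<? j) i<j))
        (≡.trans (cong (λ b → if b then edge (lookup κ i) (lookup κ j) else 1ₚ) (adj⇒ i j i<j adj))
          (≡.trans (cong (edge (lookup κ i)) (≡.sym eq)) (edge-refl (lookup κ i)))))))
    vanishing : product (λ i → product λ j → if does (i Fin.<? j) then weight κ i j else 1ₚ) ≋ 0ₚ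
    -- Only increasing pairs contribute a factor, so the monochromatic edge is put in increasing
    -- order.
    vanishing with Fin.<-cmp i j
    ... | tri< i<j _ _ = vanishes i j i<j adj eq
    ... | tri≈ _ i≡j _ = contradiction adj (adj-irrefl i≡j)
    ... | tri> _ _ j<i = vanishes j i j<i (adj-sym adj) (≡.sym eq)

  chromaticQSym≋colorSum : ∀ α → chromaticQSym G α ≋ colorSum (λ _ _ → 1ₚ) (List.tabulate τ) (fromList α)
  chromaticQSym≋colorSum α = begin
    chromaticQSym G α
      ≈⟨ sumL-filter (λ κ → proper? G κ ×-dec hasContent? α κ) (λ κ → t^ asc G κ) (colorings n (length α)) ⟩
    sumₚ (map term (colorings n (length α)))
      ≈⟨ sumₚ-colorings n (length α) term ⟩
    coloringSum n (length α) term
      ≈⟨ coloringSum-cong n (length α) (λ κ → term≋ κ (proper? G κ) (hasContent? α κ)) ⟩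
    coloringSum n (length α) (λ κ → content (fromList α) κ *ₚ (product {n} (λ _ → 1ₚ) *ₚ coloringWeight τ κ))
      ≈⟨ coloringSum≋colorSum n τ (λ _ _ → 1ₚ) (fromList α) ⟩
    colorSum (λ _ _ → 1ₚ) (List.tabulate τ) (fromList α) ∎
    where
    term : Vec (Fin (length α)) n → Poly
    term κ = if does (proper? G κ ×-dec hasContent? α κ) then t^ asc G κ else 0ₚ

    ones : ∀ n → product {n} (λ _ → 1ₚ) ≋ 1ₚ
    ones zero    = refl
    ones (suc n) = trans (*-identityˡ (product {n} (λ _ → 1ₚ))) (ones n)

    weights : ∀ κ → product {n} (λ _ → 1ₚ) *ₚ coloringWeight τ κ ≋ coloringWeight τ κ
    weights κ = trans (*-congʳ {coloringWeight τ κ} (ones n)) (*-identityˡ (coloringWeight τ κ))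

    lookup-fromList : ∀ α c → lookup (fromList α) c ≡ List.lookup α c
    lookup-fromList (x ∷ α) zero    = ≡.refl
    lookup-fromList (x ∷ α) (suc c) = lookup-fromList α c

    term≋ : ∀ κ (p? : Dec (Proper G κ)) (c? : Dec (HasContent α κ)) →
      (if does (p? ×-dec c?) then t^ asc G κ else 0ₚ) ≋
      content (fromList α) κ *ₚ (product {n} (λ _ → 1ₚ) *ₚ coloringWeight τ κ)
    term≋ κ (no improper) _ = sym (trans
      (*-congˡ {content (fromList α) κ} (trans (weights κ) (weight-improper κ improper)))
      (zeroʳ (content (fromList α) κ)))
    term≋ κ (yes _) (no other) = sym (*-congʳ {product {n} (λ _ → 1ₚ) *ₚ coloringWeight τ κ}
      (content-no (fromList α) κ λ h → other λ c → ≡.trans (h c) (lookup-fromList α c)))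
    term≋ κ (yes proper) (yes h) = sym (trans
      (*-cong (content-yes (fromList α) κ λ c → ≡.trans (h c) (≡.sym (lookup-fromList α c)))
        (trans (weights κ) (weight-proper κ proper)))
      (*-identityˡ (t^ asc G κ)))

-- The incomparability graph in terms of blocks

kind : ℕ → ℕ → ℕ → Block
kind zero    zero    i       = high
kind zero    (suc m) zero    = mid
kind zero    (suc m) (suc i) = kind zero m i
kind (suc a) m       zero    = low
kind (suc a) m       (suc i) = kind a m i

tabulate-kind : ∀ a m b → List.tabulate {n = a + (m + b)} (kind a m ∘ toℕ) ≡ blocks a m b
tabulate-kind zero    zero    zero    = ≡.refl
tabulate-kind zero    zero    (suc b) = cong (high ∷_) (tabulate-kind zero zero b)
tabulate-kind zero    (suc m) b       = cong (mid ∷_) (tabulate-kind zero m b)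
tabulate-kind (suc a) m       b       = cong (low ∷_) (tabulate-kind a m b)

kind-low : ∀ a m i → i < a → kind a m i ≡ low
kind-low (suc a) m zero    _         = ≡.refl
kind-low (suc a) m (suc i) (s≤s i<a) = kind-low a m i i<a

kind-mid : ∀ a m i → a ≤ i → i < a + m → kind a m i ≡ mid
kind-mid zero    (suc m) zero    _         _         = ≡.refl
kind-mid zero    (suc m) (suc i) _         (s≤s i<m) = kind-mid zero m i z≤n i<m
kind-mid (suc a) m       (suc i) (s≤s a≤i) (s≤s i<)  = kind-mid a m i a≤i i<

kind-high : ∀ a m i → a + m ≤ i → kind a m i ≡ high
kind-high zero    zero    i       _        = ≡.refl
kind-high zero    (suc m) (suc i) (s≤s m≤) = kind-high zero m i m≤
kind-high (suc a) m       (suc i) (s≤s m≤) = kind-high a m i m≤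

module _ (a m b : ℕ) (P : NaturalUnitIntervalOrder (a + (m + b))) where

  private
    n = a + (m + b)
    module P = NaturalUnitIntervalOrder P

  module _ (m-low : ∀ i → 1 ≤ i → i ≤ a → P.m i ≡ a + m)
           (m-rest : ∀ i → a < i → i ≤ n ∸ 1 → P.m i ≡ n) where

    private
      -- For i < j the relation j ≺ i is impossible because m_j ≥ j, so incomparability is one
      -- condition.
      i⊀j⇒Adj : ∀ {i j} → i Fin.< j → ¬ (i P.<ₚ j) → Graph.Adj (inc P) i j
      i⊀j⇒Adj {i} {j} i<j i⊀j = (λ { ≡.refl → ℕ.<-irrefl ≡.refl i<j }) , i⊀j ,
        λ (j<n , mj<i) → ℕ.<-irrefl ≡.refl
          (ℕ.<-≤-trans (ℕ.<-≤-trans mj<i (s≤s (ℕ.<⇒≤ i<j))) (P.m-lower (label j) (s≤s z≤n) j<n))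

      module _ (i j : Fin n) (i<j : i Fin.< j) where

        i<n : label i < n
        i<n = ℕ.≤-<-trans i<j (Fin.toℕ<n j)

        high-nonadjacent : toℕ i < a → a + m ≤ toℕ j → i P.<ₚ j
        high-nonadjacent i<a r≤j = i<n , ℕ.≤-trans (s≤s (ℕ.≤-reflexive (m-low (label i) (s≤s z≤n) i<a))) (s≤s r≤j)

        mid-adjacent : toℕ i < a → toℕ j < a + m → ¬ (i P.<ₚ j)
        mid-adjacent i<a j<r (_ , mi<j) = ℕ.<-irrefl ≡.refl
          (ℕ.<-≤-trans (≡.subst (_< label j) (m-low (label i) (s≤s z≤n) i<a) mi<j) j<r)

        rest-adjacent : a ≤ toℕ i → ¬ (i P.<ₚ j)
        rest-adjacent a≤i (_ , mi<j) = ℕ.<-irrefl ≡.refl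
          (ℕ.<-≤-trans (≡.subst (_< label j) (m-rest (label i) (s≤s a≤i) (ℕ.<⇒≤pred i<n)) mi<j) (Fin.toℕ<n j))

        kinds : ∀ {x y} → kind a m (toℕ i) ≡ x → kind a m (toℕ j) ≡ y →
          adjacent (kind a m (toℕ i)) (kind a m (toℕ j)) ≡ adjacent x y
        kinds = cong₂ adjacent

        adjacency : Dec (toℕ i < a) → Dec (toℕ i < a + m) → Dec (toℕ j < a) → Dec (toℕ j < a + m) →
          (i P.<ₚ j × adjacent (kind a m (toℕ i)) (kind a m (toℕ j)) ≡ false) ⊎
          (¬ (i P.<ₚ j) × adjacent (kind a m (toℕ i)) (kind a m (toℕ j)) ≡ true)
        adjacency (yes i<a) _ (yes j<a) _ = inj₂ (mid-adjacent i<a (ℕ.<-≤-trans j<a (ℕ.m≤m+n a m)) ,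
          kinds (kind-low a m _ i<a) (kind-low a m _ j<a))
        adjacency (yes i<a) _ (no j≮a) (yes j<r) = inj₂ (mid-adjacent i<a j<r ,
          kinds (kind-low a m _ i<a) (kind-mid a m _ (ℕ.≮⇒≥ j≮a) j<r))
        adjacency (yes i<a) _ (no _) (no j≮r) = inj₁ (high-nonadjacent i<a (ℕ.≮⇒≥ j≮r) ,
          kinds (kind-low a m _ i<a) (kind-high a m _ (ℕ.≮⇒≥ j≮r)))
        adjacency (no i≮a) _ (yes j<a) _ = contradiction (ℕ.<-trans i<j j<a) i≮a
        adjacency (no i≮a) (yes i<r) (no j≮a) (yes j<r) = inj₂ (rest-adjacent (ℕ.≮⇒≥ i≮a) ,
          kinds (kind-mid a m _ (ℕ.≮⇒≥ i≮a) i<r) (kind-mid a m _ (ℕ.≮⇒≥ j≮a) j<r))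
        adjacency (no i≮a) (yes i<r) (no _) (no j≮r) = inj₂ (rest-adjacent (ℕ.≮⇒≥ i≮a) ,
          kinds (kind-mid a m _ (ℕ.≮⇒≥ i≮a) i<r) (kind-high a m _ (ℕ.≮⇒≥ j≮r)))
        adjacency (no _) (no i≮r) (no _) (yes j<r) = contradiction (ℕ.<-trans i<j j<r) i≮r
        adjacency (no i≮a) (no i≮r) (no _) (no j≮r) = inj₂ (rest-adjacent (ℕ.≮⇒≥ i≮a) ,
          kinds (kind-high a m _ (ℕ.≮⇒≥ i≮r)) (kind-high a m _ (ℕ.≮⇒≥ j≮r)))

        adjacent-kind : _
        adjacent-kind = adjacency (toℕ i <? a) (toℕ i <? a + m) (toℕ j <? a) (toℕ j <? a + m)

      adj⇒ : ∀ i j → i Fin.< j → Graph.Adj (inc P) i j → adjacent (kind a m (toℕ i)) (kind a m (toℕ j)) ≡ true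
      adj⇒ i j i<j (_ , i⊀j , _) with adjacent-kind i j i<j
      ... | inj₁ (i≺j , _) = contradiction i≺j i⊀j
      ... | inj₂ (_ , eq)  = eq

      nonadj⇒ : ∀ i j → i Fin.< j → ¬ Graph.Adj (inc P) i j → adjacent (kind a m (toℕ i)) (kind a m (toℕ j)) ≡ false
      nonadj⇒ i j i<j ¬adj with adjacent-kind i j i<j
      ... | inj₁ (_ , eq)  = eq
      ... | inj₂ (i⊀j , _) = contradiction (i⊀j⇒Adj i<j i⊀j) ¬adj

    chromaticQSym≋blockSum : ∀ α → chromaticQSym (inc P) α ≋ blockSum a m b α
    chromaticQSym≋blockSum α = trans (chromaticQSym≋colorSum (inc P) (kind a m ∘ toℕ) adj⇒ nonadj⇒ α)
      (reflexive (cong (λ τ → colorSum (λ _ _ → 1ₚ) τ (fromList α)) (tabulate-kind a m b)))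

    chromaticQSym≋twoPartSum : ∀ α → chromaticQSym (inc P) α ≋ twoPartSum n (b ⊓ a) (λ ℓ → eCoeff ℓ a m b) α
    chromaticQSym≋twoPartSum α = trans (chromaticQSym≋blockSum α) (trans (blockSum≋eSum α a m b)
      (eSum≋twoPartSum n (b ⊓ a) _ α (ℕ.≤-trans (ℕ.m⊓n≤n b a) (ℕ.m≤m+n a (m + b)))
        λ ℓ → eCoeff-vanishes ℓ a m b))

-- The coefficients as quotients of quantum factorials

eCoeff-tail : ∀ ℓ x y m →
  eCoeff ℓ (ℓ + x) m (ℓ + y) *ₚ ([ y ]ₜ! *ₚ [ x ]ₜ!) ≋ (t^ (m * ℓ) *ₚ [ ℓ + y ]ₜ! *ₚ [ ℓ + x ]ₜ!) *ₚ tail x y m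
eCoeff-tail zero x y m = begin
  tail x y m *ₚ ([ y ]ₜ! *ₚ [ x ]ₜ!)
    ≈⟨ solve 3 (λ c f g → c :* (f :* g) := (con 1 :* f :* g) :* c) refl (tail x y m) [ y ]ₜ! [ x ]ₜ! ⟩
  (t^ 0 *ₚ [ y ]ₜ! *ₚ [ x ]ₜ!) *ₚ tail x y m
    ≡⟨ cong (λ i → (t^ i *ₚ [ y ]ₜ! *ₚ [ x ]ₜ!) *ₚ tail x y m) (≡.sym (ℕ.*-zeroʳ m)) ⟩
  (t^ (m * 0) *ₚ [ y ]ₜ! *ₚ [ x ]ₜ!) *ₚ tail x y m ∎
eCoeff-tail (suc ℓ) x y m = begin
  t^ m *ₚ (A *ₚ (B *ₚ E)) *ₚ F
    ≈⟨ solve 5 (λ p a b c f → p :* (a :* (b :* c)) :* f := p :* a :* b :* (c :* f)) refl (t^ m) A B E F ⟩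
  t^ m *ₚ A *ₚ B *ₚ (E *ₚ F)
    ≈⟨ *-congˡ {t^ m *ₚ A *ₚ B} (eCoeff-tail ℓ x y m) ⟩
  t^ m *ₚ A *ₚ B *ₚ ((t^ (m * ℓ) *ₚ [ ℓ + y ]ₜ! *ₚ [ ℓ + x ]ₜ!) *ₚ tail x y m)
    ≈⟨ solve 7 (λ p q a b f g c → p :* a :* b :* ((q :* f :* g) :* c) := (p :* q :* (f :* b) :* (g :* a)) :* c) refl
         (t^ m) (t^ (m * ℓ)) A B [ ℓ + y ]ₜ! [ ℓ + x ]ₜ! (tail x y m) ⟩
  (t^ m *ₚ t^ (m * ℓ) *ₚ [ suc ℓ + y ]ₜ! *ₚ [ suc ℓ + x ]ₜ!) *ₚ tail x y m
    ≈⟨ *-congʳ {tail x y m} (*-congʳ {[ suc ℓ + x ]ₜ!} (*-congʳ {[ suc ℓ + y ]ₜ!} (t^-+ m (m * ℓ)))) ⟨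
  (t^ (m + m * ℓ) *ₚ [ suc ℓ + y ]ₜ! *ₚ [ suc ℓ + x ]ₜ!) *ₚ tail x y m
    ≡⟨ cong (λ i → (t^ i *ₚ [ suc ℓ + y ]ₜ! *ₚ [ suc ℓ + x ]ₜ!) *ₚ tail x y m) (≡.sym (ℕ.*-suc m ℓ)) ⟩
  (t^ (m * suc ℓ) *ₚ [ suc ℓ + y ]ₜ! *ₚ [ suc ℓ + x ]ₜ!) *ₚ tail x y m ∎
  where
  A = [ suc (ℓ + x) ]ₜ
  B = [ suc (ℓ + y) ]ₜ
  E = eCoeff ℓ (ℓ + x) m (ℓ + y)
  F = [ y ]ₜ! *ₚ [ x ]ₜ!

module Quotient (ℓ x y : ℕ) where

  a = ℓ + x
  b = ℓ + y

  -- The arguments i, j, k are r-ℓ, n-s-ℓ and n-2ℓ. As variables they can be supplied in the form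
  -- `suc _`, on which `[_-1]ᶻ!` and `[_]ᶻ` compute.
  numerator′ : ℕ → ℕ → ℕ → ℕ → ZTerm
  numerator′ m i j k = ⟪ t^ (m * ℓ) ⟫ ⊗ ⟪ [ b ]ₜ! ⟫ ⊗ ⟪ [ a ]ₜ! ⟫ ⊗ [ i -1]ᶻ! ⊗ [ j -1]ᶻ! ⊗ [ k ]ᶻ

  denominator′ : ℕ → ZTerm
  denominator′ m = ⟪ [ y ]ₜ! ⟫ ⊗ ⟪ [ x ]ₜ! ⟫ ⊗ [ m -1]ᶻ!

  n∸r : ∀ m → a + (m + b) ∸ (a + m) ≡ b
  n∸r m = ≡.trans (cong (_∸ (a + m)) (≡.sym (ℕ.+-assoc a m b))) (ℕ.m+n∸m≡n (a + m) b)

  r∸ℓ : ∀ m → a + m ∸ ℓ ≡ x + m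
  r∸ℓ m = ≡.trans (cong (_∸ ℓ) (ℕ.+-assoc ℓ x m)) (ℕ.m+n∸m≡n ℓ (x + m))

  n∸s∸ℓ : ∀ m → a + (m + b) ∸ a ∸ ℓ ≡ y + m
  n∸s∸ℓ m = ≡.trans (cong (_∸ ℓ) (≡.trans (ℕ.m+n∸m≡n a (m + b))
    (≡.trans (ℕ.+-comm m b) (ℕ.+-assoc ℓ y m)))) (ℕ.m+n∸m≡n ℓ (y + m))

  n∸2ℓ : ∀ m → a + (m + b) ∸ 2 * ℓ ≡ x + y + m
  n∸2ℓ m = ≡.trans (cong (_∸ 2 * ℓ) (rearrange ℓ x y m)) (ℕ.m+n∸m≡n (2 * ℓ) (x + y + m))
    where
    rearrange : ∀ ℓ x y m → ℓ + x + (m + (ℓ + y)) ≡ 2 * ℓ + (x + y + m)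
    rearrange = solve-∀

  numerator-≡ : ∀ m {i j k} → x + m ≡ i → y + m ≡ j → x + y + m ≡ k →
    numerator (a + (m + b)) (a + m) a ℓ ≡ numerator′ m i j k
  numerator-≡ m i≡ j≡ k≡
    rewrite n∸r m | ℕ.m+n∸m≡n a m | r∸ℓ m | n∸s∸ℓ m | n∸2ℓ m | i≡ | j≡ | k≡ = ≡.refl

  denominator-≡ : ∀ m → denominator (a + (m + b)) (a + m) a ℓ ≡ denominator′ m
  denominator-≡ m rewrite n∸r m | ℕ.m+n∸m≡n a m | ℕ.m+n∸m≡n ℓ y | ℕ.m+n∸m≡n ℓ x = ≡.refl

  quotient-≡ : ∀ m {i j k} → x + m ≡ i → y + m ≡ j → x + y + m ≡ k →
    eCoeff ℓ a m b IsQuotientOf numerator′ m i j k by denominator′ m →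
    eCoeff ℓ a m b IsQuotientOf numerator (a + (m + b)) (a + m) a ℓ by denominator (a + (m + b)) (a + m) a ℓ
  quotient-≡ m i≡ j≡ k≡ = ≡.subst₂ (eCoeff ℓ a m b IsQuotientOf_by_)
    (≡.sym (numerator-≡ m i≡ j≡ k≡)) (≡.sym (denominator-≡ m))

  parts : ∀ m f g h d → tail x y m *ₚ d ≋ f *ₚ g *ₚ h →
    eCoeff ℓ a m b *ₚ ([ y ]ₜ! *ₚ [ x ]ₜ! *ₚ d) ≋ t^ (m * ℓ) *ₚ [ b ]ₜ! *ₚ [ a ]ₜ! *ₚ f *ₚ g *ₚ h
  parts m f g h d eq = begin
    E *ₚ (Y *ₚ X *ₚ d)                                      ≈⟨ *-assoc E (Y *ₚ X) d ⟨
    E *ₚ (Y *ₚ X) *ₚ d                                      ≈⟨ *-congʳ {d} (eCoeff-tail ℓ x y m) ⟩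
    (T *ₚ [ b ]ₜ! *ₚ [ a ]ₜ!) *ₚ tail x y m *ₚ d            ≈⟨ *-assoc (T *ₚ [ b ]ₜ! *ₚ [ a ]ₜ!) (tail x y m) d ⟩
    (T *ₚ [ b ]ₜ! *ₚ [ a ]ₜ!) *ₚ (tail x y m *ₚ d)          ≈⟨ *-congˡ {T *ₚ [ b ]ₜ! *ₚ [ a ]ₜ!} eq ⟩
    (T *ₚ [ b ]ₜ! *ₚ [ a ]ₜ!) *ₚ (f *ₚ g *ₚ h)              ≈⟨ solve 4 (λ p f g h → p :* (f :* g :* h) := p :* f :* g :* h) refl (T *ₚ [ b ]ₜ! *ₚ [ a ]ₜ!) f g h ⟩
    T *ₚ [ b ]ₜ! *ₚ [ a ]ₜ! *ₚ f *ₚ g *ₚ h                  ∎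
    where
    E = eCoeff ℓ a m b
    X = [ x ]ₜ!
    Y = [ y ]ₜ!
    T = t^ (m * ℓ)

open Quotient using (parts; quotient-≡)

-- For m > 0 no power of z occurs. For m = 0 the denominator has order -1. The numerator has the
-- same order if x or y is 0: the only z⁻¹ comes from the vanishing one, and if both vanish there
-- are two, with [0] giving back one z. If x and y are positive its order is 0, so the quotient
-- vanishes at z = 0.
eCoeff-quotient′ : ∀ ℓ x y m → eCoeff ℓ (ℓ + x) m (ℓ + y) IsQuotientOf
  numerator (ℓ + x + (m + (ℓ + y))) (ℓ + x + m) (ℓ + x) ℓ by denominator (ℓ + x + (m + (ℓ + y))) (ℓ + x + m) (ℓ + x) ℓ
eCoeff-quotient′ ℓ x y (suc k) = quotient-≡ ℓ x y (suc k) (ℕ.+-suc x k) (ℕ.+-suc y k) (ℕ.+-suc (x + y) k)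
  (inj₁ (≡.refl , coeff-≡ (parts ℓ x y (suc k) [ x + k ]ₜ! [ y + k ]ₜ! [ suc (x + y + k) ]ₜ [ k ]ₜ! (begin
    tail x y (suc k) *ₚ [ k ]ₜ!
      ≈⟨ *-congʳ {[ k ]ₜ!} (tail-suc x y k) ⟩
    [ suc (x + y + k) ]ₜ *ₚ ([ x + k ]ₜ! *ₚ rise (suc k) y) *ₚ [ k ]ₜ!
      ≈⟨ solve 4 (λ n f r g → n :* (f :* r) :* g := f :* (g :* r) :* n) refl [ suc (x + y + k) ]ₜ [ x + k ]ₜ! (rise (suc k) y) [ k ]ₜ! ⟩
    [ x + k ]ₜ! *ₚ ([ k ]ₜ! *ₚ rise (suc k) y) *ₚ [ suc (x + y + k) ]ₜ
      ≈⟨ *-congʳ {[ suc (x + y + k) ]ₜ} (*-congˡ {[ x + k ]ₜ!} (factorial-rise y k)) ⟩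
    [ x + k ]ₜ! *ₚ [ y + k ]ₜ! *ₚ [ suc (x + y + k) ]ₜ ∎))))
eCoeff-quotient′ ℓ zero zero zero = quotient-≡ ℓ 0 0 0 ≡.refl ≡.refl ≡.refl
  (inj₁ (≡.refl , coeff-≡ (parts ℓ 0 0 0 1ₚ 1ₚ 1ₚ 1ₚ refl)))
eCoeff-quotient′ ℓ zero (suc y) zero = quotient-≡ ℓ 0 (suc y) 0 ≡.refl (ℕ.+-identityʳ (suc y)) (ℕ.+-identityʳ (suc y))
  (inj₁ (≡.refl , coeff-≡ (parts ℓ 0 (suc y) 0 1ₚ [ y ]ₜ! [ suc y ]ₜ 1ₚ (begin
    [ suc y + 0 ]ₜ! *ₚ 1ₚ                 ≡⟨ cong (λ i → [ i ]ₜ! *ₚ 1ₚ) (ℕ.+-identityʳ (suc y)) ⟩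
    [ y ]ₜ! *ₚ [ suc y ]ₜ *ₚ 1ₚ           ≈⟨ solve 2 (λ f n → f :* n :* con 1 := con 1 :* f :* n) refl [ y ]ₜ! [ suc y ]ₜ ⟩
    1ₚ *ₚ [ y ]ₜ! *ₚ [ suc y ]ₜ           ∎))))
eCoeff-quotient′ ℓ (suc x) zero zero = quotient-≡ ℓ (suc x) 0 0 (ℕ.+-identityʳ (suc x)) ≡.refl
  (≡.trans (ℕ.+-identityʳ (suc x + 0)) (ℕ.+-identityʳ (suc x)))
  (inj₁ (≡.refl , coeff-≡ (parts ℓ (suc x) 0 0 [ x ]ₜ! 1ₚ [ suc x ]ₜ 1ₚ (begin
    [ suc x + 0 ]ₜ! *ₚ 1ₚ                 ≡⟨ cong (λ i → [ i ]ₜ! *ₚ 1ₚ) (ℕ.+-identityʳ (suc x)) ⟩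
    [ x ]ₜ! *ₚ [ suc x ]ₜ *ₚ 1ₚ           ≈⟨ solve 2 (λ f n → f :* n :* con 1 := f :* con 1 :* n) refl [ x ]ₜ! [ suc x ]ₜ ⟩
    [ x ]ₜ! *ₚ 1ₚ *ₚ [ suc x ]ₜ           ∎))))
eCoeff-quotient′ ℓ (suc x) (suc y) zero = quotient-≡ ℓ (suc x) (suc y) 0
  (ℕ.+-identityʳ (suc x)) (ℕ.+-identityʳ (suc y)) (ℕ.+-identityʳ (suc x + suc y))
  (inj₂ (ℤ.-<+ , coeff-≡ (vanishes ℓ)))
  where
  vanishes : ∀ ℓ → eCoeff ℓ (ℓ + suc x) 0 (ℓ + suc y) ≋ 0ₚ
  vanishes zero    = solve 2 (λ n f → n :* (f :* con 0) := con 0) refl [ suc (suc (x + y + 0)) ]ₜ [ x + 0 ]ₜ!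
  vanishes (suc ℓ) = trans (*-congˡ {1ₚ} (*-congˡ {A} (*-congˡ {B} (vanishes ℓ))))
    (solve 2 (λ a b → con 1 :* (a :* (b :* con 0)) := con 0) refl A B)
    where
    A = [ suc (ℓ + suc x) ]ₜ
    B = [ suc (ℓ + suc y) ]ₜ

eCoeff-quotient : ∀ a m b ℓ → ℓ ≤ b ⊓ a →
  eCoeff ℓ a m b IsQuotientOf numerator (a + (m + b)) (a + m) a ℓ by denominator (a + (m + b)) (a + m) a ℓ
eCoeff-quotient a m b ℓ ℓ≤ = ≡.subst₂ (λ a b → eCoeff ℓ a m b IsQuotientOf
    numerator (a + (m + b)) (a + m) a ℓ by denominator (a + (m + b)) (a + m) a ℓ)
  (ℕ.m+[n∸m]≡n (ℕ.≤-trans ℓ≤ (ℕ.m⊓n≤n b a))) (ℕ.m+[n∸m]≡n (ℕ.≤-trans ℓ≤ (ℕ.m⊓n≤m b a)))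
  (eCoeff-quotient′ ℓ (a ∸ ℓ) (b ∸ ℓ) m)

-- Symmetric unimodal polynomials

-- Extending the coefficients by 0 to all integer indices frees shifts and reflections from boundary
-- cases.
coeffℤ : Poly → ℤ → ℤ
coeffℤ p (+ i)    = coeff p i
coeffℤ p -[1+ i ] = 0ℤ

coeffℤ-cong : ∀ {p q} → p ≋ q → ∀ i → coeffℤ p i ≡ coeffℤ q i
coeffℤ-cong p≋q (+ i)    = coeff-≡ p≋q i
coeffℤ-cong p≋q -[1+ i ] = ≡.refl

coeffℤ-0 : ∀ i → coeffℤ 0ₚ i ≡ 0ℤ
coeffℤ-0 (+ i)    = ≡.refl
coeffℤ-0 -[1+ i ] = ≡.refl

coeffℤ-+ : ∀ p q i → coeffℤ (p +ₚ q) i ≡ coeffℤ p i ℤ.+ coeffℤ q i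
coeffℤ-+ p q (+ i)    = coeff-+ p q i
coeffℤ-+ p q -[1+ i ] = ≡.refl

coeffℤ-t : ∀ p i → coeffℤ (t *ₚ p) i ≡ coeffℤ p (ℤ.pred i)
coeffℤ-t p i = ≡.trans (coeffℤ-cong (sym (t-shift p)) i) (shift i)
  where
  shift : ∀ i → coeffℤ (0ℤ ∷ p) i ≡ coeffℤ p (ℤ.pred i)
  shift (+ zero)  = ≡.refl
  shift (+ suc i) = ≡.refl
  shift -[1+ i ]  = ≡.refl

coeffℤ-t^ : ∀ k p i → coeffℤ (t^ k *ₚ p) i ≡ coeffℤ p (i ℤ.- + k)
coeffℤ-t^ zero    p i = ≡.trans (coeffℤ-cong (*-identityˡ p) i) (cong (coeffℤ p) (≡.sym (ℤ.+-identityʳ i)))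
coeffℤ-t^ (suc k) p i = ≡.trans
  (coeffℤ-cong (trans (*-congʳ {p} (t^-suc k)) (*-assoc t (t^ k) p)) i)
  (≡.trans (coeffℤ-t (t^ k *ₚ p) i)
    (≡.trans (coeffℤ-t^ k p (ℤ.pred i)) (cong (coeffℤ p) (index i (+ k)))))
  where
  index : ∀ i k → ℤ.- 1ℤ ℤ.+ i ℤ.- k ≡ i ℤ.- (1ℤ ℤ.+ k)
  index = solveℤ-∀

coeffℤ-[suc] : ∀ k p i → coeffℤ ([ suc k ]ₜ *ₚ p) i ≡ coeffℤ p i ℤ.+ coeffℤ ([ k ]ₜ *ₚ p) (ℤ.pred i)
coeffℤ-[suc] k p i = ≡.trans
  (coeffℤ-cong (trans (*-congʳ {p} ([suc] k)) (solve 3 (λ t n p → (con 1 :+ t :* n) :* p := p :+ t :* (n :* p)) refl t [ k ]ₜ p)) i)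
  (≡.trans (coeffℤ-+ p (t *ₚ ([ k ]ₜ *ₚ p)) i) (cong (λ c → coeffℤ p i ℤ.+ c) (coeffℤ-t ([ k ]ₜ *ₚ p) i)))

coeffℤ-[suc]′ : ∀ k p i → coeffℤ ([ suc k ]ₜ *ₚ p) i ≡ coeffℤ p (i ℤ.- + k) ℤ.+ coeffℤ ([ k ]ₜ *ₚ p) i
coeffℤ-[suc]′ k p i = ≡.trans
  (coeffℤ-cong (trans (*-congʳ {p} ([suc]′ k)) (solve 3 (λ n t p → (n :+ t) :* p := t :* p :+ n :* p) refl [ k ]ₜ (t^ k) p)) i)
  (≡.trans (coeffℤ-+ (t^ k *ₚ p) ([ k ]ₜ *ₚ p) i) (cong (λ c → c ℤ.+ coeffℤ ([ k ]ₜ *ₚ p) i) (coeffℤ-t^ k p i)))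

-- The center is d/2. In `increasing` the index j may lie beyond the center, as long as it is no
-- farther from it than i; this form, stronger on its face than growth up to the center, is what the
-- window argument of `SU-[]` uses.
record SymmetricUnimodal (d : ℤ) (p : Poly) : Set where
  field
    nonneg      : ∀ i → 0ℤ ℤ.≤ coeffℤ p i
    palindromic : ∀ i j → i ℤ.+ j ≡ d → coeffℤ p i ≡ coeffℤ p j
    increasing  : ∀ i j → i ℤ.≤ j → i ℤ.+ j ℤ.≤ d → coeffℤ p i ℤ.≤ coeffℤ p j
open SymmetricUnimodal

SU-resp : ∀ {d p q} → p ≋ q → SymmetricUnimodal d p → SymmetricUnimodal d q
SU-resp p≋q su = record
  { nonneg      = λ i → ≡.subst (0ℤ ℤ.≤_) (coeffℤ-cong p≋q i) (nonneg su i)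
  ; palindromic = λ i j eq → ≡.trans (≡.sym (coeffℤ-cong p≋q i)) (≡.trans (palindromic su i j eq) (coeffℤ-cong p≋q j))
  ; increasing  = λ i j i≤j le → ≡.subst₂ ℤ._≤_ (coeffℤ-cong p≋q i) (coeffℤ-cong p≋q j) (increasing su i j i≤j le)
  }

SU-0 : ∀ d → SymmetricUnimodal d 0ₚ
SU-0 d = record
  { nonneg      = λ i → ℤ.≤-reflexive (≡.sym (coeffℤ-0 i))
  ; palindromic = λ i j _ → ≡.trans (coeffℤ-0 i) (≡.sym (coeffℤ-0 j))
  ; increasing  = λ i j _ _ → ℤ.≤-reflexive (≡.trans (coeffℤ-0 i) (≡.sym (coeffℤ-0 j)))
  }

SU-1 : SymmetricUnimodal 0ℤ 1ₚ
SU-1 = record { nonneg = nonneg₁ ; palindromic = palindromic₁ ; increasing = increasing₁ }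
  where
  nonneg₁ : ∀ i → 0ℤ ℤ.≤ coeffℤ 1ₚ i
  nonneg₁ (+ zero)  = ℤ.+≤+ z≤n
  nonneg₁ (+ suc i) = ℤ.≤-refl
  nonneg₁ -[1+ i ]  = ℤ.≤-refl

  palindromic₁ : ∀ i j → i ℤ.+ j ≡ 0ℤ → coeffℤ 1ₚ i ≡ coeffℤ 1ₚ j
  palindromic₁ (+ zero)  (+ zero)  _ = ≡.refl
  palindromic₁ (+ suc i) (+ suc j) _ = ≡.refl
  palindromic₁ (+ suc i) -[1+ j ]  _ = ≡.refl
  palindromic₁ -[1+ i ]  (+ suc j) _ = ≡.refl
  palindromic₁ -[1+ i ]  -[1+ j ]  _ = ≡.refl

  increasing₁ : ∀ i j → i ℤ.≤ j → i ℤ.+ j ℤ.≤ 0ℤ → coeffℤ 1ₚ i ℤ.≤ coeffℤ 1ₚ j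
  increasing₁ (+ zero)  (+ zero)  _ _           = ℤ.≤-refl
  increasing₁ (+ zero)  (+ suc j) _ (ℤ.+≤+ ())
  increasing₁ (+ suc i) j         _ _           = nonneg₁ j
  increasing₁ -[1+ i ]  j         _ _           = nonneg₁ j

SU-t^ : ∀ k {d p} → SymmetricUnimodal d p → SymmetricUnimodal (d ℤ.+ (+ k ℤ.+ + k)) (t^ k *ₚ p)
SU-t^ k {d} {p} su = record
  { nonneg      = λ i → ≡.subst (0ℤ ℤ.≤_) (≡.sym (coeffℤ-t^ k p i)) (nonneg su (i ℤ.- + k))
  ; palindromic = λ i j eq → ≡.trans (coeffℤ-t^ k p i) (≡.trans
      (palindromic su (i ℤ.- + k) (j ℤ.- + k) (≡.trans (shift i j (+ k)) (≡.trans (cong (ℤ._- (+ k ℤ.+ + k)) eq) (cancel d (+ k)))))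
      (≡.sym (coeffℤ-t^ k p j)))
  ; increasing  = λ i j i≤j le → ≡.subst₂ ℤ._≤_ (≡.sym (coeffℤ-t^ k p i)) (≡.sym (coeffℤ-t^ k p j))
      (increasing su (i ℤ.- + k) (j ℤ.- + k) (ℤ.+-monoˡ-≤ (ℤ.- (+ k)) i≤j)
        (≡.subst₂ ℤ._≤_ (≡.sym (shift i j (+ k))) (cancel d (+ k)) (ℤ.+-monoˡ-≤ (ℤ.- (+ k ℤ.+ + k)) le)))
  }
  where
  shift : ∀ i j k → (i ℤ.- k) ℤ.+ (j ℤ.- k) ≡ (i ℤ.+ j) ℤ.- (k ℤ.+ k)
  shift = solveℤ-∀
  cancel : ∀ d k → d ℤ.+ (k ℤ.+ k) ℤ.- (k ℤ.+ k) ≡ d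
  cancel = solveℤ-∀

-- The coefficients of [k+1]p are window sums of those of p; compare the window
-- ending at j, split as p_j plus a shorter window, with the one ending at i,
-- split as a shorter window plus p_{i-k}.
SU-[] : ∀ k {d p} → SymmetricUnimodal d p → SymmetricUnimodal (d ℤ.+ + k ℤ.- 1ℤ) ([ k ]ₜ *ₚ p)
SU-[] zero            su = SU-0 _
SU-[] (suc k) {d} {p} su = record
  { nonneg      = λ i → ≡.subst (0ℤ ℤ.≤_) (≡.sym (coeffℤ-[suc] k p i))
      (ℤ.+-mono-≤ (nonneg su i) (nonneg IH (ℤ.pred i)))
  ; palindromic = λ i j eq → ≡.trans (coeffℤ-[suc] k p i) (≡.trans
      (cong₂ ℤ._+_
        (palindromic su i (j ℤ.- + k) (≡.trans (outer i j (+ k)) (≡.trans (cong (ℤ._- + k) eq) (outer-d d (+ k)))))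
        (palindromic IH (ℤ.pred i) j (≡.trans (innerˡ i j) (≡.trans (cong (ℤ._- 1ℤ) eq) (inner-d d (+ k))))))
      (≡.sym (coeffℤ-[suc]′ k p j)))
  ; increasing  = λ i j i≤j le → grows i j i≤j le (i ℤ.≟ j)
  }
  where
  IH : SymmetricUnimodal (d ℤ.+ + k ℤ.- 1ℤ) ([ k ]ₜ *ₚ p)
  IH = SU-[] k su

  outer : ∀ i j k → i ℤ.+ (j ℤ.- k) ≡ (i ℤ.+ j) ℤ.- k
  outer = solveℤ-∀
  outer′ : ∀ i j k → (i ℤ.- k) ℤ.+ j ≡ (i ℤ.+ j) ℤ.- k
  outer′ = solveℤ-∀
  outer-d : ∀ d k → d ℤ.+ (1ℤ ℤ.+ k) ℤ.- 1ℤ ℤ.- k ≡ d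
  outer-d = solveℤ-∀
  innerˡ : ∀ i j → (ℤ.- 1ℤ ℤ.+ i) ℤ.+ j ≡ (i ℤ.+ j) ℤ.- 1ℤ
  innerˡ = solveℤ-∀
  innerʳ : ∀ i j → i ℤ.+ (ℤ.- 1ℤ ℤ.+ j) ≡ (i ℤ.+ j) ℤ.- 1ℤ
  innerʳ = solveℤ-∀
  inner-d : ∀ d k → d ℤ.+ (1ℤ ℤ.+ k) ℤ.- 1ℤ ℤ.- 1ℤ ≡ d ℤ.+ k ℤ.- 1ℤ
  inner-d = solveℤ-∀

  grows : ∀ i j → i ℤ.≤ j → i ℤ.+ j ℤ.≤ d ℤ.+ + suc k ℤ.- 1ℤ → Dec (i ≡ j) →
    coeffℤ ([ suc k ]ₜ *ₚ p) i ℤ.≤ coeffℤ ([ suc k ]ₜ *ₚ p) j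
  grows i j i≤j le (yes ≡.refl) = ℤ.≤-refl
  grows i j i≤j le (no i≢j) = ≡.subst₂ ℤ._≤_ (≡.sym (coeffℤ-[suc]′ k p i)) (≡.sym (coeffℤ-[suc] k p j))
    (ℤ.+-mono-≤
      (increasing su (i ℤ.- + k) j (ℤ.i≤j⇒i-k≤j (+ k) i≤j)
        (≡.subst₂ ℤ._≤_ (≡.sym (outer′ i j (+ k))) (outer-d d (+ k)) (ℤ.+-monoˡ-≤ (ℤ.- (+ k)) le)))
      (increasing IH i (ℤ.pred j) (ℤ.i<j⇒i≤pred[j] (ℤ.≤∧≢⇒< i≤j i≢j))
        (≡.subst₂ ℤ._≤_ (≡.sym (innerʳ i j)) (inner-d d (+ k)) (ℤ.+-monoˡ-≤ (ℤ.- 1ℤ) le))))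

SU-[suc] : ∀ k {d p} → SymmetricUnimodal (+ d) p → SymmetricUnimodal (+ (k + d)) ([ suc k ]ₜ *ₚ p)
SU-[suc] k {d} {p} su = ≡.subst (λ c → SymmetricUnimodal c ([ suc k ]ₜ *ₚ p)) (center (+ d) (+ k)) (SU-[] (suc k) su)
  where
  center : ∀ d k → d ℤ.+ (1ℤ ℤ.+ k) ℤ.- 1ℤ ≡ k ℤ.+ d
  center = solveℤ-∀

-- The binomial coefficient n over 2 in a form that unfolds; it is the degree of `[ n ]ₜ!`.
triangle : ℕ → ℕ
triangle zero    = 0
triangle (suc n) = n + triangle n

triangle-+ : ∀ x y → triangle (x + y) ≡ triangle x + triangle y + x * y
triangle-+ zero    y = ≡.sym (ℕ.+-identityʳ _)
triangle-+ (suc x) y = ≡.trans (cong (λ c → x + y + c) (triangle-+ x y)) (rearrange x y (triangle x) (triangle y))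
  where
  rearrange : ∀ x y a b → x + y + (a + b + x * y) ≡ x + a + b + (y + x * y)
  rearrange = solve-∀

nC2≡triangle : ∀ n → n C 2 ≡ triangle n
nC2≡triangle zero    = ≡.refl
nC2≡triangle (suc n) = ≡.trans (≡.sym (nCk+nC[k+1]≡[n+1]C[k+1] n 1)) (cong₂ _+_ (nC1≡n n) (nC2≡triangle n))

-- Opaque, so that the equality proof produced by the ring solver is never evaluated.
opaque
  recenter : ∀ {c d p} → c ≡ d → SymmetricUnimodal (+ c) p → SymmetricUnimodal (+ d) p
  recenter ≡.refl su = su

SU-factorial : ∀ n {d p} → SymmetricUnimodal (+ d) p → SymmetricUnimodal (+ (triangle n + d)) ([ n ]ₜ! *ₚ p)
SU-factorial zero    {d} {p} su = SU-resp (sym (*-identityˡ p)) su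
SU-factorial (suc n) {d} {p} su = recenter (≡.sym (ℕ.+-assoc n (triangle n) d))
  (SU-resp (solve 3 (λ x f p → x :* (f :* p) := f :* x :* p) refl [ suc n ]ₜ [ n ]ₜ! p) (SU-[suc] n (SU-factorial n su)))

SU-factorial′ : ∀ n → SymmetricUnimodal (+ triangle n) [ n ]ₜ!
SU-factorial′ n = recenter (ℕ.+-identityʳ _)
  (SU-resp (*-identityʳ [ n ]ₜ!) (SU-factorial n {0} SU-1))

SU-rise : ∀ y k → SymmetricUnimodal (+ (y * k + triangle y)) (rise (suc k) y)
SU-rise zero    k = SU-1
SU-rise (suc y) k = recenter (rearrange k y (triangle y)) (SU-[suc] k (SU-rise y (suc k)))
  where
  rearrange : ∀ k y a → k + (y * suc k + a) ≡ suc y * k + (y + a)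
  rearrange = solve-∀

-- All pairs of vertices except the low-high ones; half of this number is the common center of all
-- the coefficients.
edges : ℕ → ℕ → ℕ → ℕ
edges a m b = triangle a + triangle m + triangle b + a * m + m * b

SU-tail : ∀ x y m → SymmetricUnimodal (+ edges x m y) (tail x y m)
SU-tail zero y m = recenter
  (≡.trans (triangle-+ y m) (rearrange (triangle y) (triangle m) y m)) (SU-factorial′ (y + m))
  where
  rearrange : ∀ p q y m → p + q + y * m ≡ q + p + 0 + m * y
  rearrange = solve-∀
SU-tail (suc x) zero m = recenter
  (≡.trans (triangle-+ (suc x) m) (rearrange (triangle (suc x)) (triangle m) x m)) (SU-factorial′ (suc x + m))
  where
  rearrange : ∀ p q x m → p + q + suc x * m ≡ p + q + 0 + suc x * m + m * 0
  rearrange = solve-∀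
SU-tail (suc x) (suc y) zero = SU-resp (sym (solve 2 (λ n f → n :* (f :* con 0) := con 0) refl
  [ suc (suc (x + y + 0)) ]ₜ [ x + 0 ]ₜ!)) (SU-0 _)
SU-tail (suc x) (suc y) (suc k) = recenter
  (≡.trans (cong (λ c → suc (x + y + suc k) + (c + (suc y * k + triangle (suc y)))) (triangle-+ x (suc k)))
    (rearrange x y k (triangle x) (triangle y) (triangle k)))
  (SU-[suc] (suc (x + y + suc k)) (SU-factorial (x + suc k) (SU-rise (suc y) k)))
  where
  rearrange : ∀ x y k p q r →
    suc (x + y + suc k) + (p + (k + r) + x * suc k + (suc y * k + (y + q))) ≡
    x + p + (k + r) + (y + q) + suc x * suc k + suc k * suc y
  rearrange = solve-∀

-- A further low and a further high vertex add a + m and b + m edges. The factor t^m [a+1] [b+1] of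
-- the recursion raises d by 2m + a + b, the same amount.
SU-eCoeff : ∀ ℓ a m b → SymmetricUnimodal (+ edges a m b) (eCoeff ℓ a m b)
SU-eCoeff zero    a       m b       = SU-tail a b m
SU-eCoeff (suc ℓ) zero    m b       = SU-0 _
SU-eCoeff (suc ℓ) (suc a) m zero    = SU-0 _
SU-eCoeff (suc ℓ) (suc a) m (suc b) = recenter
  (rearrange a m b (triangle a) (triangle m) (triangle b))
  (SU-t^ m (SU-[suc] a (SU-[suc] b (SU-eCoeff ℓ a m b))))
  where
  rearrange : ∀ a m b p q r → a + (b + (p + q + r + a * m + m * b)) + (m + m) ≡
    a + p + q + (b + r) + suc a * m + m * suc b
  rearrange = solve-∀

nC2≡edges : ∀ a m b → (a + (m + b)) C 2 ≡ edges a m b + b * a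
nC2≡edges a m b = ≡.trans (nC2≡triangle (a + (m + b))) (≡.trans (triangle-+ a (m + b))
  (≡.trans (cong (λ c → triangle a + c + a * (m + b)) (triangle-+ m b)) (rearrange a m b (triangle a) (triangle m) (triangle b))))
  where
  rearrange : ∀ a m b p q r → p + (q + r + m * b) + a * (m + b) ≡ p + q + r + a * m + m * b + b * a
  rearrange = solve-∀

-- Expansions into two-part elementary symmetric functions

coeffℤ-· : ∀ c p i → coeffℤ (c ·ₚ p) i ≡ coeffℤ p i ℤ.* c
coeffℤ-· c p (+ i)    = ≡.trans (coeff-· c p i) (ℤ.*-comm c (coeff p i))
coeffℤ-· c p -[1+ i ] = ≡.refl

coeffℤ-sumₚ : ∀ {A : Set} (f : A → Poly) xs i → coeffℤ (sumₚ (map f xs)) i ≡ sumℤ (map (λ x → coeffℤ (f x) i) xs)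
coeffℤ-sumₚ f []       i = coeffℤ-0 i
coeffℤ-sumₚ f (x ∷ xs) i = ≡.trans (coeffℤ-+ (f x) (sumₚ (map f xs)) i) (cong (λ s → coeffℤ (f x) i ℤ.+ s) (coeffℤ-sumₚ f xs i))

coeffₜ≡coeffℤ : ∀ F i α → coeffₜ F i α ≡ coeffℤ (F α) i
coeffₜ≡coeffℤ F (+ i)    α = ≡.refl
coeffₜ≡coeffℤ F -[1+ i ] α = ≡.refl

combination : ℕ → ℕ → (ℕ → ℤ) → Series
combination n k c α = sumℤ (map (λ ℓ → c ℓ ℤ.* e (n ∸ ℓ ∷ ℓ ∷ []) α) (upTo (suc k)))

combination-cong : ∀ n k {c d} → (∀ ℓ → c ℓ ≡ d ℓ) → ∀ α → combination n k c α ≡ combination n k d α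
combination-cong n k c≡d α = cong sumℤ (List.map-cong (λ ℓ → cong (ℤ._* e (n ∸ ℓ ∷ ℓ ∷ []) α) (c≡d ℓ)) (upTo (suc k)))

combination-- : ∀ n k c d α → combination n k c α ℤ.- combination n k d α ≡ combination n k (λ ℓ → c ℓ ℤ.- d ℓ) α
combination-- n k c d α = go (upTo (suc k))
  where
  E : ℕ → ℤ
  E ℓ = e (n ∸ ℓ ∷ ℓ ∷ []) α
  step : ∀ c d x y z → c ℤ.* x ℤ.+ y ℤ.- (d ℤ.* x ℤ.+ z) ≡ (c ℤ.- d) ℤ.* x ℤ.+ (y ℤ.- z)
  step = solveℤ-∀
  go : ∀ xs → sumℤ (map (λ ℓ → c ℓ ℤ.* E ℓ) xs) ℤ.- sumℤ (map (λ ℓ → d ℓ ℤ.* E ℓ) xs)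
              ≡ sumℤ (map (λ ℓ → (c ℓ ℤ.- d ℓ) ℤ.* E ℓ) xs)
  go []       = ≡.refl
  go (ℓ ∷ xs) = ≡.trans (step (c ℓ) (d ℓ) (E ℓ) (sumℤ (map (λ ℓ → c ℓ ℤ.* E ℓ) xs)) (sumℤ (map (λ ℓ → d ℓ ℤ.* E ℓ) xs)))
    (cong (λ s → (c ℓ ℤ.- d ℓ) ℤ.* E ℓ ℤ.+ s) (go xs))

coeffℤ-twoPartSum : ∀ n k K α i → coeffℤ (twoPartSum n k K α) i ≡ combination n k (λ ℓ → coeffℤ (K ℓ) i) α
coeffℤ-twoPartSum n k K α i = ≡.trans (coeffℤ-sumₚ _ (upTo (suc k)) i)
  (cong sumℤ (List.map-cong (λ ℓ → coeffℤ-· (e (n ∸ ℓ ∷ ℓ ∷ []) α) (K ℓ) i) (upTo (suc k))))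

-- A partition has no part 0, so e_(n,0) must be indexed by a single part.
twoPart : ℕ → ℕ → List ℕ
twoPart n zero    = n ∷ []
twoPart n (suc ℓ) = n ∸ suc ℓ ∷ suc ℓ ∷ []

e-twoPart : ∀ n ℓ α → e (twoPart n ℓ) α ≡ e (n ∸ ℓ ∷ ℓ ∷ []) α
e-twoPart n zero    α = ≡.trans (e-one n α) (≡.sym (e-two n 0 α))
e-twoPart n (suc ℓ) α = ≡.refl

twoPart-isPartition : ∀ n ℓ → 1 ≤ n → ℓ + ℓ ≤ n → IsPartition (twoPart n ℓ)
twoPart-isPartition n zero    1≤n _  = [-] , 1≤n ∷ []
twoPart-isPartition n (suc ℓ) 1≤n le = ℓ≤ ∷ [-] , ℕ.≤-trans (s≤s z≤n) ℓ≤ ∷ s≤s z≤n ∷ []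
  where
  ℓ≤ : suc ℓ ≤ n ∸ suc ℓ
  ℓ≤ = ℕ.m+n≤o⇒m≤o∸n (suc ℓ) le

-- The bound on k gives ℓ ≤ n - ℓ throughout the sum, so its index lists are partitions.
combination-positive : ∀ n k c f → 1 ≤ n → k + k ≤ n → (∀ ℓ → 0ℤ ℤ.≤ c ℓ) →
  (∀ α → f α ≡ combination n k c α) → EPositiveSeries f
combination-positive n k c f 1≤n k+k≤n c≥0 f≡ =
  map (λ ℓ → c ℓ , twoPart n ℓ) (upTo (suc k)) ,
  All.map⁺ (All.applyUpTo⁺₁ id (suc k) λ { {ℓ} (s≤s ℓ≤k) →
    c≥0 ℓ , twoPart-isPartition n ℓ 1≤n (ℕ.≤-trans (ℕ.+-mono-≤ ℓ≤k ℓ≤k) k+k≤n) }) ,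
  λ α → ≡.trans (f≡ α) (cong sumℤ (≡.trans
    (List.map-cong (λ ℓ → cong (c ℓ ℤ.*_) (≡.sym (e-twoPart n ℓ α))) (upTo (suc k)))
    (List.map-∘ {g = λ (x , μ) → x ℤ.* e μ α} {f = λ ℓ → c ℓ , twoPart n ℓ} (upTo (suc k)))))

-- Unnormalised fractions are compared by cross-multiplication; x/2 + x/2 has denominator 4, the
-- factor to be cancelled.
half-sum : ∀ i j x → (i ℚᵘ./ 1) ℚᵘ.+ (j ℚᵘ./ 1) ℚᵘ.≃ (x ℚᵘ./ 2) ℚᵘ.+ (x ℚᵘ./ 2) → i ℤ.+ j ≡ x
half-sum i j x (ℚᵘ.*≡* eq) = ℤ.*-cancelʳ-≡ (i ℤ.+ j) x (+ 4) (≡.trans (lhs i j) (≡.trans eq (rhs x)))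
  where
  lhs : ∀ i j → (i ℤ.+ j) ℤ.* + 4 ≡ (i ℤ.* + 1 ℤ.+ j ℤ.* + 1) ℤ.* + 4
  lhs = solveℤ-∀
  rhs : ∀ x → (x ℤ.* + 2 ℤ.+ x ℤ.* + 2) ℤ.* + 1 ≡ x ℤ.* + 4
  rhs = solveℤ-∀

-- The strict inequality 2i < x supplies the 1 by which `increasing` applies to the neighbours i and
-- i + 1.
below-half : ∀ i x → (+ i ℚᵘ./ 1) ℚᵘ.< (x ℚᵘ./ 2) → + i ℤ.+ + suc i ℤ.≤ x
below-half i x (ℚᵘ.*<* lt) = ≡.subst₂ ℤ._≤_ (lhs (+ i)) (ℤ.*-identityʳ x) (ℤ.i<j⇒suc[i]≤j lt)
  where
  lhs : ∀ i → 1ℤ ℤ.+ i ℤ.* + 2 ≡ i ℤ.+ (1ℤ ℤ.+ i)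
  lhs = solveℤ-∀

module _ (n k : ℕ) (K : ℕ → Poly) (d : ℤ) (su : ∀ ℓ → SymmetricUnimodal d (K ℓ)) (F : Seriesₜ)
         (F≋ : ∀ α → F α ≋ twoPartSum n k K α) where

  coeffₜ≡combination : ∀ i α → coeffₜ F i α ≡ combination n k (λ ℓ → coeffℤ (K ℓ) i) α
  coeffₜ≡combination i α = ≡.trans (coeffₜ≡coeffℤ F i α) (≡.trans (coeffℤ-cong (F≋ α) i) (coeffℤ-twoPartSum n k K α i))

  palindromicSeries : Palindromic F (d ℚᵘ./ 2)
  palindromicSeries i j eq α = ≡.trans (coeffₜ≡combination i α) (≡.trans
    (combination-cong n k (λ ℓ → palindromic (su ℓ) i j (half-sum i j d eq)) α)
    (≡.sym (coeffₜ≡combination j α)))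

  module _ (1≤n : 1 ≤ n) (k+k≤n : k + k ≤ n) where

    ePositive : EPositive F
    ePositive i = combination-positive n k _ _ 1≤n k+k≤n (λ ℓ → nonneg (su ℓ) (+ i)) (coeffₜ≡combination (+ i))

    eUnimodal : EUnimodal F (d ℚᵘ./ 2)
    eUnimodal = palindromicSeries , λ i i<c → combination-positive n k _ _ 1≤n k+k≤n
      (λ ℓ → ℤ.i≤j⇒0≤j-i (increasing (su ℓ) (+ i) (+ suc i) (ℤ.+≤+ (ℕ.n≤1+n i)) (below-half i d i<c)))
      (λ α → ≡.trans (cong₂ ℤ._-_ (coeffₜ≡combination (+ suc i) α) (coeffₜ≡combination (+ i) α))
        (combination-- n k (λ ℓ → coeffℤ (K ℓ) (+ suc i)) (λ ℓ → coeffℤ (K ℓ) (+ i)) α))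

-- Assembly from the block sizes

Conclusion : ∀ n → (r s : ℕ) → Graph n → ℕ → Set
Conclusion n r s G b =
  (∃ λ (K : ℕ → Poly) →
    (∀ ℓ → ℓ ≤ b ⊓ s → K ℓ IsQuotientOf numerator n r s ℓ by denominator n r s ℓ)
    × chromaticQSym G ≈ₛ twoPartSum n (b ⊓ s) K)
  × EPositive (chromaticQSym G)
  × EUnimodal (chromaticQSym G) ((+ (n C 2) ℤ.- + (b * s)) ℚᵘ./ 2)

-- With n given by an equation, matching on it replaces n in the type of P and everywhere else at
-- once. The theorem is the case a = s, m = r-s, b = n-r.
conclusion : ∀ a m b {n} → n ≡ a + (m + b) → 1 ≤ a → (P : NaturalUnitIntervalOrder n) →
  (∀ i → 1 ≤ i → i ≤ a → NaturalUnitIntervalOrder.m P i ≡ a + m) →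
  (∀ i → a < i → i ≤ n ∸ 1 → NaturalUnitIntervalOrder.m P i ≡ n) →
  Conclusion n (a + m) a (inc P) b
conclusion a m b ≡.refl 1≤a P m-low m-rest =
  ((λ ℓ → eCoeff ℓ a m b) , eCoeff-quotient a m b , λ α → coeff-≡ (F≋ α)) ,
  ePositive n k _ _ (λ ℓ → SU-eCoeff ℓ a m b) F F≋ 1≤n k+k≤n ,
  ≡.subst (λ d → EUnimodal F (d ℚᵘ./ 2)) (≡.sym center)
    (eUnimodal n k _ _ (λ ℓ → SU-eCoeff ℓ a m b) F F≋ 1≤n k+k≤n)
  where
  n = a + (m + b)
  k = b ⊓ a
  F = chromaticQSym (inc P)
  F≋ = chromaticQSym≋twoPartSum a m b P m-low m-rest

  1≤n : 1 ≤ n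
  1≤n = ℕ.≤-trans 1≤a (ℕ.m≤m+n a (m + b))

  k+k≤n : k + k ≤ n
  k+k≤n = ℕ.+-mono-≤ (ℕ.m⊓n≤n b a) (ℕ.≤-trans (ℕ.m⊓n≤m b a) (ℕ.m≤n+m b m))

  center : + (n C 2) ℤ.- + (b * a) ≡ + edges a m b
  center = ≡.trans (cong (λ c → + c ℤ.- + (b * a)) (nC2≡edges a m b)) (cancel (+ edges a m b) (+ (b * a)))
    where
    cancel : ∀ x y → x ℤ.+ y ℤ.- y ≡ x
    cancel = solveℤ-∀

theorem4p2 : (n r s : ℕ) → 1 ≤ r → 1 ≤ s → s ≤ r → r ≤ n ∸ 1 →
    (P : NaturalUnitIntervalOrder n) →
    (∀ i → 1 ≤ i → i ≤ s → NaturalUnitIntervalOrder.m P i ≡ r) →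
    (∀ i → s < i → i ≤ n ∸ 1 → NaturalUnitIntervalOrder.m P i ≡ n) →
    (∃ λ (C : ℕ → Poly) →
    (∀ ℓ → ℓ ≤ (n ∸ r) ⊓ s → C ℓ IsQuotientOf numerator n r s ℓ by denominator n r s ℓ)
    × chromaticQSym (inc P) ≈ₛ twoPartSum n ((n ∸ r) ⊓ s) C)
    × EPositive (chromaticQSym (inc P))
    × EUnimodal (chromaticQSym (inc P)) ((+ (n C 2) ℤ.- + ((n ∸ r) * s)) ℚᵘ./ 2)
theorem4p2 n r s _ 1≤s s≤r r≤n-1 P m-low m-rest with ℕ.m≤n⇒∃[o]m+o≡n s≤r
... | m , ≡.refl = conclusion s m (n ∸ r) n≡ 1≤s P m-low m-rest
  where
  n≡ : n ≡ s + (m + (n ∸ r))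
  n≡ = ≡.trans (≡.sym (ℕ.m+[n∸m]≡n (ℕ.≤-trans r≤n-1 (ℕ.m∸n≤m n 1)))) (ℕ.+-assoc s m (n ∸ r))
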